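{- Let $q\ge 0$ and $s\ge 3$ be integers such that the graph $G=K_1\vee (C_s\cup qK_2)$ has at least $16$ vertices. Then $G$ is determined by its signless Laplacian spectrum, i.e., every simple graph whose signless Laplacian spectrum equals that of $G$ is isomorphic to $G$.
   Context: All graphs are finite, simple and undirected. $K_n$ and $C_n$ denote the complete graph and the cycle on $n$ vertices; $G\cup H$ is the disjoint union, $qK_2$ is the disjoint union of $q$ copies of $K_2$, and $G\vee H$ (join) is obtained from $G\cup H$ by adding all edges between a vertex of $G$ and a vertex of $H$. The signless Laplacian matrix is $Q(G)=D(G)+A(G)$, where $D(G)$ is the diagonal degree matrix and $A(G)$ the adjacency matrix; its spectrum (as a multiset) is the signless Laplacian spectrum ($Q$-spectrum). -}

module Defs where

open import Data.Bool using (Bool; true; false; _∧_; _∨_; if_then_else_)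
open import Data.Bool.Properties using (∨-comm)
open import Data.Nat using (ℕ; zero; suc; _+_; _*_; _∸_; _%_; _<ᵇ_; _≤ᵇ_; _≡ᵇ_)
open import Data.Fin using (Fin; toℕ; punchIn)
import Data.Fin as F
open import Data.Integer using (ℤ; +_; -_; _-_) renaming (_+_ to _+ℤ_; _*_ to _*ℤ_)
open import Data.Product using (Σ; _×_)
open import Function.Bundles using (_↔_; Inverse)
open import Relation.Binary.PropositionalEquality using (_≡_; refl)

record SimpleGraph (n : ℕ) : Set where
  field
    adj    : Fin n → Fin n → Bool
    sym    : ∀ i j → adj i j ≡ adj j i
    irrefl : ∀ i → adj i i ≡ false
open SimpleGraph public

Isomorphic : ∀ {n} → SimpleGraph n → SimpleGraph n → Set
Isomorphic {n} H G =
  Σ (Fin n ↔ Fin n) λ σ →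
    ∀ i j → adj H i j ≡ adj G (Inverse.to σ i) (Inverse.to σ j)

Matrix : ℕ → Set
Matrix n = Fin n → Fin n → ℤ

sumℤ : ∀ {n} → (Fin n → ℤ) → ℤ
sumℤ {zero}  f = + 0
sumℤ {suc n} f = f F.zero +ℤ sumℤ (λ i → f (F.suc i))

sign : ℕ → ℤ
sign zero          = + 1
sign (suc zero)    = - (+ 1)
sign (suc (suc k)) = sign k

det : ∀ {n} → Matrix n → ℤ
det {zero}  M = + 1
det {suc n} M =
  sumℤ (λ j → sign (toℕ j) *ℤ (M F.zero j *ℤ det (λ r c → M (F.suc r) (punchIn j c))))

b2z : Bool → ℤ
b2z true  = + 1
b2z false = + 0

degree : ∀ {n} → SimpleGraph n → Fin n → ℤ
degree G i = sumℤ (λ j → b2z (adj G i j))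

Qmat : ∀ {n} → SimpleGraph n → Matrix n
Qmat G i j = if toℕ i ≡ᵇ toℕ j then degree G i else b2z (adj G i j)

charQ : ∀ {n} → SimpleGraph n → ℤ → ℤ
charQ G x = det (λ i j → (if toℕ i ≡ᵇ toℕ j then x else + 0) - Qmat G i j)

-- Same Q-spectrum (as multisets) ⇔ same characteristic polynomial of Q,
-- and two monic integer polynomials of degree n coincide iff they agree on ℤ.
QCospectral : ∀ {n} → SimpleGraph n → SimpleGraph n → Set
QCospectral G H = ∀ x → charQ G x ≡ charQ H x

-- The graph K_1 ∨ (C_s ∪ qK_2) on vertices 0 .. s+2q:
--   0 is the K_1 vertex, 1..s form the cycle C_s (i ~ i+1, and 1 ~ s),
--   s+1+2t ~ s+2+2t are the q copies of K_2.

relKCK : ℕ → ℕ → ℕ → Bool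
relKCK s a b =
  (a <ᵇ b) ∧
  ( (a ≡ᵇ 0)
  ∨ ((1 ≤ᵇ a) ∧ (b ≤ᵇ s) ∧ ((b ≡ᵇ suc a) ∨ ((a ≡ᵇ 1) ∧ (b ≡ᵇ s))))
  ∨ ((s <ᵇ a) ∧ (((a ∸ suc s) % 2) ≡ᵇ 0) ∧ (b ≡ᵇ suc a)))

adjKCK : ∀ {n} → ℕ → Fin n → Fin n → Bool
adjKCK s i j = relKCK s (toℕ i) (toℕ j) ∨ relKCK s (toℕ j) (toℕ i)

private
  <ᵇ-irrefl : ∀ a → (a <ᵇ a) ≡ false
  <ᵇ-irrefl zero    = refl
  <ᵇ-irrefl (suc a) = <ᵇ-irrefl a

  rel-irrefl : ∀ s a → relKCK s a a ≡ false
  rel-irrefl s a rewrite <ᵇ-irrefl a = refl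

  adj-irrefl : ∀ {n} s (i : Fin n) → adjKCK s i i ≡ false
  adj-irrefl s i rewrite rel-irrefl s (toℕ i) = refl

KCK : (s q : ℕ) → SimpleGraph (1 + s + 2 * q)
KCK s q = record
  { adj    = adjKCK s
  ; sym    = λ i j → ∨-comm (relKCK s (toℕ i) (toℕ j)) (relKCK s (toℕ j) (toℕ i))
  ; irrefl = adj-irrefl s
  }

{-# OPTIONS --safe #-}
-- Write n for the number of vertices, ν = n − 1 = s + 2q, and G for K₁ ∨ (C_s ∪ qK₂).  The characteristic
-- polynomial of Q determines every trace tr Qᵏ.  Let H be cospectral with G.
--
-- The traces with k ≤ 3 are power sums of the degrees d, together with the number of triangles.  Summing
-- (j − d)(d − 2)(d − 3) ≥ 0 over all vertices of H, where j is the largest degree, and bounding the triangles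
-- through a vertex by d(d − 1)/2 (at a vertex of degree j by the number of edges missing it) gives
-- (ν − j)(ν² − 6ν − j + 5) ≤ 2s, which forces j = ν; then all other degrees are 2 or 3.  So H = K₁ ∨ H′ where H′
-- is a union of paths and cycles with 2q vertices of degree 1 and s of degree 2.
--
-- The number 5 is not an eigenvalue of Q(G), whereas two cycles in H′ would give an eigenvector for 5, constant
-- on each of them; so H′ has at most one cycle.  Let μ count the pairs of adjacent vertices of degrees 1 and 2
-- in H′.  The traces of (Q − 3)⁴ and (Q − 3)⁵ show that the 4-cycles and the closed 5-walks of H′, suitably
-- weighted, exceed those of C_s ∪ qK₂ by 2μ and 20μ.  If μ > 0 then H′ has both a 4-cycle and an odd cycle.
-- Hence μ = 0, and H′ is one cycle together with copies of K₂.
module Submission where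

open import Defs renaming (sym to adj-sym; irrefl to adj-irrefl)
open import Data.Nat as ℕ using (ℕ; zero; suc; _!; _≡ᵇ_; _<ᵇ_; _≤ᵇ_)
import Data.Nat.Properties as ℕP
import Data.Nat.DivMod as DivMod
open import Data.Nat.Tactic.RingSolver using () renaming (solve-∀ to ℕ-solve-∀)
open import Data.Integer as ℤ using (ℤ; ∣_∣)
import Data.Integer.Properties as ℤP
open import Data.Integer.Tactic.RingSolver using (solve-∀)
open import Data.Fin as Fin using (Fin; zero; suc; toℕ; punchIn; punchOut)
import Data.Fin.Properties as FinP
open import Data.Fin.Permutation using (Permutation; _⟨$⟩ʳ_; _⟨$⟩ˡ_; inverseˡ; inverseʳ; flip; _∘ₚ_; transpose; permutation; lift₀)
open import Data.Vec.Functional using (_∷_; updateAt; insertAt)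
open import Data.Vec.Functional.Properties using (updateAt-updates; updateAt-minimal; insertAt-lookup; insertAt-punchIn)
open import Data.Bool using (true; false; if_then_else_; _∧_; _∨_; T)
import Data.Bool.Properties as BoolP
open import Data.Product using (Σ; ∃; _×_; _,_; proj₁; proj₂)
open import Data.Sum using (_⊎_; inj₁; inj₂)
open import Data.Empty using (⊥; ⊥-elim)
open import Data.Unit using (tt)
open import Function using (_∘_; const)
open import Function.Bundles using (Equivalence)
open import Relation.Nullary using (¬_; Dec; yes; no; _×-dec_; _⊎-dec_; ¬?)
open import Relation.Binary.Definitions using (tri<; tri≈; tri>)
open import Relation.Binary.PropositionalEquality using (_≡_; _≢_; refl; sym; trans; cong; cong₂; subst)
import Algebra.Properties.CommutativeMonoid.Sum ℤP.+-0-commutativeMonoid as ∑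

-- No eigenvalues occur. Everything happens over ℤ, where cospectrality says only that two functions
-- `charQ` agree at all integers: traces are recovered from the growth of these functions, and
-- having 5 as an eigenvalue becomes the vanishing of the determinant of 5 - Q, decided by integer
-- kernel vectors. As `det` is a bare Laplace recursion, the determinant theory is derived from the
-- uniqueness of alternating forms. Subtracting 3 leaves 0 on the diagonal at vertices of degree 3
-- and -1 at those of degree 2, so closed walks of Q - 3 away from the apex are walks of H′
-- corrected at its leaves only, while the apex enters through row sums. Degrees alone do not
-- exclude longer paths in H′, and the fourth trace alone would still admit a 4-cycle beside such
-- paths. The fifth trace demands closed 5-walks as well; a 4-cycle component is bipartite and
-- carries none, so a second cycle appears, which the number 5 forbids.

-- Finite sums of integers

module Sums where
  open import Data.Integer using (-_; _-_; _+_; _*_) renaming (+_ to pos)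

  0ℤ 1ℤ : ℤ
  0ℤ = pos 0
  1ℤ = pos 1

  sumℤ≡sum : ∀ {n} (f : Fin n → ℤ) → sumℤ f ≡ ∑.sum f
  sumℤ≡sum {zero}  f = refl
  sumℤ≡sum {suc n} f = cong (f zero +_) (sumℤ≡sum (f ∘ suc))

  sum-cong : ∀ {n} {f g : Fin n → ℤ} → (∀ i → f i ≡ g i) → sumℤ f ≡ sumℤ g
  sum-cong {zero}  e = refl
  sum-cong {suc n} e = cong₂ _+_ (e zero) (sum-cong (e ∘ suc))

  sum-const : ∀ n (c : ℤ) → sumℤ {n} (λ _ → c) ≡ pos n * c
  sum-const zero    c = sym (ℤP.*-zeroˡ c)
  sum-const (suc n) c = trans (cong (c +_) (sum-const n c)) (sym (ℤP.suc-* (pos n) c))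

  sum-zero : ∀ {n} {f : Fin n → ℤ} → (∀ i → f i ≡ 0ℤ) → sumℤ f ≡ 0ℤ
  sum-zero {n} e = trans (sum-cong e) (trans (sum-const n 0ℤ) (ℤP.*-zeroʳ (pos n)))

  sum-+ : ∀ {n} (f g : Fin n → ℤ) → sumℤ (λ i → f i + g i) ≡ sumℤ f + sumℤ g
  sum-+ f g = trans (sumℤ≡sum (λ i → f i + g i)) (trans (∑.∑-distrib-+ f g) (sym (cong₂ _+_ (sumℤ≡sum f) (sumℤ≡sum g))))

  sum-swap : ∀ {m n} (f : Fin m → Fin n → ℤ) →
             sumℤ (λ i → sumℤ (f i)) ≡ sumℤ (λ j → sumℤ (λ i → f i j))
  sum-swap {zero}  {n} f = sym (sum-zero {n} (λ _ → refl))
  sum-swap {suc m} f = trans (cong (sumℤ (f zero) +_) (sum-swap (f ∘ suc))) (sym (sum-+ (f zero) _))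

  sum-*ˡ : ∀ {n} c (f : Fin n → ℤ) → sumℤ (λ i → c * f i) ≡ c * sumℤ f
  sum-*ˡ {zero}  c f = sym (ℤP.*-zeroʳ c)
  sum-*ˡ {suc n} c f = trans (cong (c * f zero +_) (sum-*ˡ c (f ∘ suc))) (sym (ℤP.*-distribˡ-+ c (f zero) _))

  sum-*ʳ : ∀ {n} c (f : Fin n → ℤ) → sumℤ (λ i → f i * c) ≡ sumℤ f * c
  sum-*ʳ c f = trans (sum-cong (λ i → ℤP.*-comm (f i) c)) (trans (sum-*ˡ c f) (ℤP.*-comm c _))

  sum-neg : ∀ {n} (f : Fin n → ℤ) → sumℤ (λ i → - f i) ≡ - sumℤ f
  sum-neg {zero}  f = refl
  sum-neg {suc n} f = trans (cong (- f zero +_) (sum-neg (f ∘ suc))) (sym (ℤP.neg-distrib-+ (f zero) _))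

  sum-minus : ∀ {n} (f g : Fin n → ℤ) → sumℤ (λ i → f i - g i) ≡ sumℤ f - sumℤ g
  sum-minus f g = trans (sum-+ f (-_ ∘ g)) (cong (_+_ (sumℤ f)) (sum-neg g))

  sum-single : ∀ {n} (f : Fin n → ℤ) p → (∀ i → i ≢ p → f i ≡ 0ℤ) → sumℤ f ≡ f p
  sum-single f zero e = trans (cong (f zero +_) (sum-zero (λ i → e (suc i) (λ ())))) (ℤP.+-identityʳ _)
  sum-single f (suc p) e =
    trans (cong₂ _+_ (e zero (λ ())) (sum-single (f ∘ suc) p (λ i i≢p → e (suc i) (i≢p ∘ FinP.suc-injective))))
          (ℤP.+-identityˡ _)

  sum-pair : ∀ {n} (f : Fin n → ℤ) p q → p ≢ q → (∀ i → i ≢ p → i ≢ q → f i ≡ 0ℤ) → sumℤ f ≡ f p + f q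
  sum-pair f zero zero p≢q e = ⊥-elim (p≢q refl)
  sum-pair f zero (suc q) _ e =
    cong (f zero +_) (sum-single (f ∘ suc) q (λ i i≢q → e (suc i) (λ ()) (i≢q ∘ FinP.suc-injective)))
  sum-pair f (suc p) zero _ e =
    trans (cong (f zero +_) (sum-single (f ∘ suc) p (λ i i≢p → e (suc i) (i≢p ∘ FinP.suc-injective) (λ ()))))
          (ℤP.+-comm (f zero) (f (suc p)))
  sum-pair f (suc p) (suc q) p≢q e =
    trans (cong₂ _+_ (e zero (λ ()) (λ ()))
            (sum-pair (f ∘ suc) p q (p≢q ∘ cong suc)
              (λ i i≢p i≢q → e (suc i) (i≢p ∘ FinP.suc-injective) (i≢q ∘ FinP.suc-injective))))
          (ℤP.+-identityˡ _)

open Sums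

-- Multilinear and alternating functions of the rows of a matrix

module MultilinearForms where
  open import Data.Integer using (-_; _-_; _+_; _*_) renaming (+_ to pos)

  Rows : ℕ → ℕ → Set
  Rows m n = Fin m → Fin n → ℤ

  _≈_ : ∀ {m n} → Rows m n → Rows m n → Set
  A ≈ B = ∀ i j → A i j ≡ B i j

  infix 4 _≈_

  AgreeOff : ∀ {m n} → Fin m → Rows m n → Rows m n → Set
  AgreeOff i A B = ∀ k → k ≢ i → ∀ j → A k j ≡ B k j

  -- `resp` stands in for function extensionality. `linear` relates three matrices that agree off
  -- one row, instead of going through `setRow`, so that it also applies to matrices built in other
  -- ways, such as with `_∷_`.
  record Multilinear {m n} (F : Rows m n → ℤ) : Set where
    field
      resp   : ∀ {A B} → A ≈ B → F A ≡ F B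
      linear : ∀ {A X Y} i c → AgreeOff i A X → AgreeOff i A Y →
               (∀ j → A i j ≡ c * X i j + Y i j) → F A ≡ c * F X + F Y

  Alternating : ∀ {m n} → (Rows m n → ℤ) → Set
  Alternating F = ∀ A i j → i ≢ j → (∀ k → A i k ≡ A j k) → F A ≡ 0ℤ

  setRow : ∀ {m n} → Rows m n → Fin m → (Fin n → ℤ) → Rows m n
  setRow A i r = updateAt A i (const r)

  setRow-at : ∀ {m n} (A : Rows m n) i r → setRow A i r i ≡ r
  setRow-at A i r = updateAt-updates i A

  setRow-off : ∀ {m n} (A : Rows m n) i r k → k ≢ i → setRow A i r k ≡ A k
  setRow-off A i r k k≢i = updateAt-minimal k i A k≢i

  at : ∀ {n} {r s : Fin n → ℤ} → r ≡ s → ∀ j → r j ≡ s j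
  at refl j = refl

  module MultilinearProperties {m n : ℕ} {F : Rows m n → ℤ} (F-multi : Multilinear F) where
    open Multilinear F-multi

    setRow-linear : ∀ A i c x y →
      F (setRow A i (λ j → c * x j + y j)) ≡ c * F (setRow A i x) + F (setRow A i y)
    setRow-linear A i c x y = linear i c (off x) (off y) λ j →
      trans (at (setRow-at A i _) j)
        (sym (cong₂ (λ u v → c * u + v) (at (setRow-at A i x) j) (at (setRow-at A i y) j)))
      where
      off : ∀ z → AgreeOff i (setRow A i (λ j → c * x j + y j)) (setRow A i z)
      off z k k≢i j = at (trans (setRow-off A i _ k k≢i) (sym (setRow-off A i z k k≢i))) j

    setRow-resp : ∀ A i {x y} → (∀ j → x j ≡ y j) → F (setRow A i x) ≡ F (setRow A i y)
    setRow-resp A i {x} {y} e = resp helper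
      where
      helper : setRow A i x ≈ setRow A i y
      helper k j with k FinP.≟ i
      ... | yes refl = trans (at (setRow-at A i x) j) (trans (e j) (sym (at (setRow-at A i y) j)))
      ... | no k≢i   = at (trans (setRow-off A i x k k≢i) (sym (setRow-off A i y k k≢i))) j

    setRow-self : ∀ A i → F (setRow A i (A i)) ≡ F A
    setRow-self A i = resp helper
      where
      helper : setRow A i (A i) ≈ A
      helper k j with k FinP.≟ i
      ... | yes refl = at (setRow-at A i (A i)) j
      ... | no k≢i   = at (setRow-off A i (A i) k k≢i) j

    setRow-zero : ∀ A i → F (setRow A i (λ _ → 0ℤ)) ≡ 0ℤ
    setRow-zero A i = identity _ (setRow-linear A i 1ℤ (λ _ → 0ℤ) (λ _ → 0ℤ))
      where
      cancel : ∀ x → x ≡ (1ℤ * x + x) - x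
      cancel = solve-∀
      identity : ∀ x → x ≡ 1ℤ * x + x → x ≡ 0ℤ
      identity x e = trans (cancel x) (trans (cong (_- x) (sym e)) (ℤP.+-inverseʳ x))

    setRow-sum : ∀ A i {p} (c : Fin p → ℤ) (v : Rows p n) →
      F (setRow A i (λ k → sumℤ (λ j → c j * v j k))) ≡ sumℤ (λ j → c j * F (setRow A i (v j)))
    setRow-sum A i {zero}  c v = setRow-zero A i
    setRow-sum A i {suc p} c v =
      trans (setRow-linear A i (c zero) (v zero) _)
            (cong (c zero * F (setRow A i (v zero)) +_) (setRow-sum A i (c ∘ suc) (v ∘ suc)))

    swapRows : Fin m → Fin m → Rows m n → Rows m n
    swapRows p q A = setRow (setRow A p (A q)) q (A p)

    -- Polarization: with the sum of rows `p` and `q` placed in both positions the form vanishes,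
    -- and its expansion leaves the two mixed terms. Vanishing is assumed for this one pair of
    -- positions only, so that the lemma already serves forms known to vanish just on equal adjacent
    -- rows.
    swap-neg : ∀ p q → p ≢ q → (∀ A → (∀ k → A p k ≡ A q k) → F A ≡ 0ℤ) →
               ∀ A → F A ≡ - F (swapRows p q A)
    swap-neg p q p≢q alt A = trans (sym Rab) (final (F (R a a)) (F (R a b)) (F (R b a)) (F (R b b)) (R-same a) (R-same b) ab-zero)
      where
      a = A p
      b = A q
      a+b : Fin n → ℤ
      a+b j = 1ℤ * a j + b j
      R : (x y : Fin n → ℤ) → Rows m n
      R x y = setRow (setRow A p x) q y
      R-p : ∀ x y → R x y p ≡ x
      R-p x y = trans (setRow-off _ q y p p≢q) (setRow-at A p x)
      R-same : ∀ x → F (R x x) ≡ 0ℤ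
      R-same x = alt (R x x) (at (trans (R-p x x) (sym (setRow-at _ q x))))
      R-off : ∀ x x′ y → AgreeOff p (R x y) (R x′ y)
      R-off x x′ y k k≢p with k FinP.≟ q
      ... | yes refl = at (trans (setRow-at _ q y) (sym (setRow-at _ q y)))
      ... | no k≢q = at (trans (trans (setRow-off _ q y k k≢q) (setRow-off A p x k k≢p))
                          (sym (trans (setRow-off _ q y k k≢q) (setRow-off A p x′ k k≢p))))
      split : ∀ y → F (R a+b y) ≡ 1ℤ * F (R a y) + F (R b y)
      split y = linear p 1ℤ (R-off a+b a y) (R-off a+b b y) λ j →
        trans (at (R-p a+b y) j) (sym (cong₂ (λ u v → 1ℤ * u + v) (at (R-p a y) j) (at (R-p b y) j)))
      ab-zero : 1ℤ * (1ℤ * F (R a a) + F (R a b)) + (1ℤ * F (R b a) + F (R b b)) ≡ 0ℤ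
      ab-zero = trans (sym (trans (split a+b)
        (cong₂ (λ u v → 1ℤ * u + v) (setRow-linear (setRow A p a) q 1ℤ a b) (setRow-linear (setRow A p b) q 1ℤ a b))))
        (R-same a+b)
      Rab : F (R a b) ≡ F A
      Rab = resp helper
        where
        helper : R a b ≈ A
        helper k j with k FinP.≟ q
        ... | yes refl = at (setRow-at _ q b) j
        ... | no k≢q with k FinP.≟ p
        ...   | yes refl = at (R-p a b) j
        ...   | no k≢p = at (trans (setRow-off _ q b k k≢q) (setRow-off A p a k k≢p)) j
      alg : ∀ x y z w → y ≡ 1ℤ * (1ℤ * x + y) + (1ℤ * z + w) - x - w - z
      alg = solve-∀
      alg′ : ∀ z → 0ℤ - 0ℤ - 0ℤ - z ≡ - z
      alg′ = solve-∀
      final : ∀ x y z w → x ≡ 0ℤ → w ≡ 0ℤ → 1ℤ * (1ℤ * x + y) + (1ℤ * z + w) ≡ 0ℤ → y ≡ - z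
      final x y z w ex ew e = trans (alg x y z w)
        (trans (cong (λ u → u - x - w - z) e)
        (trans (cong₂ (λ u v → 0ℤ - u - v - z) ex ew) (alg′ z)))

open MultilinearForms

-- Determinants: uniqueness, transposition, products

module Determinants where
  open import Data.Integer using (-_; _-_; _+_; _*_) renaming (+_ to pos)

  module _ {m n : ℕ} {F : Rows m n → ℤ} (F-multi : Multilinear F)
           (adjacent : ∀ A i j → toℕ j ≡ suc (toℕ i) → (∀ k → A i k ≡ A j k) → F A ≡ 0ℤ) where
    open MultilinearProperties F-multi

    private
      -- Induction on the position `b` of the lower of the two equal rows: exchanging it with the
      -- row just above changes only the sign and brings the equal rows closer.
      vanish : ∀ b A i j → toℕ j ≡ b → toℕ i ℕ.< b → (∀ k → A i k ≡ A j k) → F A ≡ 0ℤ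
      vanish (suc b) A i j j≡ i<b e with toℕ i ℕP.≟ b
      ... | yes refl = adjacent A i j j≡ e
      ... | no i≢b = trans (swap-neg j′ j j′≢j (λ B → adjacent B j′ j (trans j≡ (cong suc (sym j′≡b)))) A)
        (cong -_ (vanish b (swapRows j′ j A) i j′ j′≡b i<b′ λ k →
          trans (at (trans (setRow-off _ j _ i i≢j) (setRow-off A j′ _ i i≢j′)) k)
            (trans (e k) (sym (at (trans (setRow-off _ j _ j′ j′≢j) (setRow-at A j′ _)) k)))))
        where
        b<m = ℕP.<-trans (ℕP.≤-reflexive (sym j≡)) (FinP.toℕ<n j)
        j′ = Fin.fromℕ< b<m
        j′≡b : toℕ j′ ≡ b
        j′≡b = FinP.toℕ-fromℕ< b<m
        j′≢j : j′ ≢ j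
        j′≢j p = ℕP.1+n≢n (trans (sym j≡) (trans (cong toℕ (sym p)) j′≡b))
        i<b′ : toℕ i ℕ.< b
        i<b′ = ℕP.≤∧≢⇒< (ℕP.≤-pred i<b) i≢b
        i≢j : i ≢ j
        i≢j p = ℕP.<⇒≢ i<b (trans (cong toℕ p) j≡)
        i≢j′ : i ≢ j′
        i≢j′ p = ℕP.<⇒≢ i<b′ (trans (cong toℕ p) j′≡b)

    adjacent⇒alternating : Alternating F
    adjacent⇒alternating A i j i≢j e with FinP.<-cmp i j
    ... | tri< i<j _ _ = vanish _ A i j refl i<j e
    ... | tri≈ _ i≡j _ = ⊥-elim (i≢j i≡j)
    ... | tri> _ _ j<i = vanish _ A j i refl j<i (λ k → sym (e k))

  minor : ∀ {n} → Matrix (suc n) → Fin (suc n) → Matrix n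
  minor A j r c = A (suc r) (punchIn j c)

  det-cong : ∀ {n} {A B : Matrix n} → A ≈ B → det A ≡ det B
  det-cong {zero}  e = refl
  det-cong {suc n} e = sum-cong λ j → cong (sign (toℕ j) *_)
    (cong₂ _*_ (e zero j) (det-cong (λ r c → e (suc r) (punchIn j c))))

  -- `det` expands along row 0, and its minors keep all other rows, so column properties go through
  -- by induction. The row properties follow afterwards by `det-ᵀ`. In the expansion, the term of
  -- column `p` is linear through its coefficient, every other term through its minor.
  det-column-linear : ∀ {n} {A X Y : Matrix n} p c →
    (∀ i j → j ≢ p → A i j ≡ X i j) → (∀ i j → j ≢ p → A i j ≡ Y i j) →
    (∀ i → A i p ≡ c * X i p + Y i p) → det A ≡ c * det X + det Y
  det-column-linear {suc n} {A} {X} {Y} p c AX AY Ap =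
    trans (sum-cong term) (trans (sum-+ (λ j → c * laplace X j) (laplace Y)) (cong (_+ det Y) (sum-*ˡ c (laplace X))))
    where
    laplace : Matrix (suc n) → Fin (suc n) → ℤ
    laplace Z j = sign (toℕ j) * (Z zero j * det (minor Z j))
    term : ∀ j → sign (toℕ j) * (A zero j * det (minor A j)) ≡
      c * (sign (toℕ j) * (X zero j * det (minor X j))) + sign (toℕ j) * (Y zero j * det (minor Y j))
    term j with j FinP.≟ p
    ... | yes refl = trans
        (cong (sign (toℕ j) *_) (trans
          (cong₂ _*_ (Ap zero) refl)
          (trans (distrib c (X zero j) (Y zero j) (det (minor A j)))
            (cong₂ (λ u v → c * (X zero j * u) + Y zero j * v)
              (det-cong (λ r k → AX (suc r) (punchIn j k) (FinP.punchInᵢ≢i j k)))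
              (det-cong (λ r k → AY (suc r) (punchIn j k) (FinP.punchInᵢ≢i j k)))))))
        (assemble (sign (toℕ j)) c (X zero j * det (minor X j)) (Y zero j * det (minor Y j)))
      where
      distrib : ∀ c x y d → (c * x + y) * d ≡ c * (x * d) + y * d
      distrib = solve-∀
      assemble : ∀ s c x y → s * (c * x + y) ≡ c * (s * x) + s * y
      assemble = solve-∀
    ... | no j≢p = trans
        (cong (λ u → sign (toℕ j) * (A zero j * u))
          (det-column-linear {A = minor A j} {minor X j} {minor Y j} p′ c
            (λ r k k≢ → AX (suc r) _ (off k k≢)) (λ r k k≢ → AY (suc r) _ (off k k≢))
            (λ r → subst (λ q → A (suc r) q ≡ c * X (suc r) q + Y (suc r) q) (sym p′↦p) (Ap (suc r)))))
        (trans (distrib (sign (toℕ j)) (A zero j) c (det (minor X j)) (det (minor Y j)))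
          (cong₂ (λ u v → c * (sign (toℕ j) * (u * det (minor X j))) + sign (toℕ j) * (v * det (minor Y j)))
            (AX zero j j≢p) (AY zero j j≢p)))
      where
      p′ = punchOut j≢p
      p′↦p : punchIn j p′ ≡ p
      p′↦p = FinP.punchIn-punchOut j≢p
      off : ∀ k → k ≢ p′ → punchIn j k ≢ p
      off k k≢ e = k≢ (FinP.punchIn-injective j k p′ (trans e (sym p′↦p)))
      distrib : ∀ s a c x y → s * (a * (c * x + y)) ≡ c * (s * (a * x)) + s * (a * y)
      distrib = solve-∀

  punchOut-adjacent : ∀ {n} {j a b : Fin (suc n)} (j≢a : j ≢ a) (j≢b : j ≢ b) →
    toℕ b ≡ suc (toℕ a) → toℕ (punchOut j≢b) ≡ suc (toℕ (punchOut j≢a))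
  punchOut-adjacent {_} {zero} {zero} j≢a _ _ = ⊥-elim (j≢a refl)
  punchOut-adjacent {_} {zero} {suc a} {suc b} _ _ e = ℕP.suc-injective e
  punchOut-adjacent {suc n} {suc zero} {zero} {suc zero} _ j≢b _ = ⊥-elim (j≢b refl)
  punchOut-adjacent {suc (suc n)} {suc (suc j)} {zero} {suc zero} _ _ _ = refl
  punchOut-adjacent {suc n} {suc j} {suc a} {suc b} j≢a j≢b e =
    cong suc (punchOut-adjacent (j≢a ∘ cong suc) (j≢b ∘ cong suc) (ℕP.suc-injective e))

  punchIn-adjacent : ∀ {n} (a b : Fin (suc n)) (c : Fin n) → toℕ b ≡ suc (toℕ a) →
    punchIn a c ≡ punchIn b c ⊎ (punchIn a c ≡ b × punchIn b c ≡ a)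
  punchIn-adjacent zero (suc zero) zero _ = inj₂ (refl , refl)
  punchIn-adjacent zero (suc zero) (suc c) _ = inj₁ refl
  punchIn-adjacent (suc a) (suc b) zero _ = inj₁ refl
  punchIn-adjacent (suc a) (suc b) (suc c) e with punchIn-adjacent a b c (ℕP.suc-injective e)
  ... | inj₁ p = inj₁ (cong suc p)
  ... | inj₂ (p , q) = inj₂ (cong suc p , cong suc q)

  sign-suc : ∀ k → sign (suc k) ≡ - sign k
  sign-suc zero = refl
  sign-suc (suc k) = sym (trans (cong -_ (sign-suc k)) (ℤP.neg-involutive (sign k)))

  -- Only the terms that delete `a` or `b` survive, since every other minor still has two equal
  -- adjacent columns. Adjacency makes the two surviving minors equal entry by entry and their signs
  -- opposite.
  det-columns-adjacent : ∀ {n} (A : Matrix n) a b → toℕ b ≡ suc (toℕ a) →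
    (∀ i → A i a ≡ A i b) → det A ≡ 0ℤ
  det-columns-adjacent {suc n} A a b b≡ e = trans (sum-pair _ a b a≢b others) cancel
    where
    a≢b : a ≢ b
    a≢b p = ℕP.1+n≢n (trans (sym b≡) (cong toℕ (sym p)))
    others : ∀ j → j ≢ a → j ≢ b → sign (toℕ j) * (A zero j * det (minor A j)) ≡ 0ℤ
    others j j≢a j≢b = trans (cong (λ u → sign (toℕ j) * (A zero j * u))
      (det-columns-adjacent (minor A j) (punchOut j≢a) (punchOut j≢b) (punchOut-adjacent j≢a j≢b b≡)
        (λ r → trans (cong (A (suc r)) (FinP.punchIn-punchOut j≢a))
          (trans (e (suc r)) (cong (A (suc r)) (sym (FinP.punchIn-punchOut j≢b)))))))
      (zeros (sign (toℕ j)) (A zero j))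
      where
      zeros : ∀ x y → x * (y * 0ℤ) ≡ 0ℤ
      zeros = solve-∀
    minors : minor A a ≈ minor A b
    minors r c with punchIn-adjacent a b c b≡
    ... | inj₁ p = cong (A (suc r)) p
    ... | inj₂ (p , q) = trans (cong (A (suc r)) p) (trans (sym (e (suc r))) (cong (A (suc r)) (sym q)))
    cancel : sign (toℕ a) * (A zero a * det (minor A a)) + sign (toℕ b) * (A zero b * det (minor A b)) ≡ 0ℤ
    cancel = trans
      (cong₂ _+_ (cong (sign (toℕ a) *_) (cong₂ _*_ (e zero) (det-cong minors)))
        (cong (_* (A zero b * det (minor A b))) (trans (cong sign b≡) (sign-suc (toℕ a)))))
      (opposite (sign (toℕ a)) (A zero b * det (minor A b)))
      where
      opposite : ∀ s x → s * x + (- s) * x ≡ 0ℤ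
      opposite = solve-∀

  _ᵀ : ∀ {m n} → Rows m n → Rows n m
  (A ᵀ) i j = A j i

  detᵀ-multilinear : ∀ {n} → Multilinear {n} {n} (λ A → det (A ᵀ))
  detᵀ-multilinear = record
    { resp = λ e → det-cong (λ i j → e j i)
    ; linear = λ i c AX AY e → det-column-linear i c (λ k j j≢ → AX j j≢ k) (λ k j j≢ → AY j j≢ k) e
    }

  detᵀ-alternating : ∀ {n} → Alternating {n} {n} (λ A → det (A ᵀ))
  detᵀ-alternating = adjacent⇒alternating detᵀ-multilinear (λ A → det-columns-adjacent (A ᵀ))

  -- The boolean test is the one in `charQ`, so that `charQ` turns into the determinant of a
  -- `charMatrix` by a case split on that boolean.
  δ : ∀ {n} → Fin n → Fin n → ℤ
  δ i j = if toℕ i ℕ.≡ᵇ toℕ j then 1ℤ else 0ℤ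

  if-≡ : ∀ {n} {A : Set} (i : Fin n) (x y : A) → (if toℕ i ℕ.≡ᵇ toℕ i then x else y) ≡ x
  if-≡ i x y with toℕ i ℕ.≡ᵇ toℕ i | ℕP.≡⇒≡ᵇ (toℕ i) (toℕ i) refl
  ... | true | _ = refl

  if-≢ : ∀ {n} {A : Set} {i j : Fin n} (x y : A) → i ≢ j → (if toℕ i ℕ.≡ᵇ toℕ j then x else y) ≡ y
  if-≢ {i = i} {j} x y i≢j with toℕ i ℕ.≡ᵇ toℕ j | ℕP.≡ᵇ⇒≡ (toℕ i) (toℕ j)
  ... | true  | f = ⊥-elim (i≢j (FinP.toℕ-injective (f tt)))
  ... | false | _ = refl

  δ-≡ : ∀ {n} (i : Fin n) → δ i i ≡ 1ℤ
  δ-≡ i = if-≡ i 1ℤ 0ℤ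

  δ-≢ : ∀ {n} {i j : Fin n} → i ≢ j → δ i j ≡ 0ℤ
  δ-≢ = if-≢ 1ℤ 0ℤ

  δ-sym : ∀ {n} (i j : Fin n) → δ i j ≡ δ j i
  δ-sym i j with i FinP.≟ j
  ... | yes refl = refl
  ... | no i≢j = trans (δ-≢ i≢j) (sym (δ-≢ (i≢j ∘ sym)))

  sum-δ : ∀ {n} (i : Fin n) (f : Fin n → ℤ) → sumℤ (λ j → δ i j * f j) ≡ f i
  sum-δ i f = trans (sum-single _ i λ j j≢i → trans (cong (_* f j) (δ-≢ (j≢i ∘ sym))) (ℤP.*-zeroˡ (f j)))
    (trans (cong (_* f i) (δ-≡ i)) (ℤP.*-identityˡ (f i)))

  sum-δʳ : ∀ {n} (i : Fin n) (f : Fin n → ℤ) → sumℤ (λ j → f j * δ j i) ≡ f i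
  sum-δʳ i f = trans (sum-cong (λ j → trans (ℤP.*-comm (f j) _) (cong (_* f j) (δ-sym j i)))) (sum-δ i f)

  ∷-multilinear : ∀ {m n} {F : Rows (suc m) n → ℤ} → Multilinear F → ∀ a → Multilinear (λ A → F (a ∷ A))
  ∷-multilinear {F = F} F-multi a = record
    { resp = λ e → resp λ { zero j → refl ; (suc i) j → e i j }
    ; linear = λ i c AX AY e → linear (suc i) c
        (λ { zero _ j → refl ; (suc k) k≢ j → AX k (k≢ ∘ cong suc) j })
        (λ { zero _ j → refl ; (suc k) k≢ j → AY k (k≢ ∘ cong suc) j }) e
    }
    where open Multilinear F-multi

  ∷-alternating : ∀ {m n} {F : Rows (suc m) n → ℤ} → Alternating F → ∀ a → Alternating (λ A → F (a ∷ A))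
  ∷-alternating alt a A i j i≢j = alt (a ∷ A) (suc i) (suc j) (i≢j ∘ FinP.suc-injective)

  -- Gaussian elimination below a fixed row: `a` stands for a row kept outside `A`, which is why a
  -- copy of it inside is assumed to kill `F`. Each row then sheds its multiple of `a`.
  clear-rows : ∀ {m n} {F : Rows m n → ℤ} → Multilinear F → (a : Fin n → ℤ) →
    (∀ A i → (∀ k → A i k ≡ a k) → F A ≡ 0ℤ) →
    ∀ {A B} (c : Fin m → ℤ) → (∀ i k → A i k ≡ c i * a k + B i k) → F A ≡ F B
  clear-rows {zero} F-multi a vanish c e = Multilinear.resp F-multi (λ ())
  clear-rows {suc m} {F = F} F-multi a vanish {A} {B} c e =
    trans (linear {A} {a ∷ (A ∘ suc)} {B zero ∷ (A ∘ suc)} zero (c zero)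
            (λ { zero 0≢ _ → ⊥-elim (0≢ refl) ; (suc i) _ _ → refl })
            (λ { zero 0≢ _ → ⊥-elim (0≢ refl) ; (suc i) _ _ → refl })
            (e zero))
    (trans (cong (λ u → c zero * u + F (B zero ∷ (A ∘ suc))) (vanish (a ∷ (A ∘ suc)) zero (λ k → refl)))
    (trans (drop (c zero) (F (B zero ∷ (A ∘ suc))))
    (trans (clear-rows (∷-multilinear F-multi (B zero)) a
             (λ X i → vanish (B zero ∷ X) (suc i)) (c ∘ suc) (λ i → e (suc i)))
           (resp λ { zero j → refl ; (suc i) j → refl }))))
    where
    open Multilinear F-multi
    drop : ∀ c x → c * 0ℤ + x ≡ x
    drop = solve-∀

  insertAt-δ : ∀ {n} (j : Fin (suc n)) r k → insertAt (δ r) j 0ℤ k ≡ δ (punchIn j r) k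
  insertAt-δ j r k with j FinP.≟ k
  ... | yes refl = trans (insertAt-lookup (δ r) j 0ℤ) (sym (δ-≢ (FinP.punchInᵢ≢i j r)))
  ... | no j≢k = subst (λ k → insertAt (δ r) j 0ℤ k ≡ δ (punchIn j r) k) (FinP.punchIn-punchOut j≢k)
      (trans (insertAt-punchIn (δ r) j 0ℤ c) δ-punchIn)
    where
    c = punchOut j≢k
    δ-punchIn : δ r c ≡ δ (punchIn j r) (punchIn j c)
    δ-punchIn with r FinP.≟ c
    ... | yes refl = trans (δ-≡ r) (sym (δ-≡ (punchIn j r)))
    ... | no r≢c = trans (δ-≢ r≢c) (sym (δ-≢ (r≢c ∘ FinP.punchIn-injective j r c)))

  -- The cycle that brings `j` to the front and keeps the order of the other indices; its sign is
  -- the one in the Laplace expansion.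
  cycleRows : ∀ {n} → Fin (suc n) → Fin (suc n) → Fin (suc n)
  cycleRows j zero = j
  cycleRows j (suc r) = punchIn j r

  punchIn-inject₁ : ∀ {n} (p : Fin n) → punchIn (Fin.inject₁ p) p ≡ suc p
  punchIn-inject₁ zero = refl
  punchIn-inject₁ (suc p) = cong suc (punchIn-inject₁ p)

  punchIn-suc : ∀ {n} (p : Fin n) → punchIn (suc p) p ≡ Fin.inject₁ p
  punchIn-suc zero = refl
  punchIn-suc (suc p) = cong suc (punchIn-suc p)

  punchIn-suc≢ : ∀ {n} (p r : Fin n) → r ≢ p → punchIn (suc p) r ≡ punchIn (Fin.inject₁ p) r
  punchIn-suc≢ zero zero r≢p = ⊥-elim (r≢p refl)
  punchIn-suc≢ zero (suc r) _ = refl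
  punchIn-suc≢ (suc p) zero _ = refl
  punchIn-suc≢ (suc p) (suc r) r≢p = cong suc (punchIn-suc≢ p r (r≢p ∘ cong suc))

  module _ {n} {F : Rows (suc n) (suc n) → ℤ} (F-multi : Multilinear F) (alt : Alternating F) where
    open MultilinearProperties F-multi
    open Multilinear F-multi

    -- The arrangements with `suc p` and with `p` in front differ by the single exchange of rows `0`
    -- and `suc p`, so each unit of `j` costs one sign.
    cycleRows-sign : ∀ k (j : Fin (suc n)) → toℕ j ≡ k → F (δ ∘ cycleRows j) ≡ sign k * F δ
    cycleRows-sign zero zero refl =
      trans (resp λ { zero _ → refl ; (suc r) _ → refl }) (sym (ℤP.*-identityˡ (F δ)))
    cycleRows-sign (suc k) (suc p) j≡ =
      trans (swap-neg zero (suc p) (λ ()) (λ A → alt A zero (suc p) (λ ())) (δ ∘ cycleRows (suc p)))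
      (trans (cong -_ (trans (resp swapped)
        (cycleRows-sign k (Fin.inject₁ p) (trans (FinP.toℕ-inject₁ p) (ℕP.suc-injective j≡)))))
      (trans (ℤP.neg-distribˡ-* (sign k) (F δ)) (cong (_* F δ) (sym (sign-suc k)))))
      where
      P = δ ∘ cycleRows (suc p)
      P′ = setRow P zero (P (suc p))
      swapped : swapRows zero (suc p) (δ ∘ cycleRows (suc p)) ≈ δ ∘ cycleRows (Fin.inject₁ p)
      swapped zero j = at (trans (setRow-off P′ (suc p) (P zero) zero (λ ())) (cong δ (punchIn-suc p))) j
      swapped (suc r) j with r FinP.≟ p
      ... | yes refl = at (trans (setRow-at P′ (suc p) (P zero)) (cong δ (sym (punchIn-inject₁ p)))) j
      ... | no r≢p = at (trans (setRow-off P′ (suc p) (P zero) (suc r) (r≢p ∘ FinP.suc-injective))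
                        (cong δ (punchIn-suc≢ p r r≢p))) j

  -- Expanding row 0 in the standard basis and clearing column j below e_j turns F into an alternating
  -- form in the j-th minor, which is exactly the Laplace recursion defining det.
  det-unique : ∀ {n} {F : Rows n n → ℤ} → Multilinear F → Alternating F → ∀ A → F A ≡ det A * F δ
  det-unique {zero} {F} F-multi alt A =
    trans (Multilinear.resp F-multi (λ ())) (sym (ℤP.*-identityˡ (F δ)))
  det-unique {suc n} {F} F-multi alt A =
    trans (sym (setRow-self A zero))
    (trans (setRow-resp A zero (λ k → sym (sum-δʳ k (A zero))))
    (trans (setRow-sum A zero (A zero) δ)
    (trans (sum-cong term) (sum-*ʳ (F δ) (λ j → sign (toℕ j) * (A zero j * det (minor A j)))))))
    where
    open MultilinearProperties F-multi
    open Multilinear F-multi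
    embed : Fin (suc n) → Matrix n → Rows n (suc n)
    embed j B r = insertAt (B r) j 0ℤ
    embed-at : ∀ j B r → embed j B r j ≡ 0ℤ
    embed-at j B r = insertAt-lookup (B r) j 0ℤ
    embed-off : ∀ j B r c → embed j B r (punchIn j c) ≡ B r c
    embed-off j B r c = insertAt-punchIn (B r) j 0ℤ c
    columns : ∀ j (P : Fin (suc n) → Set) → P j → (∀ c → P (punchIn j c)) → ∀ k → P k
    columns j P Pj Pc k with j FinP.≟ k
    ... | yes refl = Pj
    ... | no j≢k = subst P (FinP.punchIn-punchOut j≢k) (Pc (punchOut j≢k))
    E : Fin (suc n) → Matrix n → ℤ
    E j B = F (δ j ∷ embed j B)
    embed-≡ : ∀ j B B′ r → (∀ c → B r c ≡ B′ r c) → ∀ k → embed j B r k ≡ embed j B′ r k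
    embed-≡ j B B′ r e = columns j _ (trans (embed-at j B r) (sym (embed-at j B′ r)))
      (λ c → trans (embed-off j B r c) (trans (e c) (sym (embed-off j B′ r c))))
    E-multi : ∀ j → Multilinear (E j)
    E-multi j = record
      { resp = λ {B} {B′} e → Multilinear.resp tail-multi (λ r → embed-≡ j B B′ r (e r))
      ; linear = λ {B} {X} {Y} i c BX BY e → Multilinear.linear tail-multi i c
          (λ k k≢i → embed-≡ j B X k (BX k k≢i))
          (λ k k≢i → embed-≡ j B Y k (BY k k≢i))
          (columns j _
            (trans (embed-at j B i) (trans (zeros c) (sym (cong₂ (λ u v → c * u + v) (embed-at j X i) (embed-at j Y i)))))
            (λ k → trans (embed-off j B i k) (trans (e k)
              (sym (cong₂ (λ u v → c * u + v) (embed-off j X i k) (embed-off j Y i k))))))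
      }
      where
      tail-multi = ∷-multilinear F-multi (δ j)
      zeros : ∀ c → 0ℤ ≡ c * 0ℤ + 0ℤ
      zeros = solve-∀
    E-alt : ∀ j → Alternating (E j)
    E-alt j B i i′ i≢i′ e = ∷-alternating alt (δ j) (embed j B) i i′ i≢i′ (columns j _
      (trans (embed-at j B i) (sym (embed-at j B i′)))
      (λ c → trans (embed-off j B i c) (trans (e c) (sym (embed-off j B i′ c)))))
    cleared : ∀ j → F (setRow A zero (δ j)) ≡ E j (minor A j)
    cleared j = trans (resp λ { zero _ → refl ; (suc r) _ → refl })
      (clear-rows (∷-multilinear F-multi (δ j)) (δ j)
        (λ X i e → alt (δ j ∷ X) zero (suc i) (λ ()) (λ k → sym (e k)))
        (λ r → A (suc r) j)
        (λ r → columns j _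
          (trans (unit (A (suc r) j)) (sym (cong₂ (λ u v → A (suc r) j * u + v) (δ-≡ j) (embed-at j (minor A j) r))))
          (λ c → trans (nounit (A (suc r) j) (A (suc r) (punchIn j c)))
            (sym (cong₂ (λ u v → A (suc r) j * u + v) (δ-≢ (FinP.punchInᵢ≢i j c ∘ sym)) (embed-off j (minor A j) r c))))))
      where
      unit : ∀ x → x ≡ x * 1ℤ + 0ℤ
      unit = solve-∀
      nounit : ∀ x y → y ≡ x * 0ℤ + y
      nounit = solve-∀
    E-δ : ∀ j → E j δ ≡ sign (toℕ j) * F δ
    E-δ j = trans (resp λ { zero _ → refl ; (suc r) k → insertAt-δ j r k }) (cycleRows-sign F-multi alt (toℕ j) j refl)
    term : ∀ j → A zero j * F (setRow A zero (δ j)) ≡ sign (toℕ j) * (A zero j * det (minor A j)) * F δ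
    term j = trans (cong (A zero j *_) (trans (cleared j)
        (trans (det-unique (E-multi j) (E-alt j) (minor A j)) (cong (det (minor A j) *_) (E-δ j)))))
      (assoc (A zero j) (det (minor A j)) (sign (toℕ j)) (F δ))
      where
      assoc : ∀ a d s f → a * (d * (s * f)) ≡ s * (a * d) * f
      assoc = solve-∀

  det-δ : ∀ n → det {n} δ ≡ 1ℤ
  det-δ zero = refl
  det-δ (suc n) = trans
    (sum-single (λ j → sign (toℕ j) * (δ {suc n} zero j * det (minor (δ {suc n}) j))) zero
      (λ j j≢0 → trans (cong (λ u → sign (toℕ j) * (u * det (minor (δ {suc n}) j))) (δ-≢ {i = zero} (j≢0 ∘ sym)))
        (zeros (sign (toℕ j)) (det (minor (δ {suc n}) j)))))
    (trans (unit (det {n} (minor (δ {suc n}) zero))) (det-δ n))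
    where
    zeros : ∀ x y → x * (0ℤ * y) ≡ 0ℤ
    zeros = solve-∀
    unit : ∀ x → 1ℤ * (1ℤ * x) ≡ x
    unit = solve-∀

  -- By the column properties, the determinant of the transpose is a multilinear alternating form in
  -- the rows, hence a multiple of `det`; the factor is its value at `δ`.
  det-ᵀ : ∀ {n} (A : Matrix n) → det (A ᵀ) ≡ det A
  det-ᵀ {n} A = trans (det-unique detᵀ-multilinear detᵀ-alternating A)
    (trans (cong (det A *_) (trans (det-cong {n} {λ i j → δ j i} {δ} (λ i j → δ-sym j i)) (det-δ n))) (ℤP.*-identityʳ (det A)))

  det-multilinear : ∀ {n} → Multilinear {n} {n} det
  det-multilinear = record
    { resp = det-cong
    ; linear = λ {A} {X} {Y} i c AX AY e → trans (sym (det-ᵀ A))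
        (trans (Multilinear.linear detᵀ-multilinear i c AX AY e) (cong₂ (λ u v → c * u + v) (det-ᵀ X) (det-ᵀ Y)))
    }

  det-alternating : ∀ {n} → Alternating {n} {n} det
  det-alternating A i j i≢j e = trans (sym (det-ᵀ A)) (detᵀ-alternating A i j i≢j e)

  infixl 7 _⊗_
  _⊗_ : ∀ {n} → Matrix n → Matrix n → Matrix n
  (A ⊗ B) i j = sumℤ (λ k → A i k * B k j)

  ⊗-identityˡ : ∀ {n} (A : Matrix n) → δ ⊗ A ≈ A
  ⊗-identityˡ A i j = sum-δ i (λ k → A k j)

  -- For fixed `B`, the left side is multilinear and alternating in the rows of `A` and takes the
  -- value `det B` at `δ`.
  det-⊗ : ∀ {n} (A B : Matrix n) → det (A ⊗ B) ≡ det A * det B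
  det-⊗ A B = trans (det-unique {F = λ X → det (X ⊗ B)}
    (record
      { resp = λ e → det-cong (λ i j → sum-cong (λ k → cong (_* B k j) (e i k)))
      ; linear = λ {X} {Y} {Z} i c XY XZ e → Multilinear.linear det-multilinear i c
          (λ k k≢ j → sum-cong (λ l → cong (_* B l j) (XY k k≢ l)))
          (λ k k≢ j → sum-cong (λ l → cong (_* B l j) (XZ k k≢ l)))
          (λ j → trans (sum-cong (λ l → trans (cong (_* B l j) (e l)) (distrib c (Y i l) (Z i l) (B l j))))
            (trans (sum-+ (λ l → c * (Y i l * B l j)) (λ l → Z i l * B l j)) (cong (_+ (Z ⊗ B) i j) (sum-*ˡ c (λ l → Y i l * B l j)))))
      })
    (λ X i j i≢j e → det-alternating (X ⊗ B) i j i≢j (λ l → sum-cong (λ k → cong (_* B k l) (e k)))) A)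
    (cong (det A *_) (det-cong {A = δ ⊗ B} {B} (⊗-identityˡ B)))
    where
    distrib : ∀ c x y b → (c * x + y) * b ≡ c * (x * b) + y * b
    distrib = solve-∀

open Determinants

-- Matrix algebra and linear systems over ℤ

module LinearSystems where
  open import Data.Integer using (-_; _-_; _+_; _*_) renaming (+_ to pos)

  ⊗-cong : ∀ {n} {A A′ B B′ : Matrix n} → A ≈ A′ → B ≈ B′ → A ⊗ B ≈ A′ ⊗ B′
  ⊗-cong eA eB i j = sum-cong (λ k → cong₂ _*_ (eA i k) (eB k j))

  ⊗-assoc : ∀ {n} (A B C : Matrix n) → (A ⊗ B) ⊗ C ≈ A ⊗ (B ⊗ C)
  ⊗-assoc A B C i j =
    trans (sum-cong (λ k → trans (sym (sum-*ʳ (C k j) (λ l → A i l * B l k)))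
                                 (sum-cong (λ l → ℤP.*-assoc (A i l) (B l k) (C k j)))))
    (trans (sum-swap (λ k l → A i l * (B l k * C k j)))
           (sum-cong (λ l → sum-*ˡ (A i l) (λ k → B l k * C k j))))

  trace : ∀ {n} → Matrix n → ℤ
  trace A = sumℤ (λ i → A i i)

  trace-cong : ∀ {n} {A B : Matrix n} → A ≈ B → trace A ≡ trace B
  trace-cong e = sum-cong (λ i → e i i)

  power : ∀ {n} → Matrix n → ℕ → Matrix n
  power M zero    = δ
  power M (suc k) = power M k ⊗ M

  -- adjugate A i j is the cofactor of the entry (j , i).
  adjugate : ∀ {n} → Matrix n → Matrix n
  adjugate A i j = det (setRow A j (δ i))

  -- Cramer's rule: the entry is the determinant of `A` with row `j` replaced by row `k`, and this
  -- has a repeated row unless `k` is `j`.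
  ⊗-adjugate : ∀ {n} (A : Matrix n) k j → (A ⊗ adjugate A) k j ≡ det A * δ k j
  ⊗-adjugate A k j = trans (sym (setRow-sum A j (A k) δ)) (trans (setRow-resp A j (λ l → sum-δʳ l (A k))) replaced)
    where
    open MultilinearProperties det-multilinear
    replaced : det (setRow A j (A k)) ≡ det A * δ k j
    replaced with k FinP.≟ j
    ... | yes refl = trans (setRow-self A k) (trans (sym (ℤP.*-identityʳ (det A))) (cong (det A *_) (sym (δ-≡ k))))
    ... | no k≢j = trans
        (det-alternating (setRow A j (A k)) k j k≢j
          (at (trans (setRow-off A j (A k) k k≢j) (sym (setRow-at A j (A k))))))
        (trans (sym (ℤP.*-zeroʳ (det A))) (cong (det A *_) (sym (δ-≢ k≢j))))

  -- Nothing can be divided by `v j`. Instead, the determinant of `A` with column `j` replaced by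
  -- `A v` is computed twice: it is 0, and by linearity it is `v j * det A`.
  kernel⇒det≡0 : ∀ {n} (A : Matrix n) (v : Fin n → ℤ) →
    (∀ i → sumℤ (λ j → A i j * v j) ≡ 0ℤ) → ∀ j → v j ≢ 0ℤ → det A ≡ 0ℤ
  kernel⇒det≡0 {n} A v Av≡0 j vj≢0 with ℤP.i*j≡0⇒i≡0∨j≡0 (v j) product
    where
    open MultilinearProperties (det-multilinear {n})
    combined : ∀ k → v k * det (setRow (A ᵀ) j ((A ᵀ) k)) ≡ δ j k * (v j * det A)
    combined k with j FinP.≟ k
    ... | yes refl = trans (cong (v j *_) (trans (setRow-self (A ᵀ) j) (det-ᵀ A)))
        (trans (sym (ℤP.*-identityˡ _)) (cong (_* (v j * det A)) (sym (δ-≡ j))))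
    ... | no j≢k = trans (cong (v k *_) (det-alternating _ j k j≢k
          (at (trans (setRow-at (A ᵀ) j _) (sym (setRow-off (A ᵀ) j ((A ᵀ) k) k (j≢k ∘ sym)))))))
        (trans (ℤP.*-zeroʳ (v k)) (sym (trans (cong (_* (v j * det A)) (δ-≢ j≢k)) (ℤP.*-zeroˡ (v j * det A)))))
    product : v j * det A ≡ 0ℤ
    product = trans (sym (sum-δ j (λ _ → v j * det A)))
      (trans (sum-cong (λ k → sym (combined k)))
      (trans (sym (setRow-sum (A ᵀ) j v (A ᵀ)))
      (trans (setRow-resp (A ᵀ) j (λ i → trans (sum-cong (λ k → ℤP.*-comm (v k) (A i k))) (Av≡0 i)))
             (setRow-zero (A ᵀ) j))))
  ... | inj₁ vj≡0 = ⊥-elim (vj≢0 vj≡0)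
  ... | inj₂ det≡0 = det≡0

  sum-remove : ∀ {n} (p : Fin (suc n)) (f : Fin (suc n) → ℤ) → sumℤ f ≡ f p + sumℤ (f ∘ punchIn p)
  sum-remove p f = trans (sumℤ≡sum f) (trans (∑.sum-remove {i = p} f) (cong (_+_ (f p)) (sym (sumℤ≡sum (f ∘ punchIn p)))))

  all-zero? : ∀ {n} (f : Fin n → ℤ) → (∀ i → f i ≡ 0ℤ) ⊎ ∃ λ i → f i ≢ 0ℤ
  all-zero? {n} f with FinP.all? (λ i → f i ℤP.≟ 0ℤ)
  ... | yes a = inj₁ a
  ... | no ¬a = inj₂ (FinP.¬∀⟶∃¬ n (λ i → f i ≡ 0ℤ) (λ i → f i ℤP.≟ 0ℤ) ¬a)

  product≢0 : ∀ {a b} → a ≢ 0ℤ → b ≢ 0ℤ → a * b ≢ 0ℤ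
  product≢0 {a} a≢0 b≢0 e with ℤP.i*j≡0⇒i≡0∨j≡0 a e
  ... | inj₁ a≡0 = a≢0 a≡0
  ... | inj₂ b≡0 = b≢0 b≡0

  NontrivialKernel : ∀ {m n} → Rows m n → Set
  NontrivialKernel {m} {n} M =
    Σ (Fin n → ℤ) λ v → (Σ (Fin n) λ j → v j ≢ 0ℤ) × (∀ i → sumℤ (λ j → M i j * v j) ≡ 0ℤ)

  -- Fraction-free elimination of the unknown `p`: the rows are multiplied by the pivot `M zero p`
  -- so that they stay integral.
  eliminate : ∀ {m n} → Rows (suc m) (suc n) → Fin (suc n) → Rows m n
  eliminate M p i j = M zero p * M (suc i) (punchIn p j) - M zero (punchIn p j) * M (suc i) p

  kernel-eliminate : ∀ {m n} (M : Rows (suc m) (suc n)) p → M zero p ≢ 0ℤ →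
    NontrivialKernel (eliminate M p) → NontrivialKernel M
  kernel-eliminate {m} {n} M p a≢0 (u , (j , uj≢0) , e) = v , (punchIn p j , vj≢0) , solves
    where
    a = M zero p
    rest = sumℤ (λ j → M zero (punchIn p j) * u j)
    -- Scaling the reduced solution by the pivot makes the pivot unknown, `- rest`, an integer too.
    v : Fin (suc n) → ℤ
    v = insertAt (λ j → a * u j) p (- rest)
    vp : v p ≡ - rest
    vp = insertAt-lookup (λ j → a * u j) p (- rest)
    vc : ∀ j → v (punchIn p j) ≡ a * u j
    vc = insertAt-punchIn (λ j → a * u j) p (- rest)
    vj≢0 : v (punchIn p j) ≢ 0ℤ
    vj≢0 vj≡0 = product≢0 {a} {u j} a≢0 uj≢0 (trans (sym (vc j)) vj≡0)
    split : ∀ i → sumℤ (λ j → M i j * v j) ≡ M i p * (- rest) + sumℤ (λ j → M i (punchIn p j) * (a * u j))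
    split i = trans (sum-remove p (λ j → M i j * v j))
      (cong₂ _+_ (cong (M i p *_) vp) (sum-cong (λ j → cong (M i (punchIn p j) *_) (vc j))))
    solves : ∀ i → sumℤ (λ j → M i j * v j) ≡ 0ℤ
    solves zero = trans (split zero)
      (trans (cong (a * (- rest) +_) (trans (sum-cong (λ j → swap (M zero (punchIn p j)) a (u j)))
                                           (sum-*ˡ a (λ j → M zero (punchIn p j) * u j))))
             (cancel a rest))
      where
      swap : ∀ m a u → m * (a * u) ≡ a * (m * u)
      swap = solve-∀
      cancel : ∀ a r → a * (- r) + a * r ≡ 0ℤ
      cancel = solve-∀
    solves (suc i) = trans (split (suc i))
      (trans (expand (M (suc i) p) rest (sumℤ (λ j → M (suc i) (punchIn p j) * (a * u j))))
      (trans (cong (_+_ (sumℤ (λ j → M (suc i) (punchIn p j) * (a * u j))))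
               (sym (sum-*ˡ (- M (suc i) p) (λ j → M zero (punchIn p j) * u j))))
      (trans (sym (sum-+ (λ j → M (suc i) (punchIn p j) * (a * u j)) (λ j → - M (suc i) p * (M zero (punchIn p j) * u j))))
      (trans (sum-cong (λ j → combine (M (suc i) (punchIn p j)) a (u j) (M (suc i) p) (M zero (punchIn p j))))
      (e i)))))
      where
      expand : ∀ m r s → m * (- r) + s ≡ s + (- m) * r
      expand = solve-∀
      combine : ∀ m a u b c → m * (a * u) + (- b) * (c * u) ≡ (a * m - c * b) * u
      combine = solve-∀

  underdetermined : ∀ {n} (M : Rows n (suc n)) → NontrivialKernel M
  underdetermined {zero} M = (λ _ → 1ℤ) , (zero , (λ ())) , (λ ())
  underdetermined {suc n} M with all-zero? (M zero)
  ... | inj₂ (p , a≢0) = kernel-eliminate M p a≢0 (underdetermined (eliminate M p))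
  -- A zero row imposes nothing; a column is dropped along with it, its unknown being set to 0, so
  -- that there remains one more unknown than equations.
  ... | inj₁ row≡0 = extend (underdetermined (λ i j → M (suc i) (suc j)))
    where
    extend : NontrivialKernel (λ i j → M (suc i) (suc j)) → NontrivialKernel M
    extend (u , (j , uj≢0) , e) = v , (suc j , uj≢0) , λ
      { zero → sum-zero (λ j → trans (cong (_* v j) (row≡0 j)) (ℤP.*-zeroˡ (v j)))
      ; (suc i) → trans (cong₂ _+_ (ℤP.*-zeroʳ (M (suc i) zero)) (e i)) refl }
      where
      v : Fin (suc (suc n)) → ℤ
      v = 0ℤ ∷ u

  det-e₀ : ∀ {n} (A : Matrix (suc n)) d → (∀ j → A zero j ≡ d * δ zero j) → det A ≡ d * det (minor A zero)
  det-e₀ A d e = trans (sum-single (λ j → sign (toℕ j) * (A zero j * det (minor A j))) zero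
      (λ j j≢0 → trans (cong (λ u → sign (toℕ j) * (u * det (minor A j)))
          (trans (e j) (cong (d *_) (δ-≢ {i = zero} {j} (j≢0 ∘ sym)))))
        (zeros (sign (toℕ j)) d (det (minor A j)))))
    (trans (cong (λ u → 1ℤ * (u * det (minor A zero))) (e zero)) (unit d (det (minor A zero))))
    where
    zeros : ∀ x d y → x * (d * 0ℤ * y) ≡ 0ℤ
    zeros = solve-∀
    unit : ∀ d x → 1ℤ * (d * 1ℤ * x) ≡ d * x
    unit = solve-∀

  det-diagonal≢0 : ∀ {n} (d : Fin n → ℤ) → (∀ i → d i ≢ 0ℤ) → det (λ i j → d i * δ i j) ≢ 0ℤ
  det-diagonal≢0 {zero} d d≢0 ()
  det-diagonal≢0 {suc n} d d≢0 e = product≢0 {d zero} {det (λ i j → d (suc i) * δ i j)} (d≢0 zero) (det-diagonal≢0 (d ∘ suc) (d≢0 ∘ suc))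
    (trans (sym (det-e₀ (λ i j → d i * δ i j) (d zero) (λ j → refl))) e)

  -- A substitute for inverting `A`: for each `i` the `n` equations `t i * e + A b = 0`, with `e`
  -- the unit vector of index `i`, have `n + 1` unknowns and hence a nonzero solution. There `t i`
  -- cannot be 0, or `b` would lie in the kernel. Collecting the columns `b` into `B` makes `A ⊗ B`
  -- diagonal with the nonzero entries `- t i`.
  trivial-kernel⇒det≢0 : ∀ {n} (A : Matrix n) →
    (∀ v → (∀ i → sumℤ (λ j → A i j * v j) ≡ 0ℤ) → ∀ j → v j ≡ 0ℤ) → det A ≢ 0ℤ
  trivial-kernel⇒det≢0 {n} A trivial detA≡0 = det-diagonal≢0 (λ i → - t i) -t≢0
    (trans (det-cong (λ i j → sym (AB i j)))
    (trans (det-⊗ A B) (trans (cong (_* det B) detA≡0) (ℤP.*-zeroˡ (det B)))))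
    where
    solution : ∀ i → NontrivialKernel (λ k → δ k i ∷ A k)
    solution i = underdetermined (λ k → δ k i ∷ A k)
    t : Fin n → ℤ
    t i = proj₁ (solution i) zero
    B : Matrix n
    B j i = proj₁ (solution i) (suc j)
    equation : ∀ i k → δ k i * t i + (A ⊗ B) k i ≡ 0ℤ
    equation i k = proj₂ (proj₂ (solution i)) k
    AB : ∀ k i → (A ⊗ B) k i ≡ - t k * δ k i
    AB k i = trans (isolate (δ k i * t i) ((A ⊗ B) k i) (equation i k)) diagonal
      where
      isolate : ∀ x y → x + y ≡ 0ℤ → y ≡ - x
      isolate x y e = trans (rearrange x y) (trans (cong (_- x) e) (ℤP.+-identityˡ (- x)))
        where
        rearrange : ∀ x y → y ≡ (x + y) - x
        rearrange = solve-∀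
      diagonal : - (δ k i * t i) ≡ - t k * δ k i
      diagonal with k FinP.≟ i
      ... | yes refl = comm (δ k k) (t k)
        where
        comm : ∀ x y → - (x * y) ≡ (- y) * x
        comm = solve-∀
      ... | no k≢i = trans (cong (λ u → - (u * t i)) (δ-≢ k≢i))
          (trans (zeros (t i) (t k)) (cong (- t k *_) (sym (δ-≢ k≢i))))
        where
        zeros : ∀ x y → - (0ℤ * x) ≡ (- y) * 0ℤ
        zeros = solve-∀
    -t≢0 : ∀ i → - t i ≢ 0ℤ
    -t≢0 i -t≡0 = nonzero (proj₁ (proj₂ (solution i)))
      where
      t≡0 : t i ≡ 0ℤ
      t≡0 = trans (sym (ℤP.neg-involutive (t i))) (cong -_ -t≡0)
      kernel : ∀ j → B j i ≡ 0ℤ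
      kernel = trivial (λ j → B j i) λ k → trans (sym (ℤP.+-identityˡ ((A ⊗ B) k i)))
        (trans (cong (_+ (A ⊗ B) k i) (sym (trans (cong (δ k i *_) t≡0) (ℤP.*-zeroʳ (δ k i))))) (equation i k))
      nonzero : (∃ λ j → proj₁ (solution i) j ≢ 0ℤ) → ⊥
      nonzero (zero , ≢0) = ≢0 t≡0
      nonzero (suc j , ≢0) = ≢0 (kernel j)

open LinearSystems

-- From the characteristic polynomial to the traces of powers

module CharacteristicPolynomials where
  open import Data.Integer using (-_; _-_; _+_; _*_) renaming (+_ to pos)

  -- First-order Taylor expansion. Of the remainder `w` only its integrality matters, since the
  -- expansion is used modulo the square of `h`.
  expand-rows : ∀ {m n} {F : Rows m n → ℤ} → Multilinear F → ∀ (A B : Rows m n) h →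
    ∃ λ w → F (λ i j → h * B i j + A i j) ≡ F A + h * sumℤ (λ i → F (setRow A i (B i))) + h * h * w
  expand-rows {zero} {F = F} F-multi A B h = 0ℤ , trans (Multilinear.resp F-multi (λ ())) (zeros (F A) h)
    where
    zeros : ∀ x h → x ≡ x + h * 0ℤ + h * h * 0ℤ
    zeros = solve-∀
  expand-rows {suc m} {n} {F} F-multi A B h = combine
    (expand-rows (∷-multilinear F-multi (B zero)) (A ∘ suc) (B ∘ suc) h)
    (expand-rows (∷-multilinear F-multi (A zero)) (A ∘ suc) (B ∘ suc) h)
    where
    open Multilinear F-multi
    A′ B′ AB′ : Rows m n
    A′ = A ∘ suc
    B′ = B ∘ suc
    AB′ i j = h * B′ i j + A′ i j
    σ : (Fin n → ℤ) → ℤ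
    σ a = sumℤ (λ i → F (a ∷ setRow A′ i (B′ i)))
    combine : (∃ λ w → F (B zero ∷ AB′) ≡ F (B zero ∷ A′) + h * σ (B zero) + h * h * w) →
              (∃ λ w → F (A zero ∷ AB′) ≡ F (A zero ∷ A′) + h * σ (A zero) + h * h * w) →
              ∃ λ w → F (λ i j → h * B i j + A i j) ≡ F A + h * sumℤ (λ i → F (setRow A i (B i))) + h * h * w
    combine (w₁ , e₁) (w₂ , e₂) = σ (B zero) + w₂ + h * w₁ ,
      trans (linear {λ i j → h * B i j + A i j} {B zero ∷ AB′} {A zero ∷ AB′} zero h
              (λ { zero 0≢ _ → ⊥-elim (0≢ refl) ; (suc i) _ _ → refl })
              (λ { zero 0≢ _ → ⊥-elim (0≢ refl) ; (suc i) _ _ → refl })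
              (λ j → refl))
      (trans (cong₂ (λ u v → h * u + v) e₁ e₂)
      (trans (regroup h (F (B zero ∷ A′)) (σ (B zero)) w₁ (F (A zero ∷ A′)) (σ (A zero)) w₂)
        (cong₂ (λ u v → u + h * v + h * h * (σ (B zero) + w₂ + h * w₁))
          (resp λ { zero _ → refl ; (suc i) _ → refl })
          (cong₂ _+_ (resp λ { zero _ → refl ; (suc i) _ → refl })
            (sum-cong (λ i → resp {A zero ∷ setRow A′ i (B′ i)} {setRow A (suc i) (B (suc i))} λ { zero _ → refl ; (suc k) _ → refl }))))))
      where
      regroup : ∀ h b s w a t v →
        h * (b + h * s + h * h * w) + (a + h * t + h * h * v) ≡ a + h * (b + t) + h * h * (s + v + h * w)
      regroup = solve-∀

  -- Divisibility by `∣ t ∣ + 1` alone forces `t` to be 0.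
  divisible-by-all⇒0 : ∀ t → (∀ (h : ℕ) → ∃ λ w → t ≡ pos (suc h) * w) → t ≡ 0ℤ
  divisible-by-all⇒0 t divides with divides ∣ t ∣
  ... | w , e = ℤP.∣i∣≡0⇒i≡0 (small ∣ w ∣ (trans (cong ∣_∣ e) (ℤP.abs-* (pos (suc ∣ t ∣)) w)))
    where
    small : ∀ k → ∣ t ∣ ≡ suc ∣ t ∣ ℕ.* k → ∣ t ∣ ≡ 0
    small zero    p = trans p (ℕP.*-zeroʳ ∣ t ∣)
    small (suc k) p = ⊥-elim (ℕP.1+n≰n (ℕP.≤-trans (ℕP.m≤m*n (suc ∣ t ∣) (suc k)) (ℕP.≤-reflexive (sym p))))

  charMatrix : ∀ {n} → Matrix n → ℤ → Matrix n
  charMatrix M x i j = x * δ i j - M i j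

  -- The trace of the adjugate is the derivative of the characteristic polynomial. In place of a
  -- limit, the values at `x` and `h + x` fix this derivative modulo every positive `h`.
  trace-adjugate : ∀ {n} (A B : Matrix n) → (∀ x → det (charMatrix A x) ≡ det (charMatrix B x)) →
    ∀ x → trace (adjugate (charMatrix A x)) ≡ trace (adjugate (charMatrix B x))
  trace-adjugate A B P x = ℤP.i-j≡0⇒i≡j (trAdj A) (trAdj B) (divisible-by-all⇒0 (trAdj A - trAdj B) divides)
    where
    trAdj : Matrix _ → ℤ
    trAdj M = trace (adjugate (charMatrix M x))
    expansion : ∀ M h → ∃ λ w → det (charMatrix M (h + x)) ≡ det (charMatrix M x) + h * trAdj M + h * h * w
    expansion M h with expand-rows det-multilinear (charMatrix M x) δ h
    ... | w , e = w , trans (det-cong (λ i j → shift h x (δ i j) (M i j))) e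
      where
      shift : ∀ h x d m → (h + x) * d - m ≡ h * d + (x * d - m)
      shift = solve-∀
    divides : ∀ h → ∃ λ w → trAdj A - trAdj B ≡ pos (suc h) * w
    divides h = combine (expansion A (pos (suc h))) (expansion B (pos (suc h)))
      where
      H = pos (suc h)
      rearrange : ∀ p h ta tb wa wb → h * (ta - tb) ≡ (p + h * ta + h * h * wa) - (p + h * tb + h * h * wb) + h * (h * (wb - wa))
      rearrange = solve-∀
      combine : (∃ λ w → det (charMatrix A (H + x)) ≡ det (charMatrix A x) + H * trAdj A + H * H * w) →
                (∃ λ w → det (charMatrix B (H + x)) ≡ det (charMatrix B x) + H * trAdj B + H * H * w) →
                ∃ λ w → trAdj A - trAdj B ≡ H * w
      combine (wa , ea) (wb , eb) = wb - wa , ℤP.*-cancelˡ-≡ H (trAdj A - trAdj B) (H * (wb - wa))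
        (trans (rearrange (det (charMatrix A x)) H (trAdj A) (trAdj B) wa wb)
        (trans (cong (_+ H * (H * (wb - wa)))
          (trans (cong₂ _-_ (sym ea) (trans (cong (λ u → u + H * trAdj B + H * H * wb) (P x)) (sym eb)))
            (trans (cong (_- det (charMatrix B (H + x))) (P (H + x))) (ℤP.+-inverseʳ (det (charMatrix B (H + x)))))))
          (ℤP.+-identityˡ (H * (H * (wb - wa))))))

  ∣sum∣≤ : ∀ {n} (f : Fin n → ℤ) B → (∀ i → ∣ f i ∣ ℕ.≤ B) → ∣ sumℤ f ∣ ℕ.≤ n ℕ.* B
  ∣sum∣≤ {zero}  f B b = ℕ.z≤n
  ∣sum∣≤ {suc n} f B b = ℕP.≤-trans (ℤP.∣i+j∣≤∣i∣+∣j∣ (f zero) _) (ℕP.+-mono-≤ (b zero) (∣sum∣≤ (f ∘ suc) B (b ∘ suc)))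

  ∣sign∣ : ∀ k → ∣ sign k ∣ ≡ 1
  ∣sign∣ zero = refl
  ∣sign∣ (suc zero) = refl
  ∣sign∣ (suc (suc k)) = ∣sign∣ k

  ∣laplace∣ : ∀ k x y → ∣ sign k * (x * y) ∣ ≡ ∣ x ∣ ℕ.* ∣ y ∣
  ∣laplace∣ k x y = trans (ℤP.abs-* (sign k) (x * y))
    (trans (cong₂ ℕ._*_ (∣sign∣ k) (ℤP.abs-* x y)) (ℕP.*-identityˡ _))

  det-bound : ∀ {n} (A : Matrix n) b → (∀ i j → ∣ A i j ∣ ℕ.≤ b) → ∣ det A ∣ ℕ.≤ n ! ℕ.* b ℕ.^ n
  det-bound {zero}  A b A≤b = ℕP.≤-refl
  det-bound {suc n} A b A≤b = ℕP.≤-trans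
    (∣sum∣≤ (λ j → sign (toℕ j) * (A zero j * det (minor A j))) (b ℕ.* (n ! ℕ.* b ℕ.^ n)) (λ j →
      ℕP.≤-trans (ℕP.≤-reflexive (∣laplace∣ (toℕ j) (A zero j) (det (minor A j))))
        (ℕP.*-mono-≤ (A≤b zero j) (det-bound (minor A j) b (λ r c → A≤b (suc r) (punchIn j c))))))
    (ℕP.≤-reflexive (regroup (suc n) b (n !) (b ℕ.^ n)))
    where
    regroup : ∀ s b f p → s ℕ.* (b ℕ.* (f ℕ.* p)) ≡ s ℕ.* f ℕ.* (b ℕ.* p)
    regroup = ℕ-solve-∀

  -- One row has its own bound `c`. In the adjugate of `charMatrix M x` the replaced row is free of
  -- `x`, and this is what saves one power of `x` against `det-bound`.
  det-bound-row : ∀ {n} (A : Matrix (suc n)) i b c → (∀ j → ∣ A i j ∣ ℕ.≤ c) →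
    (∀ k → k ≢ i → ∀ j → ∣ A k j ∣ ℕ.≤ b) → ∣ det A ∣ ℕ.≤ (suc n) ! ℕ.* (c ℕ.* b ℕ.^ n)
  det-bound-row {n} A zero b c Ai≤c A≤b = ℕP.≤-trans
    (∣sum∣≤ (λ j → sign (toℕ j) * (A zero j * det (minor A j))) (c ℕ.* (n ! ℕ.* b ℕ.^ n)) (λ j →
      ℕP.≤-trans (ℕP.≤-reflexive (∣laplace∣ (toℕ j) (A zero j) (det (minor A j))))
        (ℕP.*-mono-≤ (Ai≤c j) (det-bound (minor A j) b (λ r k → A≤b (suc r) (λ ()) (punchIn j k))))))
    (ℕP.≤-reflexive (regroup (suc n) c (n !) (b ℕ.^ n)))
    where
    regroup : ∀ s b f p → s ℕ.* (b ℕ.* (f ℕ.* p)) ≡ s ℕ.* f ℕ.* (b ℕ.* p)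
    regroup = ℕ-solve-∀
  det-bound-row {suc n} A (suc i) b c Ai≤c A≤b = ℕP.≤-trans
    (∣sum∣≤ (λ j → sign (toℕ j) * (A zero j * det (minor A j))) (b ℕ.* ((suc n) ! ℕ.* (c ℕ.* b ℕ.^ n))) (λ j →
      ℕP.≤-trans (ℕP.≤-reflexive (∣laplace∣ (toℕ j) (A zero j) (det (minor A j))))
        (ℕP.*-mono-≤ (A≤b zero (λ ()) j) (det-bound-row (minor A j) i b c (λ k → Ai≤c (punchIn j k))
          (λ r r≢i k → A≤b (suc r) (r≢i ∘ FinP.suc-injective) (punchIn j k))))))
    (ℕP.≤-reflexive (regroup (suc (suc n)) b ((suc n) !) c (b ℕ.^ n)))
    where
    regroup : ∀ s b f c p → s ℕ.* (b ℕ.* (f ℕ.* (c ℕ.* p))) ≡ s ℕ.* f ℕ.* (c ℕ.* (b ℕ.* p))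
    regroup = ℕ-solve-∀

  ^-distribʳ-* : ∀ n a b → (a ℕ.* b) ℕ.^ n ≡ a ℕ.^ n ℕ.* b ℕ.^ n
  ^-distribʳ-* zero a b = refl
  ^-distribʳ-* (suc n) a b = trans (cong (a ℕ.* b ℕ.*_) (^-distribʳ-* n a b)) (ℕP.[m*n]*[o*p]≡[m*o]*[n*p] a b (a ℕ.^ n) (b ℕ.^ n))

  bounded : ∀ {n} (f : Fin n → ℕ) → ∃ λ K → ∀ i → f i ℕ.≤ K
  bounded {zero} f = 0 , λ ()
  bounded {suc n} f with bounded (f ∘ suc)
  ... | K , b = f zero ℕ.+ K , λ { zero → ℕP.m≤m+n (f zero) K ; (suc i) → ℕP.≤-trans (b i) (ℕP.m≤n+m K (f zero)) }

  entry-bound : ∀ {m n} (M : Rows m n) → ∃ λ K → ∀ i j → ∣ M i j ∣ ℕ.≤ K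
  entry-bound M with bounded (λ i → proj₁ (bounded (λ j → ∣ M i j ∣)))
  ... | K , b = K , λ i j → ℕP.≤-trans (proj₂ (bounded (λ j → ∣ M i j ∣)) j) (b i)

  ∣δ∣≤1 : ∀ {n} (i j : Fin n) → ∣ δ i j ∣ ℕ.≤ 1
  ∣δ∣≤1 i j with i FinP.≟ j
  ... | yes refl = ℕP.≤-reflexive (cong ∣_∣ (δ-≡ i))
  ... | no i≢j = ℕP.≤-trans (ℕP.≤-reflexive (cong ∣_∣ (δ-≢ i≢j))) ℕ.z≤n

  charMatrix-bound : ∀ {n} (M : Matrix n) K → (∀ i j → ∣ M i j ∣ ℕ.≤ K) →
    ∀ Y i j → ∣ charMatrix M (pos (suc Y)) i j ∣ ℕ.≤ suc K ℕ.* suc Y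
  charMatrix-bound M K M≤K Y i j = ℕP.≤-trans (ℤP.∣i-j∣≤∣i∣+∣j∣ (pos (suc Y) * δ i j) (M i j))
    (ℕP.+-mono-≤
      (ℕP.≤-trans (ℕP.≤-reflexive (ℤP.abs-* (pos (suc Y)) (δ i j)))
        (ℕP.≤-trans (ℕP.*-monoʳ-≤ (suc Y) (∣δ∣≤1 i j)) (ℕP.≤-reflexive (ℕP.*-identityʳ (suc Y)))))
      (ℕP.≤-trans (M≤K i j) (ℕP.m≤m*n K (suc Y))))

  -- O n f expresses f x = O(x ^ (n - 1)), avoiding the truncated subtraction; f X is the value at x = X + 1.
  O : ℕ → (ℕ → ℤ) → Set
  O n f = ∃ λ C → ∀ Y → ∣ f Y ∣ ℕ.* suc Y ℕ.≤ C ℕ.* suc Y ℕ.^ n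

  O-+ : ∀ {n f g} → O n f → O n g → O n (λ Y → f Y + g Y)
  O-+ {n} {f} {g} (C , c) (D , d) = C ℕ.+ D , λ Y → ℕP.≤-trans
    (ℕP.*-monoˡ-≤ (suc Y) (ℤP.∣i+j∣≤∣i∣+∣j∣ (f Y) (g Y)))
    (ℕP.≤-trans (ℕP.≤-reflexive (ℕP.*-distribʳ-+ (suc Y) ∣ f Y ∣ ∣ g Y ∣))
      (ℕP.≤-trans (ℕP.+-mono-≤ (c Y) (d Y)) (ℕP.≤-reflexive (sym (ℕP.*-distribʳ-+ (suc Y ℕ.^ n) C D)))))

  O-* : ∀ {n f} a → O n f → O n (λ Y → a * f Y)
  O-* {n} {f} a (C , c) = ∣ a ∣ ℕ.* C , λ Y → ℕP.≤-trans
    (ℕP.≤-reflexive (trans (cong (ℕ._* suc Y) (ℤP.abs-* a (f Y))) (ℕP.*-assoc ∣ a ∣ ∣ f Y ∣ (suc Y))))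
    (ℕP.≤-trans (ℕP.*-monoʳ-≤ ∣ a ∣ (c Y)) (ℕP.≤-reflexive (sym (ℕP.*-assoc ∣ a ∣ C (suc Y ℕ.^ n)))))

  O-sum : ∀ {n m} (f : Fin m → ℕ → ℤ) → (∀ i → O n (f i)) → O n (λ Y → sumℤ (λ i → f i Y))
  O-sum {m = zero}  f b = 0 , λ Y → ℕ.z≤n
  O-sum {n} {m = suc m} f b = O-+ {n} {f zero} {λ Y → sumℤ (λ i → f (suc i) Y)} (b zero) (O-sum {n} (f ∘ suc) (b ∘ suc))

  O-minus : ∀ {n f g} → O n f → O n g → O n (λ Y → f Y - g Y)
  O-minus {n} {f} {g} (C , c) (D , d) = O-+ {n} {f} {λ Y → - g Y} (C , c)
    (D , λ Y → ℕP.≤-trans (ℕP.≤-reflexive (cong (ℕ._* suc Y) (ℤP.∣-i∣≡∣i∣ (g Y)))) (d Y))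

  adjugate-O : ∀ {n} (M : Matrix n) i j → O n (λ Y → adjugate (charMatrix M (pos (suc Y))) i j)
  adjugate-O {suc n} M i j = (suc n) ! ℕ.* suc K ℕ.^ n , λ Y → ℕP.≤-trans
    (ℕP.*-monoˡ-≤ (suc Y) (det-bound-row (setRow (charMatrix M (pos (suc Y))) j (δ i)) j (suc K ℕ.* suc Y) 1
      (λ l → ℕP.≤-trans (ℕP.≤-reflexive (cong ∣_∣ (at (setRow-at (charMatrix M (pos (suc Y))) j (δ i)) l))) (∣δ∣≤1 i l))
      (λ k k≢j l → ℕP.≤-trans (ℕP.≤-reflexive (cong ∣_∣ (at (setRow-off (charMatrix M (pos (suc Y))) j (δ i) k k≢j) l)))
        (charMatrix-bound M K (proj₂ (entry-bound M)) Y k l))))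
    (ℕP.≤-reflexive (trans (cong (λ u → (suc n) ! ℕ.* (1 ℕ.* u) ℕ.* suc Y) (^-distribʳ-* n (suc K) (suc Y)))
      (regroup ((suc n) !) (suc K ℕ.^ n) (suc Y ℕ.^ n) (suc Y))))
    where
    K = proj₁ (entry-bound M)
    regroup : ∀ f k p y → f ℕ.* (1 ℕ.* (k ℕ.* p)) ℕ.* y ≡ f ℕ.* k ℕ.* (y ℕ.* p)
    regroup = ℕ-solve-∀

  -- The polynomial is monic of degree `n`. Row 0 is `x` times a unit vector, which yields `x` times
  -- the polynomial of the minor, plus a row free of `x`, whose determinant has lower order by
  -- `det-bound-row`.
  charPoly-O : ∀ {n} (M : Matrix n) → O n (λ Y → det (charMatrix M (pos (suc Y))) - pos (suc Y ℕ.^ n))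
  charPoly-O {zero} M = 0 , λ Y → ℕ.z≤n
  charPoly-O {suc n} M with charPoly-O (minor M zero) | entry-bound M
  ... | C , c | K , M≤K = C ℕ.+ (suc n) ! ℕ.* (K ℕ.* suc K ℕ.^ n) , λ Y → bound Y
    where
    module _ (Y : ℕ) where
      y = pos (suc Y)
      D = det (charMatrix M y)
      D′ = det (charMatrix (minor M zero) y)
      R : Matrix (suc n)
      R = setRow (charMatrix M y) zero (λ j → - M zero j)
      expansion : D ≡ y * D′ + det R
      expansion = trans (Multilinear.linear det-multilinear {charMatrix M y} {X = setRow (charMatrix M y) zero (δ zero)} {Y = R} zero y
          (λ { zero 0≢ _ → ⊥-elim (0≢ refl) ; (suc i) _ _ → refl })
          (λ { zero 0≢ _ → ⊥-elim (0≢ refl) ; (suc i) _ _ → refl })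
          (λ j → refl))
        (cong (λ u → y * u + det R) (trans
          (det-e₀ (setRow (charMatrix M y) zero (δ zero)) 1ℤ (λ j → sym (ℤP.*-identityˡ (δ zero j))))
          (ℤP.*-identityˡ D′)))
      difference : D - pos (suc Y ℕ.^ suc n) ≡ y * (D′ - pos (suc Y ℕ.^ n)) + det R
      difference = trans (cong₂ _-_ expansion (ℤP.pos-* (suc Y) (suc Y ℕ.^ n))) (regroup y D′ (det R) (pos (suc Y ℕ.^ n)))
        where
        regroup : ∀ y d r p → (y * d + r) - y * p ≡ y * (d - p) + r
        regroup = solve-∀
      detR : ∣ det R ∣ ℕ.≤ (suc n) ! ℕ.* (K ℕ.* (suc K ℕ.* suc Y) ℕ.^ n)
      detR = det-bound-row R zero (suc K ℕ.* suc Y) K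
        (λ j → ℕP.≤-trans (ℕP.≤-reflexive (ℤP.∣-i∣≡∣i∣ (M zero j))) (M≤K zero j))
        (λ { zero 0≢ _ → ⊥-elim (0≢ refl) ; (suc k) _ j → charMatrix-bound M K M≤K Y (suc k) j })
      bound : ∣ D - pos (suc Y ℕ.^ suc n) ∣ ℕ.* suc Y ℕ.≤ (C ℕ.+ (suc n) ! ℕ.* (K ℕ.* suc K ℕ.^ n)) ℕ.* suc Y ℕ.^ suc n
      bound = begin
        ∣ D - pos (suc Y ℕ.^ suc n) ∣ ℕ.* suc Y
          ≡⟨ cong (λ u → ∣ u ∣ ℕ.* suc Y) difference ⟩
        ∣ y * (D′ - pos (suc Y ℕ.^ n)) + det R ∣ ℕ.* suc Y
          ≤⟨ ℕP.*-monoˡ-≤ (suc Y) (ℤP.∣i+j∣≤∣i∣+∣j∣ (y * (D′ - pos (suc Y ℕ.^ n))) (det R)) ⟩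
        (∣ y * (D′ - pos (suc Y ℕ.^ n)) ∣ ℕ.+ ∣ det R ∣) ℕ.* suc Y
          ≡⟨ cong (λ u → (u ℕ.+ ∣ det R ∣) ℕ.* suc Y) (ℤP.abs-* y (D′ - pos (suc Y ℕ.^ n))) ⟩
        (suc Y ℕ.* E ℕ.+ ∣ det R ∣) ℕ.* suc Y
          ≡⟨ distribute (suc Y) E ∣ det R ∣ ⟩
        suc Y ℕ.* (E ℕ.* suc Y) ℕ.+ ∣ det R ∣ ℕ.* suc Y
          ≤⟨ ℕP.+-mono-≤ (ℕP.*-monoʳ-≤ (suc Y) (c Y)) (ℕP.*-monoˡ-≤ (suc Y) detR) ⟩
        suc Y ℕ.* (C ℕ.* p) ℕ.+ (suc n) ! ℕ.* (K ℕ.* (suc K ℕ.* suc Y) ℕ.^ n) ℕ.* suc Y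
          ≡⟨ cong (λ u → suc Y ℕ.* (C ℕ.* p) ℕ.+ (suc n) ! ℕ.* (K ℕ.* u) ℕ.* suc Y) (^-distribʳ-* n (suc K) (suc Y)) ⟩
        suc Y ℕ.* (C ℕ.* p) ℕ.+ (suc n) ! ℕ.* (K ℕ.* (suc K ℕ.^ n ℕ.* p)) ℕ.* suc Y
          ≡⟨ collect (suc Y) C p ((suc n) !) K (suc K ℕ.^ n) ⟩
        (C ℕ.+ (suc n) ! ℕ.* (K ℕ.* suc K ℕ.^ n)) ℕ.* (suc Y ℕ.* p) ∎
        where
        open ℕP.≤-Reasoning
        E = ∣ D′ - pos (suc Y ℕ.^ n) ∣
        p = suc Y ℕ.^ n
        distribute : ∀ y e r → (y ℕ.* e ℕ.+ r) ℕ.* y ≡ y ℕ.* (e ℕ.* y) ℕ.+ r ℕ.* y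
        distribute = ℕ-solve-∀
        collect : ∀ y c p f k q → y ℕ.* (c ℕ.* p) ℕ.+ f ℕ.* (k ℕ.* (q ℕ.* p)) ℕ.* y ≡ (c ℕ.+ f ℕ.* (k ℕ.* q)) ℕ.* (y ℕ.* p)
        collect = ℕ-solve-∀

  -- A nonzero integer `d` has absolute value at least 1, so multiplying by it cannot lower the
  -- order of a monic polynomial of degree `n`.
  monic-multiple-O⇒0 : ∀ {n} (P : ℕ → ℤ) (d : ℤ) → O n (λ Y → P Y - pos (suc Y ℕ.^ n)) → O n (λ Y → P Y * d) → d ≡ 0ℤ
  monic-multiple-O⇒0 {n} P d (C , c) (D , b) with ∣ d ∣ ℕP.≟ 0
  ... | yes d≡0 = ℤP.∣i∣≡0⇒i≡0 d≡0
  ... | no d≢0 = ⊥-elim (ℕP.1+n≰n too-small)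
    where
    -- At the argument `suc Y` both bounds together allow only `D + C` times the power, which is
    -- less than the `suc Y` times required.
    Y = D ℕ.+ C
    p = suc Y ℕ.^ n
    p≢0 : ℕ.NonZero p
    p≢0 = ℕP.m^n≢0 (suc Y) n
    P≤ : ∣ P Y ∣ ℕ.≤ ∣ P Y * d ∣
    P≤ = ℕP.≤-trans (ℕP.m≤m*n ∣ P Y ∣ ∣ d ∣ {{ℕ.≢-nonZero d≢0}}) (ℕP.≤-reflexive (sym (ℤP.abs-* (P Y) d)))
    p≤ : p ℕ.≤ ∣ P Y * d ∣ ℕ.+ ∣ P Y - pos p ∣
    p≤ = ℕP.≤-trans (ℕP.≤-reflexive (cong ∣_∣ (split (P Y) (pos p))))
      (ℕP.≤-trans (ℤP.∣i-j∣≤∣i∣+∣j∣ (P Y) (P Y - pos p)) (ℕP.+-monoˡ-≤ ∣ P Y - pos p ∣ P≤))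
      where
      split : ∀ x y → y ≡ x - (x - y)
      split = solve-∀
    too-small : suc Y ℕ.≤ Y
    too-small = ℕP.*-cancelʳ-≤ (suc Y) Y p {{p≢0}} (begin
      suc Y ℕ.* p ≡⟨ ℕP.*-comm (suc Y) p ⟩
      p ℕ.* suc Y ≤⟨ ℕP.*-monoˡ-≤ (suc Y) p≤ ⟩
      (∣ P Y * d ∣ ℕ.+ ∣ P Y - pos p ∣) ℕ.* suc Y ≡⟨ ℕP.*-distribʳ-+ (suc Y) ∣ P Y * d ∣ ∣ P Y - pos p ∣ ⟩
      ∣ P Y * d ∣ ℕ.* suc Y ℕ.+ ∣ P Y - pos p ∣ ℕ.* suc Y ≤⟨ ℕP.+-mono-≤ (b Y) (c Y) ⟩
      D ℕ.* p ℕ.+ C ℕ.* p ≡⟨ sym (ℕP.*-distribʳ-+ p D C) ⟩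
      (D ℕ.+ C) ℕ.* p ∎)
      where open ℕP.≤-Reasoning

  -- With S_k(x) = tr (M^k adj(xI - M)) one has x S_k - S_{k+1} = P(x) tr M^k; as S_{k+1} has smaller degree
  -- than P, knowing P and S_k determines tr M^k and then S_{k+1}.  The start S_0 = P' depends on P only.
  module _ {n} (A B : Matrix n) (P : ∀ x → det (charMatrix A x) ≡ det (charMatrix B x)) where
    private
      S : Matrix n → ℕ → ℤ → ℤ
      S M k x = trace (power M k ⊗ adjugate (charMatrix M x))

      S-suc : ∀ M k x → S M (suc k) x ≡ x * S M k x - det (charMatrix M x) * trace (power M k)
      S-suc M k x = trans (trace-cong (⊗-assoc N M Adj))
        (trans (sum-cong λ i → row i)
        (trans (sum-minus (λ i → x * (N ⊗ Adj) i i) (λ i → det C * N i i))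
          (cong₂ _-_ (sum-*ˡ x (λ i → (N ⊗ Adj) i i)) (sum-*ˡ (det C) (λ i → N i i)))))
        where
        N = power M k
        C = charMatrix M x
        Adj = adjugate C
        column : ∀ l i → (M ⊗ Adj) l i ≡ x * Adj l i - det C * δ l i
        column l i = trans (isolate (x * Adj l i) ((M ⊗ Adj) l i) (det C * δ l i)
            (trans (sym (trans (sum-cong (λ m → distrib x (δ l m) (M l m) (Adj m i)))
              (trans (sum-minus (λ m → x * (δ l m * Adj m i)) (λ m → M l m * Adj m i))
                (cong (_- (M ⊗ Adj) l i) (trans (sum-*ˡ x (λ m → δ l m * Adj m i)) (cong (x *_) (sum-δ l (λ m → Adj m i))))))))
              (⊗-adjugate C l i))) refl
          where
          distrib : ∀ x d m a → (x * d - m) * a ≡ x * (d * a) - m * a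
          distrib = solve-∀
          isolate : ∀ u v w → u - v ≡ w → v ≡ u - w
          isolate u v w e = trans (solution u v) (cong (_-_ u) e)
            where
            solution : ∀ u v → v ≡ u - (u - v)
            solution = solve-∀
        row : ∀ i → (N ⊗ (M ⊗ Adj)) i i ≡ x * (N ⊗ Adj) i i - det C * N i i
        row i = trans (sum-cong (λ l → trans (cong (N i l *_) (column l i)) (distrib (N i l) x (Adj l i) (det C) (δ l i))))
          (trans (sum-minus (λ l → x * (N i l * Adj l i)) (λ l → det C * (N i l * δ l i)))
            (cong₂ _-_ (sum-*ˡ x (λ l → N i l * Adj l i))
              (trans (sum-*ˡ (det C) (λ l → N i l * δ l i)) (cong (det C *_) (sum-δʳ i (N i))))))
          where
          distrib : ∀ n x a d e → n * (x * a - d * e) ≡ x * (n * a) - d * (n * e)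
          distrib = solve-∀

      S-O : ∀ M k → O n (λ Y → S M k (pos (suc Y)))
      S-O M k = O-sum {n} _ (λ i → O-sum {n} _ (λ l → O-* {n} (power M k i l) (adjugate-O M l i)))

      traces : ∀ k → (∀ x → S A k x ≡ S B k x) → trace (power A k) ≡ trace (power B k)
      traces k Sk = ℤP.i-j≡0⇒i≡j (trace (power A k)) (trace (power B k))
          (monic-multiple-O⇒0 {n} (λ Y → det (charMatrix A (pos (suc Y)))) _ (charPoly-O A)
            (proj₁ S-diff , λ Y → subst (λ u → ∣ u ∣ ℕ.* suc Y ℕ.≤ proj₁ S-diff ℕ.* suc Y ℕ.^ n) (formula (pos (suc Y))) (proj₂ S-diff Y)))
        where
        S-diff : O n (λ Y → S B (suc k) (pos (suc Y)) - S A (suc k) (pos (suc Y)))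
        S-diff = O-minus {n} {λ Y → S B (suc k) (pos (suc Y))} {λ Y → S A (suc k) (pos (suc Y))} (S-O B (suc k)) (S-O A (suc k))
        formula : ∀ x → S B (suc k) x - S A (suc k) x ≡ det (charMatrix A x) * (trace (power A k) - trace (power B k))
        formula x = trans (cong₂ _-_ (trans (S-suc B k x) (cong₂ (λ u v → x * u - v * trace (power B k)) (sym (Sk x)) (sym (P x)))) (S-suc A k x))
          (regroup x (S A k x) (det (charMatrix A x)) (trace (power A k)) (trace (power B k)))
          where
          regroup : ∀ x s d a b → (x * s - d * b) - (x * s - d * a) ≡ d * (a - b)
          regroup = solve-∀

      S-equal : ∀ k x → S A k x ≡ S B k x
      S-equal zero x = trans (trace-cong (⊗-identityˡ (adjugate (charMatrix A x))))
        (trans (trace-adjugate A B P x) (sym (trace-cong (⊗-identityˡ (adjugate (charMatrix B x))))))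
      S-equal (suc k) x = trans (S-suc A k x)
        (trans (cong₂ _-_ (cong (x *_) (S-equal k x)) (cong₂ _*_ (P x) (traces k (S-equal k)))) (sym (S-suc B k x)))

    trace-powers : ∀ k → trace (power A k) ≡ trace (power B k)
    trace-powers k = traces k (S-equal k)

open CharacteristicPolynomials

-- Nonnegative sums, adjacency matrices and low-order traces

module AdjacencyMatrices where
  open import Data.Integer using (_≤_; -_; _-_; _+_; _*_) renaming (+_ to pos)

  0≤-+ : ∀ {x y} → 0ℤ ≤ x → 0ℤ ≤ y → 0ℤ ≤ x + y
  0≤-+ p q = ℤP.+-mono-≤ p q

  0≤-* : ∀ {x y} → 0ℤ ≤ x → 0ℤ ≤ y → 0ℤ ≤ x * y
  0≤-* {x} {y} p q = ℤP.≤-trans (ℤP.≤-reflexive (sym (ℤP.*-zeroʳ x))) (ℤP.*-monoˡ-≤-nonNeg x {{ℤ.nonNegative p}} q)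

  0≤pos : ∀ n → 0ℤ ≤ pos n
  0≤pos n = ℤ.+≤+ ℕ.z≤n

  ≤-by : ∀ {x y} z → 0ℤ ≤ z → y - x ≡ z → x ≤ y
  ≤-by z 0≤z e = ℤP.0≤i-j⇒j≤i (subst (0ℤ ≤_) (sym e) 0≤z)

  0≤y-x : ∀ {x y} → x ≤ y → 0ℤ ≤ y - x
  0≤y-x = ℤP.i≤j⇒0≤j-i

  sum-mono : ∀ {n} {f g : Fin n → ℤ} → (∀ i → f i ≤ g i) → sumℤ f ≤ sumℤ g
  sum-mono {zero}  f≤g = ℤP.≤-refl
  sum-mono {suc n} f≤g = ℤP.+-mono-≤ (f≤g zero) (sum-mono (f≤g ∘ suc))

  0≤sum : ∀ {n} {f : Fin n → ℤ} → (∀ i → 0ℤ ≤ f i) → 0ℤ ≤ sumℤ f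
  0≤sum {zero}  0≤f = ℤP.≤-refl
  0≤sum {suc n} 0≤f = 0≤-+ (0≤f zero) (0≤sum (0≤f ∘ suc))

  0≤x,0≤y,x+y≡0 : ∀ {x y} → 0ℤ ≤ x → 0ℤ ≤ y → x + y ≡ 0ℤ → x ≡ 0ℤ × y ≡ 0ℤ
  0≤x,0≤y,x+y≡0 {x} {y} p q e = x≡0 , trans (sym (ℤP.+-identityˡ y)) (trans (cong (_+ y) (sym x≡0)) e)
    where
    cancel : ∀ x y → (x + y) - x ≡ y
    cancel = solve-∀
    x≡0 : x ≡ 0ℤ
    x≡0 = ℤP.≤-antisym (≤-by y q (trans (cong (_- x) (sym e)) (cancel x y))) p

  sum-nonneg≡0 : ∀ {n} {f : Fin n → ℤ} → (∀ i → 0ℤ ≤ f i) → sumℤ f ≡ 0ℤ → ∀ i → f i ≡ 0ℤ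
  sum-nonneg≡0 {suc n} 0≤f e i with 0≤x,0≤y,x+y≡0 (0≤f zero) (0≤sum (0≤f ∘ suc)) e
  sum-nonneg≡0 {suc n} 0≤f e zero    | f₀≡0 , rest = f₀≡0
  sum-nonneg≡0 {suc n} 0≤f e (suc i) | f₀≡0 , rest = sum-nonneg≡0 (0≤f ∘ suc) rest i

  ∑∑ : ∀ {m n} → Rows m n → ℤ
  ∑∑ f = sumℤ (λ i → sumℤ (f i))

  ∑∑-cong : ∀ {m n} {f g : Rows m n} → f ≈ g → ∑∑ f ≡ ∑∑ g
  ∑∑-cong e = sum-cong (λ i → sum-cong (e i))

  ∑∑-+ : ∀ {m n} (f g : Rows m n) → ∑∑ (λ i j → f i j + g i j) ≡ ∑∑ f + ∑∑ g
  ∑∑-+ f g = trans (sum-cong (λ i → sum-+ (f i) (g i))) (sum-+ (λ i → sumℤ (f i)) (λ i → sumℤ (g i)))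

  ∑∑-* : ∀ {m n} c (f : Rows m n) → ∑∑ (λ i j → c * f i j) ≡ c * ∑∑ f
  ∑∑-* c f = trans (sum-cong (λ i → sum-*ˡ c (f i))) (sum-*ˡ c (λ i → sumℤ (f i)))

  -- Graphs are handled as integer matrices, so that the graph left by removing the apex, which is
  -- just a block of the full matrix, falls under the same lemmas.
  record Adjacency {n} (A : Matrix n) : Set where
    field
      symm     : ∀ i j → A i j ≡ A j i
      loopless : ∀ i → A i i ≡ 0ℤ
      binary   : ∀ i j → A i j ≡ 0ℤ ⊎ A i j ≡ 1ℤ

    idem : ∀ i j → A i j * A i j ≡ A i j
    idem i j with A i j | binary i j
    ... | _ | inj₁ refl = refl
    ... | _ | inj₂ refl = refl

    0≤A : ∀ i j → 0ℤ ≤ A i j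
    0≤A i j with A i j | binary i j
    ... | _ | inj₁ refl = 0≤pos 0
    ... | _ | inj₂ refl = 0≤pos 1

  deg : ∀ {n} → Matrix n → Fin n → ℤ
  deg A i = sumℤ (A i)

  -- The diagonal is left free: the degrees give the signless Laplacian, and minus the indicator of
  -- the leaves gives the inner block of Q - 3.
  loops : ∀ {n} → (Fin n → ℤ) → Matrix n → Matrix n
  loops d A i j = δ i j * d i + A i j

  ⊗-loops : ∀ {n} (Z : Matrix n) d A i j → (Z ⊗ loops d A) i j ≡ Z i j * d j + (Z ⊗ A) i j
  ⊗-loops Z d A i j =
    trans (sum-cong (λ k → distrib (Z i k) (δ k j) (d k) (A k j)))
    (trans (sum-+ (λ k → (Z i k * d k) * δ k j) (λ k → Z i k * A k j))
           (cong (_+ (Z ⊗ A) i j) (sum-δʳ j (λ k → Z i k * d k))))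
    where
    distrib : ∀ z e d a → z * (e * d + a) ≡ (z * d) * e + z * a
    distrib = solve-∀

  loops-⊗ : ∀ {n} d A (Z : Matrix n) i j → (loops d A ⊗ Z) i j ≡ d i * Z i j + (A ⊗ Z) i j
  loops-⊗ d A Z i j =
    trans (sum-cong (λ k → distrib (δ i k) (d i) (A i k) (Z k j)))
    (trans (sum-+ (λ k → δ i k * (d i * Z k j)) (λ k → A i k * Z k j))
           (cong (_+ (A ⊗ Z) i j) (sum-δ i (λ k → d i * Z k j))))
    where
    distrib : ∀ e d a z → (e * d + a) * z ≡ e * (d * z) + a * z
    distrib = solve-∀

  loops-square : ∀ {n} d (A : Matrix n) i j →
    (loops d A ⊗ loops d A) i j ≡ δ i j * (d i * d i) + (d i + d j) * A i j + (A ⊗ A) i j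
  loops-square d A i j = trans (⊗-loops (loops d A) d A i j)
    (trans (cong (loops d A i j * d j +_) (loops-⊗ d A A i j)) (δ-swap (δ i j) (d i) (d j) (A i j) ((A ⊗ A) i j) commute))
    where
    commute : δ i j * d j ≡ δ i j * d i
    commute with i FinP.≟ j
    ... | yes refl = refl
    ... | no i≢j = trans (cong (_* d j) (δ-≢ i≢j)) (sym (cong (_* d i) (δ-≢ i≢j)))
    δ-swap : ∀ e x y a s → e * y ≡ e * x → (e * x + a) * y + (x * a + s) ≡ e * (x * x) + (x + y) * a + s
    δ-swap e x y a s p = trans (expand e x y a s) (trans (cong (λ u → u * x + (x + y) * a + s) p) (collect e x y a s))
      where
      expand : ∀ e x y a s → (e * x + a) * y + (x * a + s) ≡ (e * y) * x + (x + y) * a + s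
      expand = solve-∀
      collect : ∀ e x y a s → (e * x) * x + (x + y) * a + s ≡ e * (x * x) + (x + y) * a + s
      collect = solve-∀

  module AdjacencyProperties {n} {A : Matrix n} (adjA : Adjacency A) where
    open Adjacency adjA

    square-diagonal : ∀ i → (A ⊗ A) i i ≡ deg A i
    square-diagonal i = sum-cong (λ k → trans (cong (A i k *_) (symm k i)) (idem i k))

    square-sym : ∀ i j → (A ⊗ A) i j ≡ (A ⊗ A) j i
    square-sym i j = sum-cong (λ k → trans (cong₂ _*_ (symm i k) (symm k j)) (ℤP.*-comm (A k i) (A j k)))

    -- Closed 3-walks from `i`: each triangle through `i` is counted twice.
    triangles : Fin n → ℤ
    triangles i = sumℤ (λ j → A i j * (A ⊗ A) i j)

    δA≡0 : ∀ i j → δ i j * A i j ≡ 0ℤ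
    δA≡0 i j with i FinP.≟ j
    ... | yes refl = trans (cong (δ i i *_) (loopless i)) (ℤP.*-zeroʳ (δ i i))
    ... | no i≢j = trans (cong (_* A i j) (δ-≢ i≢j)) (ℤP.*-zeroˡ (A i j))

    trace-loops¹ : ∀ d → trace (power (loops d A) 1) ≡ sumℤ d
    trace-loops¹ d = trans (trace-cong (⊗-identityˡ (loops d A)))
      (sum-cong (λ i → trans (cong₂ (λ u v → u * d i + v) (δ-≡ i) (loopless i)) (unit (d i))))
      where
      unit : ∀ x → 1ℤ * x + 0ℤ ≡ x
      unit = solve-∀

    loops-square-diagonal : ∀ d i → (loops d A ⊗ loops d A) i i ≡ d i * d i + deg A i
    loops-square-diagonal d i = trans (loops-square d A i i)
      (trans (cong₂ (λ u v → u * (d i * d i) + (d i + d i) * v + (A ⊗ A) i i) (δ-≡ i) (loopless i))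
      (trans (cong (1ℤ * (d i * d i) + (d i + d i) * 0ℤ +_) (square-diagonal i)) (unit (d i) (deg A i))))
      where
      unit : ∀ x y → 1ℤ * (x * x) + (x + x) * 0ℤ + y ≡ x * x + y
      unit = solve-∀

    power² : ∀ (M : Matrix n) → power M 2 ≈ M ⊗ M
    power² M = ⊗-cong (⊗-identityˡ M) (λ i j → refl)

    trace-loops² : ∀ d → trace (power (loops d A) 2) ≡ sumℤ (λ i → d i * d i) + sumℤ (deg A)
    trace-loops² d = trans (trace-cong (power² (loops d A)))
      (trans (sum-cong (loops-square-diagonal d)) (sum-+ (λ i → d i * d i) (deg A)))

    -- In the cube of diagonal plus `A`, the words with one factor `A` have zero trace, those with
    -- two are equal up to rotation and reduce to degrees, and the word with three counts triangles.
    trace-loops³ : ∀ d → trace (power (loops d A) 3) ≡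
      sumℤ (λ i → d i * d i * d i) + pos 3 * sumℤ (λ i → d i * deg A i) + sumℤ triangles
    trace-loops³ d = trans (trace-cong (⊗-cong (power² M) (λ i j → refl)))
      (trans (sum-cong (λ i → trans (⊗-loops (M ⊗ M) d A i i)
        (trans (cong₂ _+_ (cong (_* d i) (loops-square-diagonal d i)) (sum-cong (λ k → term i k)))
        (trans (cong ((d i * d i + deg A i) * d i +_)
          (trans (sum-+ (λ k → d i * A i k + A i k * d k) (λ k → A i k * (A ⊗ A) i k))
            (cong (_+ triangles i) (trans (sum-+ (λ k → d i * A i k) (λ k → A i k * d k))
              (cong (_+ sumℤ (λ k → A i k * d k)) (sum-*ˡ (d i) (A i)))))))
          (regroup (d i) (deg A i) (sumℤ (λ k → A i k * d k)) (triangles i))))))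
      (trans (sum-+ (λ i → d i * d i * d i + pos 2 * (d i * deg A i) + sumℤ (λ k → A i k * d k)) triangles)
        (cong (_+ sumℤ triangles) (trans (sum-+ (λ i → d i * d i * d i + pos 2 * (d i * deg A i)) (λ i → sumℤ (λ k → A i k * d k)))
          (trans (cong₂ _+_ (trans (sum-+ (λ i → d i * d i * d i) (λ i → pos 2 * (d i * deg A i)))
                   (cong (sumℤ (λ i → d i * d i * d i) +_) (sum-*ˡ (pos 2) (λ i → d i * deg A i)))) transposed)
            (total (sumℤ (λ i → d i * d i * d i)) (sumℤ (λ i → d i * deg A i))))))))
      where
      M = loops d A
      term : ∀ i k → (M ⊗ M) i k * A k i ≡ (d i * A i k + A i k * d k) + A i k * (A ⊗ A) i k
      term i k = trans (cong₂ _*_ (loops-square d A i k) (symm k i))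
        (trans (expand (δ i k) (d i) (d k) (A i k) ((A ⊗ A) i k))
          (trans (cong₂ (λ u v → u * (d i * d i) + (d i + d k) * v + A i k * (A ⊗ A) i k) (δA≡0 i k) (idem i k))
            (collect (d i) (d k) (A i k) ((A ⊗ A) i k))))
        where
        expand : ∀ e x y a s → (e * (x * x) + (x + y) * a + s) * a ≡ (e * a) * (x * x) + (x + y) * (a * a) + a * s
        expand = solve-∀
        collect : ∀ x y a s → 0ℤ * (x * x) + (x + y) * a + a * s ≡ (x * a + a * y) + a * s
        collect = solve-∀
      regroup : ∀ x e s t → (x * x + e) * x + ((x * e + s) + t) ≡ (x * x * x + pos 2 * (x * e) + s) + t
      regroup = solve-∀
      transposed : sumℤ (λ i → sumℤ (λ k → A i k * d k)) ≡ sumℤ (λ i → d i * deg A i)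
      transposed = trans (sum-swap (λ i k → A i k * d k)) (sum-cong (λ k →
        trans (sum-*ʳ (d k) (λ i → A i k)) (trans (ℤP.*-comm _ (d k)) (cong (d k *_) (sum-cong (λ i → symm i k))))))
      total : ∀ x y → x + pos 2 * y + y ≡ x + pos 3 * y
      total = solve-∀

open AdjacencyMatrices

-- The degree sequence of a cospectral graph

module DegreeSequences where
  open import Data.Integer using (_≤_; -_; _-_; _+_; _*_) renaming (+_ to pos)

  maximum : ∀ {n} (f : Fin (suc n) → ℤ) → ∃ λ h → ∀ i → f i ≤ f h
  maximum {zero} f = zero , λ { zero → ℤP.≤-refl }
  maximum {suc n} f with maximum (f ∘ suc)
  ... | h , max with ℤP.≤-total (f zero) (f (suc h))
  ...   | inj₁ ≤h = suc h , λ { zero → ≤h ; (suc i) → max i }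
  ...   | inj₂ h≤ = zero , λ { zero → ℤP.≤-refl ; (suc i) → ℤP.≤-trans (max i) h≤ }

  -- Integrality is essential: the product is negative only strictly between 2 and 3.
  consecutive-product-nonneg : ∀ d → 0ℤ ≤ (d - pos 2) * (d - pos 3)
  consecutive-product-nonneg d with d ℤP.≤? pos 2
  ... | yes d≤2 = ≤-by ((pos 2 - d) * ((pos 2 - d) + 1ℤ))
      (0≤-* (0≤y-x d≤2) (0≤-+ (0≤y-x d≤2) (0≤pos 1))) (identity d)
    where
    identity : ∀ d → (d - pos 2) * (d - pos 3) - 0ℤ ≡ (pos 2 - d) * ((pos 2 - d) + 1ℤ)
    identity = solve-∀
  ... | no d≰2 = 0≤-* {d - pos 2} {d - pos 3} (ℤP.≤-trans (0≤y-x 3≤d) (≤-by 1ℤ (0≤pos 1) (step d))) (0≤y-x 3≤d)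
    where
    3≤d : pos 3 ≤ d
    3≤d = ℤP.i<j⇒suc[i]≤j (ℤP.≰⇒> d≰2)
    step : ∀ d → (d - pos 2) - (d - pos 3) ≡ 1ℤ
    step = solve-∀

  consecutive-product≡0 : ∀ d → (d - pos 2) * (d - pos 3) ≡ 0ℤ → d ≡ pos 2 ⊎ d ≡ pos 3
  consecutive-product≡0 d e with ℤP.i*j≡0⇒i≡0∨j≡0 (d - pos 2) e
  ... | inj₁ p = inj₁ (ℤP.i-j≡0⇒i≡j d (pos 2) p)
  ... | inj₂ p = inj₂ (ℤP.i-j≡0⇒i≡j d (pos 3) p)

  sum-cubic : ∀ {n} (f : Fin n → ℤ) a b c e →
    sumℤ (λ i → a * (f i * f i * f i) + b * (f i * f i) + c * f i + e) ≡
    a * sumℤ (λ i → f i * f i * f i) + b * sumℤ (λ i → f i * f i) + c * sumℤ f + pos n * e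
  sum-cubic {n} f a b c e =
    trans (sum-+ (λ i → a * (f i * f i * f i) + b * (f i * f i) + c * f i) (λ _ → e))
    (cong₂ _+_ (trans (sum-+ (λ i → a * (f i * f i * f i) + b * (f i * f i)) (λ i → c * f i))
      (cong₂ _+_ (trans (sum-+ (λ i → a * (f i * f i * f i)) (λ i → b * (f i * f i)))
        (cong₂ _+_ (sum-*ˡ a (λ i → f i * f i * f i)) (sum-*ˡ b (λ i → f i * f i)))) (sum-*ˡ c f)))
      (sum-const n e))

  module DegreeBounds {n} {A : Matrix n} (adjA : Adjacency A) where
    open Adjacency adjA
    open AdjacencyProperties adjA

    d : Fin n → ℤ
    d = deg A

    0≤1-A : ∀ i j → 0ℤ ≤ 1ℤ - A i j
    0≤1-A i j with A i j | binary i j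
    ... | _ | inj₁ refl = 0≤pos 1
    ... | _ | inj₂ refl = 0≤pos 0

    -- The difference counts the neighbours of `i` other than `j` that are not adjacent to `j`.
    codegree-bound : ∀ i j → A i j ≡ 1ℤ → 0ℤ ≤ d i - 1ℤ - (A ⊗ A) i j
    codegree-bound i j Aij≡1 = subst (0ℤ ≤_) total (0≤sum term)
      where
      term : ∀ k → 0ℤ ≤ (A i k - δ j k * 1ℤ) - A i k * A k j
      term k with j FinP.≟ k
      ... | yes refl = ℤP.≤-reflexive (sym (trans
          (cong₂ (λ u v → (u - v * 1ℤ) - u * A j j) Aij≡1 (δ-≡ j)) (cong (λ u → (1ℤ - 1ℤ * 1ℤ) - 1ℤ * u) (loopless j))))
      ... | no j≢k = ≤-by (A i k * (1ℤ - A k j)) (0≤-* (0≤A i k) (0≤1-A k j))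
          (trans (cong (λ u → (A i k - u * 1ℤ) - A i k * A k j - 0ℤ) (δ-≢ j≢k)) (factor (A i k) (A k j)))
        where
        factor : ∀ x y → (x - 0ℤ * 1ℤ) - x * y - 0ℤ ≡ x * (1ℤ - y)
        factor = solve-∀
      total : sumℤ (λ k → (A i k - δ j k * 1ℤ) - A i k * A k j) ≡ d i - 1ℤ - (A ⊗ A) i j
      total = trans (sum-minus (λ k → A i k - δ j k * 1ℤ) (λ k → A i k * A k j))
        (cong (_- (A ⊗ A) i j) (trans (sum-minus (A i) (λ k → δ j k * 1ℤ)) (cong (_-_ (d i)) (sum-δ j (λ _ → 1ℤ)))))

    triangles-bound : ∀ i → triangles i ≤ d i * d i - d i
    triangles-bound i = ≤-by _ (0≤sum term) (sym total)
      where
      term : ∀ j → 0ℤ ≤ A i j * (d i - 1ℤ - (A ⊗ A) i j)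
      term j with binary i j
      ... | inj₁ e = ℤP.≤-reflexive (sym (trans (cong (_* (d i - 1ℤ - (A ⊗ A) i j)) e) (ℤP.*-zeroˡ (d i - 1ℤ - (A ⊗ A) i j))))
      ... | inj₂ e = 0≤-* (0≤A i j) (codegree-bound i j e)
      distrib : ∀ a d s → a * (d - 1ℤ - s) ≡ (a * d - a) - a * s
      distrib = solve-∀
      total : sumℤ (λ j → A i j * (d i - 1ℤ - (A ⊗ A) i j)) ≡ d i * d i - d i - triangles i
      total = trans (sum-cong (λ j → distrib (A i j) (d i) ((A ⊗ A) i j)))
        (trans (sum-minus (λ j → A i j * d i - A i j) (λ j → A i j * (A ⊗ A) i j))
          (cong (_- triangles i) (trans (sum-minus (λ j → A i j * d i) (A i)) (cong (_- d i) (sum-*ʳ (d i) (A i))))))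

    -- A triangle at h is an edge between two neighbours of h, hence an edge missing h.
    triangles-edge-bound : ∀ h → triangles h ≤ sumℤ d - pos 2 * d h
    triangles-edge-bound h = ≤-by _ (0≤sum (λ j → 0≤sum (term j))) (sym total)
      where
      cell : Fin n → Fin n → ℤ
      cell j k = (A j k - δ h j * A j k - A j k * δ k h) - A h j * (A h k * A k j)
      term : ∀ j k → 0ℤ ≤ cell j k
      term j k with h FinP.≟ j | k FinP.≟ h
      ... | yes refl | _ = ℤP.≤-reflexive (sym (trans
          (cong₂ (λ u v → (A h k - u * A h k - v) - A h h * (A h k * A k h)) (δ-≡ h) (trans (ℤP.*-comm (A h k) (δ k h)) (trans (cong (δ k h *_) (symm h k)) (δA≡0 k h))))
          (trans (cong (λ u → (A h k - 1ℤ * A h k - 0ℤ) - u * (A h k * A k h)) (loopless h)) (zeros (A h k) (A k h)))))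
        where
        zeros : ∀ x y → (x - 1ℤ * x - 0ℤ) - 0ℤ * (x * y) ≡ 0ℤ
        zeros = solve-∀
      ... | no h≢j | yes refl = ℤP.≤-reflexive (sym (trans
          (cong₂ (λ u v → (A j h - u * A j h - A j h * v) - A h j * (A h h * A h j)) (δ-≢ h≢j) (δ-≡ h))
          (trans (cong (λ u → (A j h - 0ℤ * A j h - A j h * 1ℤ) - A h j * (u * A h j)) (loopless h)) (zeros (A j h) (A h j)))))
        where
        zeros : ∀ x y → (x - 0ℤ * x - x * 1ℤ) - y * (0ℤ * y) ≡ 0ℤ
        zeros = solve-∀
      ... | no h≢j | no k≢h = ≤-by (A j k * (1ℤ - A h j) + A j k * A h j * (1ℤ - A h k))
          (0≤-+ (0≤-* (0≤A j k) (0≤1-A h j)) (0≤-* (0≤-* (0≤A j k) (0≤A h j)) (0≤1-A h k)))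
          (trans (cong₂ (λ u v → (A j k - u * A j k - A j k * v) - A h j * (A h k * A k j) - 0ℤ) (δ-≢ h≢j) (δ-≢ k≢h))
          (trans (cong (λ u → (A j k - 0ℤ * A j k - A j k * 0ℤ) - A h j * (A h k * u) - 0ℤ) (symm k j)) (factor (A j k) (A h j) (A h k))))
        where
        factor : ∀ x y z → (x - 0ℤ * x - x * 0ℤ) - y * (z * x) - 0ℤ ≡ x * (1ℤ - y) + x * y * (1ℤ - z)
        factor = solve-∀
      row : ∀ j → sumℤ (cell j) ≡ (d j - δ h j * d j - A h j) - A h j * (A ⊗ A) h j
      row j = trans (sum-minus (λ k → A j k - δ h j * A j k - A j k * δ k h) (λ k → A h j * (A h k * A k j)))
        (cong₂ _-_ (trans (sum-minus (λ k → A j k - δ h j * A j k) (λ k → A j k * δ k h))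
            (cong₂ _-_ (trans (sum-minus (A j) (λ k → δ h j * A j k)) (cong (_-_ (d j)) (sum-*ˡ (δ h j) (A j))))
              (trans (sum-δʳ h (A j)) (symm j h))))
          (sum-*ˡ (A h j) (λ k → A h k * A k j)))
      double : ∀ t x τ → t - x - x - τ ≡ (t - pos 2 * x) - τ
      double = solve-∀
      total : sumℤ (λ j → sumℤ (cell j)) ≡ sumℤ d - pos 2 * d h - triangles h
      total = trans (sum-cong row)
        (trans (sum-minus (λ j → d j - δ h j * d j - A h j) (λ j → A h j * (A ⊗ A) h j))
        (trans (cong (_- triangles h) (trans (sum-minus (λ j → d j - δ h j * d j) (A h))
          (cong (_- d h) (trans (sum-minus d (λ j → δ h j * d j)) (cong (_-_ (sumℤ d)) (sum-δ h d))))))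
          (double (sumℤ d) (d h) (triangles h))))

    -- The bound by degrees is used at every vertex but `h`. At a vertex of very large degree it is
    -- poor, since the graph has far fewer edges than that vertex has pairs of neighbours; there the
    -- edge bound takes over.
    total-triangles-bound : ∀ h → sumℤ triangles ≤ sumℤ (λ i → d i * d i) - d h * d h - d h
    total-triangles-bound h = ℤP.≤-trans (sum-mono bound) (ℤP.≤-reflexive total)
      where
      excess : ℤ
      excess = (sumℤ d - pos 2 * d h) - (d h * d h - d h)
      -- The term with `δ h i` exchanges one bound for the other at `h`, which keeps the right side
      -- summable in closed form.
      bound : ∀ i → triangles i ≤ (d i * d i - d i) + δ h i * excess
      bound i with h FinP.≟ i
      ... | yes refl = ℤP.≤-trans (triangles-edge-bound h)
          (ℤP.≤-reflexive (trans (telescope (d h * d h - d h) (sumℤ d - pos 2 * d h)) (cong (λ u → (d h * d h - d h) + u * excess) (sym (δ-≡ h)))))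
        where
        telescope : ∀ x y → y ≡ x + 1ℤ * (y - x)
        telescope = solve-∀
      ... | no h≢i = ℤP.≤-trans (triangles-bound i)
          (ℤP.≤-reflexive (trans (drop (d i * d i - d i) excess) (cong (λ u → (d i * d i - d i) + u * excess) (sym (δ-≢ h≢i)))))
        where
        drop : ∀ x e → x ≡ x + 0ℤ * e
        drop = solve-∀
      simplify : ∀ q t x → (q - t) + ((t - pos 2 * x) - (x * x - x)) ≡ q - x * x - x
      simplify = solve-∀
      total : sumℤ (λ i → (d i * d i - d i) + δ h i * excess) ≡ sumℤ (λ i → d i * d i) - d h * d h - d h
      total = trans (sum-+ (λ i → d i * d i - d i) (λ i → δ h i * excess))
        (trans (cong₂ _+_ (sum-minus (λ i → d i * d i) d) (sum-δ h (λ _ → excess)))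
          (simplify (sumℤ (λ i → d i * d i)) (sumℤ d) (d h)))

  -- σ, κ and m stand for s, q and the order minus one.  The hypotheses are what the traces of Q, Q² and Q³ give
  -- for K₁ ∨ (C_s ∪ qK₂); in the last one, 27σ + 16κ comes from the cubes of the inner degrees and 6σ + 6κ from
  -- the triangles through the cone vertex (there is one more triangle when s = 3).
  module DegreeSequence {m} {A : Matrix (suc m)} (adjA : Adjacency A) (σ κ : ℤ)
    (0≤κ : 0ℤ ≤ κ) (ν≡ : pos m ≡ σ + pos 2 * κ) (15≤ν : pos 15 ≤ pos m)
    (moment₁ : sumℤ (deg A) ≡ pos m + pos 3 * σ + pos 4 * κ)
    (moment₂ : sumℤ (λ i → deg A i * deg A i) ≡ pos m * pos m + pos 9 * σ + pos 8 * κ)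
    (moment₃ : pos m * pos m * pos m + pos 33 * σ + pos 22 * κ ≤
               sumℤ (λ i → deg A i * deg A i * deg A i) + sumℤ (AdjacencyProperties.triangles adjA))
    where
    open Adjacency adjA
    open AdjacencyProperties adjA
    open DegreeBounds adjA
    private
      ν T₁ T₂ T₃ τ : ℤ
      ν = pos m
      T₁ = sumℤ d
      T₂ = sumℤ (λ i → d i * d i)
      T₃ = sumℤ (λ i → d i * d i * d i)
      τ = sumℤ triangles

    h : Fin (suc m)
    h = proj₁ (maximum d)

    private
      j = d h

      nonneighbours : Fin (suc m) → ℤ
      nonneighbours k = (1ℤ - δ h k * 1ℤ) - A h k

      0≤nonneighbours : ∀ k → 0ℤ ≤ nonneighbours k
      0≤nonneighbours k with h FinP.≟ k
      ... | yes refl = ℤP.≤-reflexive (sym (cong₂ (λ u v → (1ℤ - u * 1ℤ) - v) (δ-≡ h) (loopless h)))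
      ... | no h≢k = subst (0ℤ ≤_) (cong (λ u → (1ℤ - u * 1ℤ) - A h k) (sym (δ-≢ h≢k))) (0≤1-A h k)

      nonneighbours-total : sumℤ nonneighbours ≡ ν - j
      nonneighbours-total = trans (sum-minus (λ k → 1ℤ - δ h k * 1ℤ) (A h))
        (cong (_- j) (trans (sum-minus (λ _ → 1ℤ) (λ k → δ h k * 1ℤ))
          (trans (cong₂ _-_ (sum-const (suc m) 1ℤ) (sum-δ h (λ _ → 1ℤ))) (pred ν))))
        where
        pred : ∀ x → (1ℤ + x) * 1ℤ - 1ℤ ≡ x
        pred = solve-∀

      cubic-inequality : 0ℤ ≤ (j + pos 5) * T₂ + (- (pos 5 * j + pos 6)) * T₁ + (1ℤ + ν) * (pos 6 * j) - T₃
      cubic-inequality = subst (0ℤ ≤_)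
        (trans (sum-cong (λ i → expand j (d i)))
          (trans (sum-cubic d (- 1ℤ) (j + pos 5) (- (pos 5 * j + pos 6)) (pos 6 * j)) (reorder T₃ _ _ _)))
        (0≤sum (λ i → 0≤-* (0≤y-x (proj₂ (maximum d) i)) (consecutive-product-nonneg (d i))))
        where
        expand : ∀ j x → (j - x) * ((x - pos 2) * (x - pos 3)) ≡
          (- 1ℤ) * (x * x * x) + (j + pos 5) * (x * x) + (- (pos 5 * j + pos 6)) * x + pos 6 * j
        expand = solve-∀
        reorder : ∀ t a b c → (- 1ℤ) * t + a + b + c ≡ a + b + c - t
        reorder = solve-∀

      0≤ν-j : 0ℤ ≤ ν - j
      0≤ν-j = subst (0ℤ ≤_) nonneighbours-total (0≤sum 0≤nonneighbours)

      -- In the sum of the cubic inequality, the triangle bound and the third moment, `T₃` and `τ`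
      -- cancel. Only the first two moments remain, and these are known exactly.
      key-inequality : 0ℤ ≤ pos 2 * σ - (ν - j) * (ν * ν - pos 6 * ν - j + pos 5)
      key-inequality = subst (0ℤ ≤_) (trans (collect j T₁ T₂ T₃ τ ν σ κ)
          (trans (cong₂ (λ t₁ t₂ → (j + pos 6) * t₂ - (pos 5 * j + pos 6) * t₁ + (1ℤ + ν) * (pos 6 * j) - j * j - j - (ν * ν * ν + pos 33 * σ + pos 22 * κ)) moment₁ moment₂)
            (trans (cong (λ u → (j + pos 6) * (u * u + pos 9 * σ + pos 8 * κ) - (pos 5 * j + pos 6) * (u + pos 3 * σ + pos 4 * κ) + (1ℤ + u) * (pos 6 * j) - j * j - j - (u * u * u + pos 33 * σ + pos 22 * κ)) ν≡)
              (trans (identity j σ κ) (cong (λ u → pos 2 * σ - (u - j) * (u * u - pos 6 * u - j + pos 5)) (sym ν≡))))))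
        (0≤-+ (0≤-+ cubic-inequality (0≤y-x (total-triangles-bound h))) (0≤y-x moment₃))
        where
        collect : ∀ j t₁ t₂ t₃ τ ν σ κ →
          ((j + pos 5) * t₂ + (- (pos 5 * j + pos 6)) * t₁ + (1ℤ + ν) * (pos 6 * j) - t₃) + (t₂ - j * j - j - τ)
            + (t₃ + τ - (ν * ν * ν + pos 33 * σ + pos 22 * κ))
          ≡ (j + pos 6) * t₂ - (pos 5 * j + pos 6) * t₁ + (1ℤ + ν) * (pos 6 * j) - j * j - j - (ν * ν * ν + pos 33 * σ + pos 22 * κ)
        collect = solve-∀
        identity : ∀ j σ κ → let u = σ + pos 2 * κ in
          (j + pos 6) * (u * u + pos 9 * σ + pos 8 * κ) - (pos 5 * j + pos 6) * (u + pos 3 * σ + pos 4 * κ) + (1ℤ + u) * (pos 6 * j) - j * j - j - (u * u * u + pos 33 * σ + pos 22 * κ)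
          ≡ pos 2 * σ - (u - j) * (u * u - pos 6 * u - j + pos 5)
        identity = solve-∀

      -- Otherwise `j` is at most `ν - 1`. In terms of `k = ν - 1 - j`, `μ = ν - 15` and `κ`, all
      -- nonnegative, the number `- 1 - E` is a polynomial with nonnegative coefficients, while the
      -- key inequality says that `E` is nonnegative.
      j≡ν : j ≡ ν
      j≡ν with j ℤP.≟ ν
      ... | yes e = e
      ... | no j≢ν = ⊥-elim (absurd (subst (0ℤ ≤_) rewritten key-inequality) negative)
        where
        k μ : ℤ
        k = ν - (1ℤ + j)
        μ = ν - pos 15
        0≤k : 0ℤ ≤ k
        0≤k = 0≤y-x (ℤP.i<j⇒suc[i]≤j (ℤP.≤∧≢⇒< (ℤP.0≤i-j⇒j≤i 0≤ν-j) j≢ν))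
        0≤μ : 0ℤ ≤ μ
        0≤μ = 0≤y-x 15≤ν
        E : ℤ
        E = pos 2 * (ν - pos 2 * κ) - (ν - j) * (ν * ν - pos 6 * ν - j + pos 5)
        rewritten : pos 2 * σ - (ν - j) * (ν * ν - pos 6 * ν - j + pos 5) ≡ E
        rewritten = cong (λ u → pos 2 * u - (ν - j) * (ν * ν - pos 6 * ν - j + pos 5))
          (trans (solve-σ σ κ) (cong (_- pos 2 * κ) (sym ν≡)))
          where
          solve-σ : ∀ σ κ → σ ≡ (σ + pos 2 * κ) - pos 2 * κ
          solve-σ = solve-∀
        Y : ℤ
        Y = pos 126 + pos 23 * μ + μ * μ + k
        negative : 0ℤ ≤ - 1ℤ - E
        negative = subst (0ℤ ≤_) (sym (identity ν j κ))
          (0≤-+ (0≤-+ (0≤-+ (0≤-* 0≤k (0≤-+ (0≤-+ (0≤-+ (0≤pos 126) (0≤-* (0≤pos 23) 0≤μ)) (0≤-* 0≤μ 0≤μ)) 0≤k))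
            (0≤-+ (0≤-+ (0≤pos 95) (0≤-* (0≤pos 21) 0≤μ)) (0≤-* 0≤μ 0≤μ))) 0≤k) (0≤-* (0≤pos 4) 0≤κ))
          where
          identity : ∀ ν j κ → - 1ℤ - (pos 2 * (ν - pos 2 * κ) - (ν - j) * (ν * ν - pos 6 * ν - j + pos 5)) ≡
            (ν - (1ℤ + j)) * (pos 126 + pos 23 * (ν - pos 15) + (ν - pos 15) * (ν - pos 15) + (ν - (1ℤ + j)))
              + (pos 95 + pos 21 * (ν - pos 15) + (ν - pos 15) * (ν - pos 15)) + (ν - (1ℤ + j)) + pos 4 * κ
          identity = solve-∀
        absurd : 0ℤ ≤ E → 0ℤ ≤ - 1ℤ - E → ⊥
        absurd p q with subst (0ℤ ≤_) (cancel E) (0≤-+ p q)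
          where
          cancel : ∀ e → e + (- 1ℤ - e) ≡ - 1ℤ
          cancel = solve-∀
        ... | ()

    hub-adjacent : ∀ k → k ≢ h → A h k ≡ 1ℤ
    hub-adjacent k k≢h = sym (ℤP.i-j≡0⇒i≡j 1ℤ (A h k)
      (trans (cong (λ u → (1ℤ - u * 1ℤ) - A h k) (sym (δ-≢ {i = h} {k} (k≢h ∘ sym))))
        (sum-nonneg≡0 0≤nonneighbours (trans nonneighbours-total (ℤP.i≡j⇒i-j≡0 (sym j≡ν))) k)))

    -- Once `j` is `ν`, the first two moments make the sum of `(d - 2)(d - 3)` over the vertices
    -- other than `h` equal to 0, and each of its terms is nonnegative.
    other-degrees : ∀ i → i ≢ h → d i ≡ pos 2 ⊎ d i ≡ pos 3
    other-degrees i i≢h = consecutive-product≡0 (d i)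
      (trans (sym (trans (cong (λ u → g (d i) - u * g j) (δ-≢ {i = h} {i} (i≢h ∘ sym))) (drop (g (d i)) (g j))))
        (sum-nonneg≡0 0≤term total i))
      where
      g : ℤ → ℤ
      g x = (x - pos 2) * (x - pos 3)
      drop : ∀ x y → x - 0ℤ * y ≡ x
      drop = solve-∀
      term : Fin (suc m) → ℤ
      -- The contribution of the hub is subtracted, so that the sum can still run over all vertices.
      term i = g (d i) - δ h i * g j
      0≤term : ∀ i → 0ℤ ≤ term i
      0≤term i with h FinP.≟ i
      ... | yes refl = ℤP.≤-reflexive (sym (trans (cong (λ u → g j - u * g j) (δ-≡ h)) (cancel (g j))))
        where
        cancel : ∀ x → x - 1ℤ * x ≡ 0ℤ
        cancel = solve-∀
      ... | no h≢i = subst (0ℤ ≤_) (sym (trans (cong (λ u → g (d i) - u * g j) (δ-≢ h≢i)) (drop (g (d i)) (g j)))) (consecutive-product-nonneg (d i))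
      total : sumℤ term ≡ 0ℤ
      total = trans (sum-minus (λ i → g (d i)) (λ i → δ h i * g j))
        (trans (cong₂ _-_
          (trans (sum-cong (λ i → expand (d i))) (trans (sum-cubic d 0ℤ 1ℤ (- pos 5) (pos 6))
            (cong₂ (λ t₁ t₂ → 0ℤ * T₃ + 1ℤ * t₂ + (- pos 5) * t₁ + (1ℤ + ν) * pos 6) moment₁ moment₂)))
          (trans (sum-δ h (λ _ → g j)) (cong g j≡ν)))
        (trans (cong (λ u → 0ℤ * T₃ + 1ℤ * (u * u + pos 9 * σ + pos 8 * κ) + (- pos 5) * (u + pos 3 * σ + pos 4 * κ) + (1ℤ + u) * pos 6 - (u - pos 2) * (u - pos 3)) ν≡)
          (identity T₃ σ κ)))
        where
        expand : ∀ x → (x - pos 2) * (x - pos 3) ≡ 0ℤ * (x * x * x) + 1ℤ * (x * x) + (- pos 5) * x + pos 6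
        expand = solve-∀
        identity : ∀ t σ κ → let u = σ + pos 2 * κ in
          0ℤ * t + 1ℤ * (u * u + pos 9 * σ + pos 8 * κ) + (- pos 5) * (u + pos 3 * σ + pos 4 * κ) + (1ℤ + u) * pos 6 - (u - pos 2) * (u - pos 3) ≡ 0ℤ
        identity = solve-∀

open DegreeSequences

-- Cospectral graphs, relabelling, and cones over graphs of small degree

module Cones where
  open import Data.Integer using (_≤_; -_; _-_; _+_; _*_) renaming (+_ to pos)

  +-cancelʳ : ∀ x y z → x + z ≡ y + z → x ≡ y
  +-cancelʳ x y z e = trans (expose x z) (trans (cong (_- z) e) (sym (expose y z)))
    where
    expose : ∀ x z → x ≡ (x + z) - z
    expose = solve-∀

  adjMatrix : ∀ {n} → SimpleGraph n → Matrix n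
  adjMatrix G i j = b2z (adj G i j)

  adjMatrix-adjacency : ∀ {n} (G : SimpleGraph n) → Adjacency (adjMatrix G)
  adjMatrix-adjacency G = record
    { symm = λ i j → cong b2z (adj-sym G i j)
    ; loopless = λ i → cong b2z (adj-irrefl G i)
    ; binary = λ i j → b2z-binary (adj G i j)
    }
    where
    b2z-binary : ∀ b → b2z b ≡ 0ℤ ⊎ b2z b ≡ 1ℤ
    b2z-binary true = inj₂ refl
    b2z-binary false = inj₁ refl

  signless : ∀ {n} → SimpleGraph n → Matrix n
  signless G = loops (deg (adjMatrix G)) (adjMatrix G)

  Qmat≈signless : ∀ {n} (G : SimpleGraph n) → Qmat G ≈ signless G
  Qmat≈signless G i j with i FinP.≟ j
  ... | yes refl = trans (if-≡ i (degree G i) (adjMatrix G i i))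
      (sym (trans (cong₂ (λ u v → u * degree G i + v) (δ-≡ i) (cong b2z (adj-irrefl G i))) (unit (degree G i))))
    where
    unit : ∀ x → 1ℤ * x + 0ℤ ≡ x
    unit = solve-∀
  ... | no i≢j = trans (if-≢ (degree G i) (adjMatrix G i j) i≢j)
      (sym (trans (cong (λ u → u * degree G i + adjMatrix G i j) (δ-≢ i≢j)) (drop (degree G i) (adjMatrix G i j))))
    where
    drop : ∀ x y → 0ℤ * x + y ≡ y
    drop = solve-∀

  charQ≡det : ∀ {n} (G : SimpleGraph n) x → charQ G x ≡ det (charMatrix (signless G) x)
  charQ≡det G x = det-cong (λ i j → cong₂ _-_ (scale (toℕ i ℕ.≡ᵇ toℕ j)) (Qmat≈signless G i j))
    where
    scale : ∀ b → (if b then x else pos 0) ≡ x * (if b then 1ℤ else 0ℤ)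
    scale true = sym (ℤP.*-identityʳ x)
    scale false = sym (ℤP.*-zeroʳ x)

  module _ {n} (G : SimpleGraph n) where
    degrees : Fin n → ℤ
    degrees = deg (adjMatrix G)

    triangleCounts : Fin n → ℤ
    triangleCounts = AdjacencyProperties.triangles (adjMatrix-adjacency G)

  module _ {n} {H G : SimpleGraph n} (cospectral : QCospectral H G) where
    cospectral-traces : ∀ k → trace (power (signless H) k) ≡ trace (power (signless G) k)
    cospectral-traces = trace-powers (signless H) (signless G)
      (λ x → trans (sym (charQ≡det H x)) (trans (cospectral x) (charQ≡det G x)))

    private
      dH = degrees H
      dG = degrees G
      module PH = AdjacencyProperties (adjMatrix-adjacency H)
      module PG = AdjacencyProperties (adjMatrix-adjacency G)

    same-moment₁ : sumℤ dH ≡ sumℤ dG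
    same-moment₁ = trans (sym (PH.trace-loops¹ dH)) (trans (cospectral-traces 1) (PG.trace-loops¹ dG))

    same-moment₂ : sumℤ (λ i → dH i * dH i) ≡ sumℤ (λ i → dG i * dG i)
    same-moment₂ = +-cancelʳ (sumℤ (λ i → dH i * dH i)) (sumℤ (λ i → dG i * dG i)) (sumℤ dG) (trans (cong (sumℤ (λ i → dH i * dH i) +_) (sym same-moment₁))
      (trans (sym (PH.trace-loops² dH)) (trans (cospectral-traces 2) (PG.trace-loops² dG))))

    -- The third trace ties the cubes of the degrees to the triangles without separating them. This
    -- is why the degree argument has to bound triangles.
    same-moment₃ : sumℤ (λ i → dH i * dH i * dH i) + sumℤ (triangleCounts H) ≡
                   sumℤ (λ i → dG i * dG i * dG i) + sumℤ (triangleCounts G)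
    same-moment₃ = trans (expose (sumℤ (λ i → dH i * dH i * dH i)) (sumℤ (λ i → dH i * dH i)) (sumℤ (triangleCounts H)))
      (trans (cong₂ _-_ (trans (sym (PH.trace-loops³ dH)) (trans (cospectral-traces 3) (PG.trace-loops³ dG))) (cong (pos 3 *_) same-moment₂))
        (sym (expose (sumℤ (λ i → dG i * dG i * dG i)) (sumℤ (λ i → dG i * dG i)) (sumℤ (triangleCounts G)))))
      where
      expose : ∀ x y z → x + z ≡ (x + pos 3 * y + z) - pos 3 * y
      expose = solve-∀

  sum-permute : ∀ {n} (f : Fin n → ℤ) (ρ : Permutation n n) → sumℤ (λ i → f (ρ ⟨$⟩ʳ i)) ≡ sumℤ f
  sum-permute f ρ = trans (sumℤ≡sum (λ i → f (ρ ⟨$⟩ʳ i))) (trans (sym (∑.sum-permute f ρ)) (sym (sumℤ≡sum f)))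

  module _ {n} (ρ : Permutation n n) where
    private
      to-from : ∀ {i k} → k ≢ ρ ⟨$⟩ˡ i → ρ ⟨$⟩ʳ k ≢ i
      to-from {i} k≢ e = k≢ (trans (sym (inverseˡ ρ)) (cong (ρ ⟨$⟩ˡ_) e))

    δ-permute : ∀ i j → δ (ρ ⟨$⟩ʳ i) (ρ ⟨$⟩ʳ j) ≡ δ i j
    δ-permute i j with i FinP.≟ j
    ... | yes refl = trans (δ-≡ (ρ ⟨$⟩ʳ i)) (sym (δ-≡ i))
    ... | no i≢j = trans (δ-≢ (λ e → i≢j (trans (sym (inverseˡ ρ)) (trans (cong (ρ ⟨$⟩ˡ_) e) (inverseˡ ρ))))) (sym (δ-≢ i≢j))

    -- Another case of `det-unique`: permuting rows and columns alike preserves multilinearity and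
    -- alternation, and fixes `δ`.
    det-permute : ∀ (A : Matrix n) → det (λ i j → A (ρ ⟨$⟩ʳ i) (ρ ⟨$⟩ʳ j)) ≡ det A
    det-permute A = trans (det-unique {F = λ A → det (λ i j → A (ρ ⟨$⟩ʳ i) (ρ ⟨$⟩ʳ j))}
      (record
        { resp = λ e → det-cong (λ i j → e (ρ ⟨$⟩ʳ i) (ρ ⟨$⟩ʳ j))
        ; linear = λ {A} {X} {Y} i c AX AY e → Multilinear.linear det-multilinear (ρ ⟨$⟩ˡ i) c
            (λ k k≢ j → AX (ρ ⟨$⟩ʳ k) (to-from k≢) (ρ ⟨$⟩ʳ j))
            (λ k k≢ j → AY (ρ ⟨$⟩ʳ k) (to-from k≢) (ρ ⟨$⟩ʳ j))
            (λ j → subst (λ l → A l (ρ ⟨$⟩ʳ j) ≡ c * X l (ρ ⟨$⟩ʳ j) + Y l (ρ ⟨$⟩ʳ j)) (sym (inverseʳ ρ)) (e (ρ ⟨$⟩ʳ j)))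
        })
      (λ A i j i≢j e → det-alternating (λ i j → A (ρ ⟨$⟩ʳ i) (ρ ⟨$⟩ʳ j)) (ρ ⟨$⟩ˡ i) (ρ ⟨$⟩ˡ j)
        (λ p → i≢j (trans (sym (inverseʳ ρ)) (trans (cong (ρ ⟨$⟩ʳ_) p) (inverseʳ ρ))))
        (λ k → trans (cong (λ l → A l (ρ ⟨$⟩ʳ k)) (inverseʳ ρ)) (trans (e (ρ ⟨$⟩ʳ k)) (cong (λ l → A l (ρ ⟨$⟩ʳ k)) (sym (inverseʳ ρ)))))) A)
      (trans (cong (det A *_) (trans (det-cong δ-permute) (det-δ n))) (ℤP.*-identityʳ (det A)))

    relabel : SimpleGraph n → SimpleGraph n
    relabel H = record
      { adj = λ i j → adj H (ρ ⟨$⟩ʳ i) (ρ ⟨$⟩ʳ j)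
      ; sym = λ i j → adj-sym H (ρ ⟨$⟩ʳ i) (ρ ⟨$⟩ʳ j)
      ; irrefl = λ i → adj-irrefl H (ρ ⟨$⟩ʳ i)
      }

    degrees-relabel : ∀ H i → degrees (relabel H) i ≡ degrees H (ρ ⟨$⟩ʳ i)
    degrees-relabel H i = sum-permute (λ j → adjMatrix H (ρ ⟨$⟩ʳ i) j) ρ

    charQ-relabel : ∀ H x → charQ (relabel H) x ≡ charQ H x
    charQ-relabel H x = trans (charQ≡det (relabel H) x)
      (trans (det-cong (λ i j → cong₂ _-_ (cong (x *_) (sym (δ-permute i j)))
          (cong (_+ adjMatrix (relabel H) i j) (cong₂ _*_ (sym (δ-permute i j)) (degrees-relabel H i)))))
      (trans (det-permute (charMatrix (signless H) x)) (sym (charQ≡det H x))))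

    isomorphic-relabel : ∀ {H G} → Isomorphic (relabel H) G → Isomorphic H G
    isomorphic-relabel {H} {G} (τ , e) = flip ρ ∘ₚ τ , λ i j →
      trans (cong₂ (adj H) (sym (inverseʳ ρ)) (sym (inverseʳ ρ))) (e (ρ ⟨$⟩ˡ i) (ρ ⟨$⟩ˡ j))

  inner : ∀ {n} → SimpleGraph (suc n) → Matrix n
  inner G i j = adjMatrix G (suc i) (suc j)

  inner-adjacency : ∀ {n} (G : SimpleGraph (suc n)) → Adjacency (inner G)
  inner-adjacency G = record
    { symm = λ i j → symm (suc i) (suc j)
    ; loopless = λ i → loopless (suc i)
    ; binary = λ i j → binary (suc i) (suc j)
    }
    where open Adjacency (adjMatrix-adjacency G)

  record IsCone {n} (G : SimpleGraph (suc n)) : Set where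
    field
      apex  : ∀ i → adjMatrix G zero (suc i) ≡ 1ℤ
      small : ∀ i → deg (inner G) i ≡ pos 1 ⊎ deg (inner G) i ≡ pos 2

    -- `leaf` is 1 at inner degree 1 and 0 at inner degree 2. Being idempotent, it makes every
    -- polynomial in the degrees affine in `leaf`.
    e leaf : Fin n → ℤ
    e = deg (inner G)
    leaf i = pos 2 - e i

    apex′ : ∀ i → adjMatrix G (suc i) zero ≡ 1ℤ
    apex′ i = trans (Adjacency.symm (adjMatrix-adjacency G) (suc i) zero) (apex i)

    leaf-idem : ∀ i → leaf i * leaf i ≡ leaf i
    leaf-idem i with e i | small i
    ... | _ | inj₁ refl = refl
    ... | _ | inj₂ refl = refl

    degree-apex : degrees G zero ≡ pos n
    degree-apex = trans (cong₂ _+_ (Adjacency.loopless (adjMatrix-adjacency G) zero) (trans (sum-cong apex) (sum-const n 1ℤ)))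
      (unit (pos n))
      where
      unit : ∀ x → 0ℤ + x * 1ℤ ≡ x
      unit = solve-∀

    degree-inner : ∀ i → degrees G (suc i) ≡ pos 3 - leaf i
    degree-inner i = trans (cong (_+ e i) (apex′ i)) (shift (e i))
      where
      shift : ∀ x → 1ℤ + x ≡ pos 3 - (pos 2 - x)
      shift = solve-∀

    module Moments (σ κ : ℤ) (ν≡ : pos n ≡ σ + pos 2 * κ) (leaves : sumℤ leaf ≡ pos 2 * κ) where
      private
        ν = pos n
        -- `a` is the value taken at full degree 3 and `a - b` the value at full degree 2. Hence the
        -- pairs 9, 5 for squares (9 and 4) and 27, 19 for cubes (27 and 8).
        affine : ∀ a b → sumℤ (λ i → a - b * leaf i) ≡ a * σ + pos 2 * (a - b) * κ
        affine a b = trans (sum-minus (λ _ → a) (λ i → b * leaf i))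
          (trans (cong₂ _-_ (trans (sum-const n a) (cong (_* a) ν≡)) (trans (sum-*ˡ b leaf) (cong (b *_) leaves)))
            (collect a b σ κ))
          where
          collect : ∀ a b s k → (s + pos 2 * k) * a - b * (pos 2 * k) ≡ a * s + pos 2 * (a - b) * k
          collect = solve-∀

      moment₁ : sumℤ (degrees G) ≡ ν + pos 3 * σ + pos 4 * κ
      moment₁ = trans (cong₂ _+_ degree-apex (trans (sum-cong (λ i → trans (degree-inner i) (unit (leaf i)))) (affine (pos 3) 1ℤ)))
        (sym (ℤP.+-assoc ν (pos 3 * σ) (pos 4 * κ)))
        where
        unit : ∀ x → pos 3 - x ≡ pos 3 - 1ℤ * x
        unit = solve-∀

      moment₂ : sumℤ (λ i → degrees G i * degrees G i) ≡ ν * ν + pos 9 * σ + pos 8 * κ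
      moment₂ = trans (cong₂ _+_ (cong₂ _*_ degree-apex degree-apex)
          (trans (sum-cong (λ i → trans (cong₂ _*_ (degree-inner i) (degree-inner i)) (square (leaf i) (leaf-idem i)))) (affine (pos 9) (pos 5))))
        (sym (ℤP.+-assoc (ν * ν) (pos 9 * σ) (pos 8 * κ)))
        where
        square : ∀ x → x * x ≡ x → (pos 3 - x) * (pos 3 - x) ≡ pos 9 - pos 5 * x
        square x p = trans (expand x) (trans (cong (λ u → pos 9 - pos 6 * x + u) p) (collect x))
          where
          expand : ∀ x → (pos 3 - x) * (pos 3 - x) ≡ pos 9 - pos 6 * x + x * x
          expand = solve-∀
          collect : ∀ x → pos 9 - pos 6 * x + x ≡ pos 9 - pos 5 * x
          collect = solve-∀

      cubes : sumℤ (λ i → degrees G i * degrees G i * degrees G i) ≡ ν * ν * ν + pos 27 * σ + pos 16 * κ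
      cubes = trans (cong₂ _+_ (cong (λ u → u * u * u) degree-apex)
          (trans (sum-cong (λ i → trans (cong (λ u → u * u * u) (degree-inner i)) (cube (leaf i) (leaf-idem i)))) (affine (pos 27) (pos 19))))
        (sym (ℤP.+-assoc (ν * ν * ν) (pos 27 * σ) (pos 16 * κ)))
        where
        cube : ∀ x → x * x ≡ x → (pos 3 - x) * (pos 3 - x) * (pos 3 - x) ≡ pos 27 - pos 19 * x
        cube x p = trans (expand x) (trans (cong (λ u → pos 27 - pos 27 * x + pos 9 * u - u * x) p)
            (trans (cong (λ u → pos 27 - pos 27 * x + pos 9 * x - u) p) (collect x)))
          where
          expand : ∀ x → (pos 3 - x) * (pos 3 - x) * (pos 3 - x) ≡ pos 27 - pos 27 * x + pos 9 * (x * x) - (x * x) * x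
          expand = solve-∀
          collect : ∀ x → pos 27 - pos 27 * x + pos 9 * x - x ≡ pos 27 - pos 19 * x
          collect = solve-∀

      private
        a = adjMatrix G
        module A = Adjacency (inner-adjacency G)

      sum-e : sumℤ e ≡ pos 2 * σ + pos 2 * κ
      sum-e = trans (sum-cong (λ i → flip-leaf (e i))) (trans (affine (pos 2) 1ℤ) (collect σ κ))
        where
        flip-leaf : ∀ x → x ≡ pos 2 - 1ℤ * (pos 2 - x)
        flip-leaf = solve-∀
        collect : ∀ s k → pos 2 * s + pos 2 * (pos 2 - 1ℤ) * k ≡ pos 2 * s + pos 2 * k
        collect = solve-∀

      apex-triangles : triangleCounts G zero ≡ sumℤ e
      apex-triangles = trans (cong₂ _+_ (trans (cong (_* (a ⊗ a) zero zero) (Adjacency.loopless (adjMatrix-adjacency G) zero)) (ℤP.*-zeroˡ ((a ⊗ a) zero zero)))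
          (sum-cong (λ j → trans (cong₂ _*_ (apex j) (codegree j)) (ℤP.*-identityˡ (e j)))))
        (ℤP.+-identityˡ (sumℤ e))
        where
        codegree : ∀ j → (a ⊗ a) zero (suc j) ≡ e j
        codegree j = trans (cong₂ _+_ (trans (cong (_* a zero (suc j)) (Adjacency.loopless (adjMatrix-adjacency G) zero)) (ℤP.*-zeroˡ (a zero (suc j))))
            (sum-cong (λ k → trans (cong₂ _*_ (apex k) (A.symm k j)) (ℤP.*-identityˡ (inner G j k)))))
          (ℤP.+-identityˡ (e j))

      -- Each inner edge at `i` spans a triangle with the apex, walked in two directions. Triangles
      -- inside the inner graph add to this, hence the inequality.
      inner-triangles : ∀ i → pos 2 * e i ≤ triangleCounts G (suc i)
      inner-triangles i = ℤP.≤-trans (ℤP.≤-reflexive (two (e i)))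
        (ℤP.+-mono-≤ (ℤP.≤-reflexive (sym first)) (sum-mono rest))
        where
        two : ∀ x → pos 2 * x ≡ x + x
        two = solve-∀
        first : a (suc i) zero * (a ⊗ a) (suc i) zero ≡ e i
        first = trans (cong₂ _*_ (apex′ i) (cong₂ _+_ (trans (cong (a (suc i) zero *_) (Adjacency.loopless (adjMatrix-adjacency G) zero)) (ℤP.*-zeroʳ (a (suc i) zero)))
            (sum-cong (λ k → trans (cong (a (suc i) (suc k) *_) (apex′ k)) (ℤP.*-identityʳ (a (suc i) (suc k)))))))
          (unit (e i))
          where
          unit : ∀ x → 1ℤ * (0ℤ + x) ≡ x
          unit = solve-∀
        rest : ∀ j → inner G i j ≤ inner G i j * (a ⊗ a) (suc i) (suc j)
        rest j = ≤-by (inner G i j * (inner G ⊗ inner G) i j)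
          (0≤-* (A.0≤A i j) (0≤sum (λ k → 0≤-* (A.0≤A i k) (A.0≤A k j))))
          (trans (cong (λ u → inner G i j * (u + (inner G ⊗ inner G) i j) - inner G i j) (cong₂ _*_ (apex′ i) (apex j)))
            (cancel (inner G i j) ((inner G ⊗ inner G) i j)))
          where
          cancel : ∀ x y → x * (1ℤ * 1ℤ + y) - x ≡ x * y
          cancel = solve-∀

      moment₃ : ν * ν * ν + pos 33 * σ + pos 22 * κ ≤
                sumℤ (λ i → degrees G i * degrees G i * degrees G i) + sumℤ (triangleCounts G)
      moment₃ = ℤP.≤-trans (ℤP.≤-reflexive (split (ν * ν * ν) σ κ))
        (ℤP.+-mono-≤ (ℤP.≤-reflexive (sym cubes))
          (ℤP.≤-trans (ℤP.≤-reflexive (sym (trans (cong₂ _+_ sum-e (trans (sum-*ˡ (pos 2) e) (cong (pos 2 *_) sum-e))) (total σ κ))))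
            (ℤP.+-mono-≤ (ℤP.≤-reflexive (sym apex-triangles)) (sum-mono inner-triangles))))
        where
        split : ∀ c s k → c + pos 33 * s + pos 22 * k ≡ (c + pos 27 * s + pos 16 * k) + (pos 6 * s + pos 6 * k)
        split = solve-∀
        total : ∀ s k → (pos 2 * s + pos 2 * k) + pos 2 * (pos 2 * s + pos 2 * k) ≡ pos 6 * s + pos 6 * k
        total = solve-∀

open Cones

-- Fourth and fifth traces of a bordered matrix

module BorderedMatrices where
  open import Data.Integer using (_≤_; -_; _-_; _+_; _*_) renaming (+_ to pos)

  trace-power⁴ : ∀ {n} (M : Matrix n) → trace (power M 4) ≡ trace ((M ⊗ M) ⊗ (M ⊗ M))
  trace-power⁴ M = trace-cong (λ i j → trans (⊗-assoc (power M 2) M M i j)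
    (⊗-cong {A = power M 2} {M ⊗ M} {M ⊗ M} {M ⊗ M} (⊗-cong {A = power M 1} {M} {M} {M} (⊗-identityˡ M) (λ _ _ → refl)) (λ _ _ → refl) i j))

  trace-power⁵ : ∀ {n} (M : Matrix n) → trace (power M 5) ≡ trace ((M ⊗ M) ⊗ (M ⊗ (M ⊗ M)))
  trace-power⁵ M = trace-cong (λ i j → trans (⊗-cong {B = M} (⊗-assoc (power M 2) M M) (λ _ _ → refl) i j)
    (trans (⊗-assoc (power M 2) (M ⊗ M) M i j)
    (⊗-cong {A = power M 2} {M ⊗ M} {(M ⊗ M) ⊗ M} {M ⊗ (M ⊗ M)} (⊗-cong {A = power M 1} {M} {M} {M} (⊗-identityˡ M) (λ _ _ → refl)) (⊗-assoc M M M) i j)))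

  -- The shape of Q - 3 for a cone: the border of ones comes from the apex, and `c` is its diagonal
  -- entry.
  bordered : ∀ {n} → ℤ → Matrix n → Matrix (suc n)
  bordered c X zero    zero    = c
  bordered c X zero    (suc j) = 1ℤ
  bordered c X (suc i) zero    = 1ℤ
  bordered c X (suc i) (suc j) = X i j

  module Bordered {n} (c : ℤ) (X : Matrix n) (X-sym : ∀ i j → X i j ≡ X j i) where
    X² X³ : Matrix n
    X² = X ⊗ X
    X³ = X ⊗ X²

    -- With u the all-ones vector, `x` is Xu and `y` is X²u. By symmetry `sx`, `qx` and `w` are the
    -- total sums of the entries of X, X² and X³, the form in which walks through the border index
    -- enter the traces.
    x y : Fin n → ℤ
    x i = sumℤ (X i)
    y i = sumℤ (λ k → X i k * x k)

    sx qx w t₄ t₅ ν : ℤ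
    sx = sumℤ x
    qx = sumℤ (λ i → x i * x i)
    w = sumℤ (λ i → x i * y i)
    t₄ = trace (X² ⊗ X²)
    t₅ = trace (X² ⊗ X³)
    ν = pos n

    private
      B B² B³ : Matrix (suc n)
      B = bordered c X
      B² = B ⊗ B
      B³ = B ⊗ B²

      column-sum : ∀ j → sumℤ (λ k → X k j) ≡ x j
      column-sum j = sum-cong (λ k → X-sym k j)

      X²-row : ∀ i → sumℤ (X² i) ≡ y i
      X²-row i = trans (sum-swap (λ j k → X i k * X k j)) (sum-cong (λ k → sum-*ˡ (X i k) (X k)))

      X²-sym : ∀ i j → X² i j ≡ X² j i
      X²-sym i j = sum-cong (λ k → trans (cong₂ _*_ (X-sym i k) (X-sym k j)) (ℤP.*-comm (X k i) (X j k)))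

      X²-column : ∀ j → sumℤ (λ k → X² k j) ≡ y j
      X²-column j = trans (sum-cong (λ k → X²-sym k j)) (X²-row j)

      adjoint : ∀ (f : Fin n → ℤ) → sumℤ (λ i → sumℤ (λ k → X i k * f k)) ≡ sumℤ (λ k → x k * f k)
      adjoint f = trans (sum-swap (λ i k → X i k * f k))
        (sum-cong (λ k → trans (sum-*ʳ (f k) (λ i → X i k)) (cong (_* f k) (column-sum k))))

      y-sum : sumℤ y ≡ qx
      y-sum = adjoint x

      X³-sum : sumℤ (λ i → sumℤ (λ j → X³ j i)) ≡ w
      X³-sum = trans (sum-swap (λ i j → X³ j i))
        (trans (sum-cong (λ j → trans (sum-swap (λ i k → X j k * X² k i)) (sum-cong (λ k → trans (sum-*ˡ (X j k) (X² k)) (cong (X j k *_) (X²-row k))))))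
          (adjoint y))

      B²₀₀ : B² zero zero ≡ c * c + ν
      B²₀₀ = cong (c * c +_) (trans (sum-const n (1ℤ * 1ℤ)) (ℤP.*-identityʳ ν))

      B²₀ : ∀ j → B² zero (suc j) ≡ c + x j
      B²₀ j = cong₂ _+_ (ℤP.*-identityʳ c) (trans (sum-cong (λ k → ℤP.*-identityˡ (X k j))) (column-sum j))

      B²₁ : ∀ i → B² (suc i) zero ≡ c + x i
      B²₁ i = cong₂ _+_ (ℤP.*-identityˡ c) (sum-cong (λ k → ℤP.*-identityʳ (X i k)))

      B³₀₀ : B³ zero zero ≡ c * (c * c + ν) + (ν * c + sx)
      B³₀₀ = cong₂ _+_ (cong (c *_) B²₀₀)
        (trans (sum-cong (λ k → trans (ℤP.*-identityˡ (B² (suc k) zero)) (B²₁ k))) (trans (sum-+ (λ _ → c) x) (cong (_+ sx) (sum-const n c))))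

      B³₁ : ∀ j → B³ (suc j) zero ≡ (c * c + ν) + (c * x j + y j)
      B³₁ j = cong₂ _+_ (trans (ℤP.*-identityˡ (B² zero zero)) B²₀₀)
        (trans (sum-cong (λ k → trans (cong (X j k *_) (B²₁ k)) (ℤP.*-distribˡ-+ (X j k) c (x k))))
          (trans (sum-+ (λ k → X j k * c) (λ k → X j k * x k)) (cong (_+ y j) (trans (sum-*ʳ c (X j)) (ℤP.*-comm (x j) c)))))

      B³₀ : ∀ i → B³ zero (suc i) ≡ c * (c + x i) + (ν + y i)
      B³₀ i = cong₂ _+_ (cong (c *_) (B²₀ i))
        (trans (sum-cong (λ k → ℤP.*-identityˡ (1ℤ + X² k i)))
          (trans (sum-+ (λ _ → 1ℤ) (λ k → X² k i)) (cong₂ _+_ (trans (sum-const n 1ℤ) (ℤP.*-identityʳ ν)) (X²-column i))))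

      B³ᵢⱼ : ∀ j i → B³ (suc j) (suc i) ≡ (c + x i) + (x j + X³ j i)
      B³ᵢⱼ j i = cong₂ _+_ (trans (ℤP.*-identityˡ (B² zero (suc i))) (B²₀ i))
        (trans (sum-cong (λ k → trans (ℤP.*-distribˡ-+ (X j k) 1ℤ (X² k i)) (cong (_+ X j k * X² k i) (ℤP.*-identityʳ (X j k)))))
          (sum-+ (X j) (λ k → X j k * X² k i)))

      quadratic-sum : ∀ a b e f → sumℤ (λ i → a + b * x i + e * (x i * x i) + f * y i + x i * y i) ≡
        ν * a + b * sx + e * qx + f * qx + w
      quadratic-sum a b e f =
        trans (sum-+ (λ i → a + b * x i + e * (x i * x i) + f * y i) (λ i → x i * y i)) (cong (_+ w)
        (trans (sum-+ (λ i → a + b * x i + e * (x i * x i)) (λ i → f * y i)) (cong₂ _+_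
          (trans (sum-+ (λ i → a + b * x i) (λ i → e * (x i * x i))) (cong₂ _+_
            (trans (sum-+ (λ _ → a) (λ i → b * x i)) (cong₂ _+_ (sum-const n a) (sum-*ˡ b x)))
            (sum-*ˡ e (λ i → x i * x i))))
          (trans (sum-*ˡ f y) (cong (f *_) y-sum)))))

    -- Closed 4-walks sorted by their visits to the border index: `t₄` collects those that avoid it,
    -- and `4 qx` those that meet it once, in four rotations.
    trace⁴ : trace (power B 4) ≡
      (c * c + ν) * (c * c + ν) + pos 2 * (ν * (c * c) + pos 2 * c * sx) + ν * ν + pos 4 * qx + t₄
    trace⁴ = trans (trace-power⁴ B) (trans (cong₂ _+_
        (cong₂ _+_ (cong₂ _*_ B²₀₀ B²₀₀) (trans (sum-cong (λ j → trans (cong₂ _*_ (B²₀ j) (B²₁ j)) (square c (x j)))) (squares)))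
        (trans (sum-+ (λ i → B² (suc i) zero * B² zero (suc i)) (λ i → sumℤ (λ j → (1ℤ + X² i j) * (1ℤ + X² j i))))
          (cong₂ _+_ (trans (sum-cong (λ i → trans (cong₂ _*_ (B²₁ i) (B²₀ i)) (square c (x i)))) squares)
            (trans (sum-cong row) blocks))))
      (collect (c * c + ν) ν c sx qx t₄))
      where
      square : ∀ c x → (c + x) * (c + x) ≡ c * c + (pos 2 * c) * x + x * x
      square = solve-∀
      squares : sumℤ (λ i → c * c + (pos 2 * c) * x i + x i * x i) ≡ ν * (c * c) + (pos 2 * c) * sx + qx
      squares = trans (sum-+ (λ i → c * c + (pos 2 * c) * x i) (λ i → x i * x i))
        (cong (_+ qx) (trans (sum-+ (λ _ → c * c) (λ i → (pos 2 * c) * x i)) (cong₂ _+_ (sum-const n (c * c)) (sum-*ˡ (pos 2 * c) x))))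
      row : ∀ i → sumℤ (λ j → (1ℤ + X² i j) * (1ℤ + X² j i)) ≡ ν + y i + y i + (X² ⊗ X²) i i
      row i = trans (sum-cong (λ j → expand (X² i j) (X² j i)))
        (trans (sum-+ (λ j → 1ℤ + X² i j + X² j i) (λ j → X² i j * X² j i)) (cong (_+ (X² ⊗ X²) i i)
          (trans (sum-+ (λ j → 1ℤ + X² i j) (λ j → X² j i)) (cong₂ _+_
            (trans (sum-+ (λ _ → 1ℤ) (X² i)) (cong₂ _+_ (trans (sum-const n 1ℤ) (ℤP.*-identityʳ ν)) (X²-row i)))
            (X²-column i)))))
        where
        expand : ∀ a b → (1ℤ + a) * (1ℤ + b) ≡ 1ℤ + a + b + a * b
        expand = solve-∀
      blocks : sumℤ (λ i → ν + y i + y i + (X² ⊗ X²) i i) ≡ ν * ν + qx + qx + t₄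
      blocks = trans (sum-+ (λ i → ν + y i + y i) (λ i → (X² ⊗ X²) i i)) (cong (_+ t₄)
        (trans (sum-+ (λ i → ν + y i) y) (cong₂ _+_ (trans (sum-+ (λ _ → ν) y) (cong₂ _+_ (sum-const n ν) y-sum)) y-sum)))
      collect : ∀ u ν c s q t → u * u + (ν * (c * c) + (pos 2 * c) * s + q) + ((ν * (c * c) + (pos 2 * c) * s + q) + (ν * ν + q + q + t))
        ≡ u * u + pos 2 * (ν * (c * c) + pos 2 * c * s) + ν * ν + pos 4 * q + t
      collect = solve-∀

    -- As for four steps: `t₅` avoids the border index, and `5 w` comes from the five rotations of a
    -- walk meeting it once. Everything else depends on `c`, `ν`, `sx` and `qx` only.
    trace⁵ : trace (power B 5) ≡
      (c * c + ν) * (c * (c * c + ν) + (ν * c + sx))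
      + pos 2 * (ν * (c * (c * c + ν)) + (pos 2 * (c * c) + ν) * sx + pos 2 * c * qx)
      + (ν * ν * c + pos 2 * ν * sx + c * qx) + pos 5 * w + t₅
    trace⁵ = trans (trace-power⁵ B) (trans (cong₂ _+_
        (cong₂ _+_ (cong₂ _*_ B²₀₀ B³₀₀)
          (trans (sum-cong (λ j → trans (cong₂ _*_ (B²₀ j) (B³₁ j)) (expand₁ c ν (x j) (y j)))) middle))
        (trans (sum-+ (λ i → B² (suc i) zero * B³ zero (suc i)) (λ i → sumℤ (λ j → (1ℤ + X² i j) * B³ (suc j) (suc i))))
          (cong₂ _+_ (trans (sum-cong (λ i → trans (cong₂ _*_ (B²₁ i) (B³₀ i)) (expand₂ c ν (x i) (y i)))) middle)
            (trans (sum-cong row) blocks))))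
      (collect (c * c + ν) (c * (c * c + ν) + (ν * c + sx)) ν c sx qx w t₅))
      where
      middle-term : ℤ → ℤ → ℤ
      middle-term x y = c * (c * c + ν) + (pos 2 * (c * c) + ν) * x + c * (x * x) + c * y + x * y
      expand₁ : ∀ c ν x y → (c + x) * ((c * c + ν) + (c * x + y)) ≡ c * (c * c + ν) + (pos 2 * (c * c) + ν) * x + c * (x * x) + c * y + x * y
      expand₁ = solve-∀
      expand₂ : ∀ c ν x y → (c + x) * (c * (c + x) + (ν + y)) ≡ c * (c * c + ν) + (pos 2 * (c * c) + ν) * x + c * (x * x) + c * y + x * y
      expand₂ = solve-∀
      middle : sumℤ (λ i → middle-term (x i) (y i)) ≡ ν * (c * (c * c + ν)) + (pos 2 * (c * c) + ν) * sx + c * qx + c * qx + w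
      middle = quadratic-sum (c * (c * c + ν)) (pos 2 * (c * c) + ν) c c
      row : ∀ i → sumℤ (λ j → (1ℤ + X² i j) * B³ (suc j) (suc i)) ≡
        (ν * (c + x i) + sx + sumℤ (λ j → X³ j i) + (c + x i) * y i) + (sumℤ (λ j → X² i j * x j) + (X² ⊗ X³) i i)
      row i = trans (sum-cong (λ j → trans (cong ((1ℤ + X² i j) *_) (B³ᵢⱼ j i)) (expand (X² i j) (c + x i) (x j) (X³ j i))))
        (trans (sum-+ (λ j → (c + x i) + x j + X³ j i + (c + x i) * X² i j) (λ j → X² i j * x j + X² i j * X³ j i)) (cong₂ _+_
          (trans (sum-+ (λ j → (c + x i) + x j + X³ j i) (λ j → (c + x i) * X² i j)) (cong₂ _+_
            (trans (sum-+ (λ j → (c + x i) + x j) (λ j → X³ j i)) (cong (_+ sumℤ (λ j → X³ j i))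
              (trans (sum-+ (λ _ → c + x i) x) (cong (_+ sx) (sum-const n (c + x i))))))
            (trans (sum-*ˡ (c + x i) (X² i)) (cong ((c + x i) *_) (X²-row i)))))
          (sum-+ (λ j → X² i j * x j) (λ j → X² i j * X³ j i))))
        where
        expand : ∀ a b x z → (1ℤ + a) * (b + (x + z)) ≡ (b + x + z + b * a) + (a * x + a * z)
        expand = solve-∀
      X²x : sumℤ (λ i → sumℤ (λ j → X² i j * x j)) ≡ w
      X²x = trans (sum-swap (λ i j → X² i j * x j))
        (sum-cong (λ j → trans (sum-*ʳ (x j) (λ i → X² i j)) (trans (cong (_* x j) (X²-column j)) (ℤP.*-comm (y j) (x j)))))
      diagonal : sumℤ (λ i → ν * (c + x i) + sx + sumℤ (λ j → X³ j i) + (c + x i) * y i) ≡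
        (ν * (ν * c) + ν * sx + ν * sx + w) + (c * qx + w)
      diagonal = trans (sum-+ (λ i → ν * (c + x i) + sx + sumℤ (λ j → X³ j i)) (λ i → (c + x i) * y i)) (cong₂ _+_
        (trans (sum-+ (λ i → ν * (c + x i) + sx) (λ i → sumℤ (λ j → X³ j i))) (cong₂ _+_
          (trans (sum-+ (λ i → ν * (c + x i)) (λ _ → sx)) (cong₂ _+_
            (trans (sum-*ˡ ν (λ i → c + x i)) (trans (cong (ν *_) (trans (sum-+ (λ _ → c) x) (cong (_+ sx) (sum-const n c)))) (ℤP.*-distribˡ-+ ν (ν * c) sx)))
            (sum-const n sx))) X³-sum))
        (trans (sum-cong (λ i → ℤP.*-distribʳ-+ (y i) c (x i))) (trans (sum-+ (λ i → c * y i) (λ i → x i * y i))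
          (cong (_+ w) (trans (sum-*ˡ c y) (cong (c *_) y-sum))))))
      blocks : sumℤ (λ i → (ν * (c + x i) + sx + sumℤ (λ j → X³ j i) + (c + x i) * y i) + (sumℤ (λ j → X² i j * x j) + (X² ⊗ X³) i i)) ≡
        ((ν * (ν * c) + ν * sx + ν * sx + w) + (c * qx + w)) + (w + t₅)
      blocks = trans (sum-+ (λ i → ν * (c + x i) + sx + sumℤ (λ j → X³ j i) + (c + x i) * y i) (λ i → sumℤ (λ j → X² i j * x j) + (X² ⊗ X³) i i))
        (cong₂ _+_ diagonal (trans (sum-+ (λ i → sumℤ (λ j → X² i j * x j)) (λ i → (X² ⊗ X³) i i)) (cong (_+ t₅) X²x)))
      collect : ∀ u v ν c s q w t →
        u * v + (ν * (c * u) + (pos 2 * (c * c) + ν) * s + c * q + c * q + w)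
          + ((ν * (c * u) + (pos 2 * (c * c) + ν) * s + c * q + c * q + w) + (((ν * (ν * c) + ν * s + ν * s + w) + (c * q + w)) + (w + t)))
        ≡ u * v + pos 2 * (ν * (c * u) + (pos 2 * (c * c) + ν) * s + pos 2 * c * q) + (ν * ν * c + pos 2 * ν * s + c * q) + pos 5 * w + t
      collect = solve-∀

open BorderedMatrices

-- Walk counts when all degrees are 1 or 2

module SmallDegrees where
  open import Data.Integer using (_≤_; -_; _-_; _+_; _*_) renaming (+_ to pos)

  Binary : ∀ {n} → (Fin n → ℤ) → Set
  Binary f = ∀ i → f i ≡ 0ℤ ⊎ f i ≡ 1ℤ

  one-hot : ∀ {n} (f : Fin n → ℤ) → Binary f → sumℤ f ≡ 1ℤ → ∃ λ p → ∀ k → f k ≡ δ p k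
  one-hot f binary f≡1 with FinP.any? (λ p → f p ℤP.≟ 1ℤ)
  ... | no none = ⊥-elim (0≢1 (trans (sym (sum-zero zeros)) f≡1))
    where
    0≢1 : 0ℤ ≢ 1ℤ
    0≢1 ()
    zeros : ∀ i → f i ≡ 0ℤ
    zeros i with binary i
    ... | inj₁ p = p
    ... | inj₂ p = ⊥-elim (none (i , p))
  ... | yes (p , fp≡1) = p , λ k → ℤP.i-j≡0⇒i≡j (f k) (δ p k) (sum-nonneg≡0 nonneg total k)
    where
    nonneg : ∀ k → 0ℤ ≤ f k - δ p k
    nonneg k with p FinP.≟ k
    ... | yes refl = ℤP.≤-reflexive (sym (ℤP.i≡j⇒i-j≡0 (trans fp≡1 (sym (δ-≡ p)))))
    ... | no p≢k with binary k
    ...   | inj₁ e = ℤP.≤-reflexive (sym (ℤP.i≡j⇒i-j≡0 (trans e (sym (δ-≢ p≢k)))))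
    ...   | inj₂ e = subst (0ℤ ≤_) (sym (cong₂ _-_ e (δ-≢ p≢k))) (0≤pos 1)
    sum-δ-1 : sumℤ (δ p) ≡ 1ℤ
    sum-δ-1 = trans (sum-cong (λ k → sym (ℤP.*-identityʳ (δ p k)))) (sum-δ p (λ _ → 1ℤ))
    total : sumℤ (λ k → f k - δ p k) ≡ 0ℤ
    total = trans (sum-minus f (δ p)) (ℤP.i≡j⇒i-j≡0 (trans f≡1 (sym sum-δ-1)))

  two-hot : ∀ {n} (f : Fin n → ℤ) → Binary f → sumℤ f ≡ pos 2 →
    ∃ λ p → ∃ λ q → p ≢ q × (∀ k → f k ≡ δ p k + δ q k)
  two-hot f binary f≡2 with FinP.any? (λ p → f p ℤP.≟ 1ℤ)
  ... | no none = ⊥-elim (0≢2 (trans (sym (sum-zero zeros)) f≡2))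
    where
    0≢2 : 0ℤ ≢ pos 2
    0≢2 ()
    zeros : ∀ i → f i ≡ 0ℤ
    zeros i with binary i
    ... | inj₁ p = p
    ... | inj₂ p = ⊥-elim (none (i , p))
  ... | yes (p , fp≡1) = second (one-hot g g-binary g≡1)
    where
    g : Fin _ → ℤ
    g k = f k - δ p k
    gp≡0 : g p ≡ 0ℤ
    gp≡0 = ℤP.i≡j⇒i-j≡0 (trans fp≡1 (sym (δ-≡ p)))
    g-binary : Binary g
    g-binary k with p FinP.≟ k
    ... | yes refl = inj₁ gp≡0
    ... | no p≢k with binary k
    ...   | inj₁ e = inj₁ (cong₂ _-_ e (δ-≢ p≢k))
    ...   | inj₂ e = inj₂ (cong₂ _-_ e (δ-≢ p≢k))
    g≡1 : sumℤ g ≡ 1ℤ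
    g≡1 = trans (sum-minus f (δ p)) (cong₂ _-_ f≡2 (trans (sum-cong (λ k → sym (ℤP.*-identityʳ (δ p k)))) (sum-δ p (λ _ → 1ℤ))))
    second : (∃ λ q → ∀ k → g k ≡ δ q k) → ∃ λ p → ∃ λ q → p ≢ q × (∀ k → f k ≡ δ p k + δ q k)
    second (q , e) = p , q , p≢q , λ k → trans (recover (f k) (δ p k)) (cong (_+_ (δ p k)) (e k))
      where
      recover : ∀ x y → x ≡ y + (x - y)
      recover = solve-∀
      p≢q : p ≢ q
      p≢q refl with trans (sym gp≡0) (trans (e p) (δ-≡ p))
      ... | ()

  trace-comm : ∀ {n} (A B : Matrix n) → trace (A ⊗ B) ≡ trace (B ⊗ A)
  trace-comm A B = trans (sum-swap (λ i k → A i k * B k i)) (sum-cong (λ k → sum-cong (λ i → ℤP.*-comm (A i k) (B k i))))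

  Small : ∀ {n} → Matrix n → Set
  Small A = ∀ i → deg A i ≡ pos 1 ⊎ deg A i ≡ pos 2

  module SmallDegree {n} {A : Matrix n} (adjA : Adjacency A) (small : Small A) where
    open Adjacency adjA
    open AdjacencyProperties adjA

    e π : Fin n → ℤ
    e = deg A
    π i = pos 2 - e i

    -- The neighbours are recorded as an equation for the whole row `A i`, so that sums over
    -- neighbours evaluate at once.
    data View (i : Fin n) : Set where
      leaf     : ∀ p → π i ≡ 1ℤ → e i ≡ 1ℤ → (∀ k → A i k ≡ δ p k) → View i
      interior : ∀ p q → p ≢ q → π i ≡ 0ℤ → e i ≡ pos 2 → (∀ k → A i k ≡ δ p k + δ q k) → View i

    view : ∀ i → View i
    view i with small i
    ... | inj₁ ei≡1 with one-hot (A i) (binary i) ei≡1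
    ...   | p , Ai = leaf p (cong (_-_ (pos 2)) ei≡1) ei≡1 Ai
    view i | inj₂ ei≡2 with two-hot (A i) (binary i) ei≡2
    ...   | p , q , p≢q , Ai = interior p q p≢q (cong (_-_ (pos 2)) ei≡2) ei≡2 Ai

    π-idem : ∀ i → π i * π i ≡ π i
    π-idem i with view i
    ... | leaf _ πi _ _ = trans (cong₂ _*_ πi πi) (sym πi)
    ... | interior _ _ _ πi _ _ = trans (cong₂ _*_ πi πi) (sym πi)

    0≤π : ∀ i → 0ℤ ≤ π i
    0≤π i with view i
    ... | leaf _ πi _ _ = subst (0ℤ ≤_) (sym πi) (0≤pos 1)
    ... | interior _ _ _ πi _ _ = ℤP.≤-reflexive (sym πi)

    0≤1-π : ∀ i → 0ℤ ≤ 1ℤ - π i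
    0≤1-π i with view i
    ... | leaf _ πi _ _ = ℤP.≤-reflexive (sym (cong (_-_ 1ℤ) πi))
    ... | interior _ _ _ πi _ _ = subst (0ℤ ≤_) (sym (cong (_-_ 1ℤ) πi)) (0≤pos 1)

    πe≡π : ∀ i → π i * e i ≡ π i
    πe≡π i with view i
    ... | leaf _ πi ei _ = trans (cong (π i *_) ei) (ℤP.*-identityʳ (π i))
    ... | interior _ _ _ πi _ _ = trans (cong (_* e i) πi) (trans (ℤP.*-zeroˡ (e i)) (sym πi))

    leaf-sum : ∀ {i p} → (∀ k → A i k ≡ δ p k) → ∀ (g : Fin n → ℤ) → sumℤ (λ k → A i k * g k) ≡ g p
    leaf-sum {i} {p} Ai g = trans (sum-cong (λ k → cong (_* g k) (Ai k))) (sum-δ p g)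

    private
      πΣ : ∀ i {u v} → (∀ p → (∀ k → A i k ≡ δ p k) → u ≡ v) → π i * u ≡ π i * v
      πΣ i {u} {v} f with view i
      ... | leaf p _ _ Ai = cong (π i *_) (f p Ai)
      ... | interior _ _ _ πi _ _ = trans (cong (_* u) πi) (trans (ℤP.*-zeroˡ u) (sym (trans (cong (_* v) πi) (ℤP.*-zeroˡ v))))

    -- Both triangle neighbours of a leaf would be its only neighbour, which would then carry a
    -- loop.
    leaf-in-no-triangle : ∀ i j k → π i * (A i j * A j k * A k i) ≡ 0ℤ
    leaf-in-no-triangle i j k = trans (πΣ i {v = 0ℤ} λ p Ai → trans (cong₂ (λ u v → u * A j k * v) (Ai j) (trans (symm k i) (Ai k))) (path p))
        (ℤP.*-zeroʳ (π i))
      where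
      path : ∀ p → δ p j * A j k * δ p k ≡ 0ℤ
      path p with p FinP.≟ j | p FinP.≟ k
      ... | no p≢j | _ = trans (cong (λ u → u * A j k * δ p k) (δ-≢ p≢j)) (zeros (A j k) (δ p k))
        where
        zeros : ∀ x y → 0ℤ * x * y ≡ 0ℤ
        zeros = solve-∀
      ... | yes _ | no p≢k = trans (cong (δ p j * A j k *_) (δ-≢ p≢k)) (ℤP.*-zeroʳ (δ p j * A j k))
      ... | yes refl | yes refl = trans (cong (λ u → δ p p * u * δ p p) (loopless p)) (zeros (δ p p))
        where
        zeros : ∀ x → x * 0ℤ * x ≡ 0ℤ
        zeros = solve-∀

    A² : Matrix n
    A² = A ⊗ A

    leaf-codegree : ∀ i j → π i * (A i j * A² i j) ≡ 0ℤ
    leaf-codegree i j = trans (cong (λ u → π i * (A i j * u)) (square-sym i j))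
      (trans (cong (π i *_) (sym (sum-*ˡ (A i j) (λ k → A j k * A k i))))
      (trans (sym (sum-*ˡ (π i) (λ k → A i j * (A j k * A k i))))
        (sum-zero (λ k → trans (cong (π i *_) (sym (ℤP.*-assoc (A i j) (A j k) (A k i)))) (leaf-in-no-triangle i j k)))))

    leaf-codegree′ : ∀ i j → π j * (A i j * A² i j) ≡ 0ℤ
    leaf-codegree′ i j = trans (cong (π j *_) (cong₂ _*_ (symm i j) (square-sym i j))) (leaf-codegree j i)

    -- `Π` counts the leaves and `Λ` the ordered pairs of adjacent leaves, hence twice the
    -- components K₂. `Q₄` and `Q₅` count closed walks, being the traces of A⁴ and A⁵.
    Π Λ Q₄ Q₅ : ℤ
    Π = sumℤ π
    Λ = sumℤ (λ i → sumℤ (λ j → π i * (A i j * π j)))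
    Q₄ = trace (A² ⊗ A²)
    Q₅ = trace (A² ⊗ (A ⊗ A²))

    sum-πA : sumℤ (λ i → sumℤ (λ j → π i * A i j)) ≡ Π
    sum-πA = sum-cong (λ i → trans (sum-*ˡ (π i) (A i)) (πe≡π i))

    sum-Aπ : sumℤ (λ i → sumℤ (λ j → π j * A i j)) ≡ Π
    sum-Aπ = trans (sum-swap (λ i j → π j * A i j))
      (trans (sum-cong (λ j → sum-cong (λ i → cong (π j *_) (symm i j)))) sum-πA)

    sum-e : sumℤ e ≡ pos 2 * pos n - Π
    sum-e = trans (sum-cong (λ i → complement (e i))) (trans (sum-minus (λ _ → pos 2) π)
      (cong (_- Π) (trans (sum-const n (pos 2)) (ℤP.*-comm (pos n) (pos 2)))))
      where
      complement : ∀ x → x ≡ pos 2 - (pos 2 - x)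
      complement = solve-∀

    -- A leaf with neighbour `p` starts `e p` closed 4-walks, and `e p` is `2 - π p`.
    leaf-walks⁴ : sumℤ (λ i → π i * (A² ⊗ A²) i i) ≡ pos 2 * Π - Λ
    leaf-walks⁴ = trans (sum-cong (λ i → trans (πΣ i λ p Ai → walks i p Ai) (sym (sum-*ˡ (π i) (λ k → A i k * e k)))))
      (trans (∑∑-cong (λ i k → expand (π i) (A i k) (e k)))
      (trans (∑∑-+ (λ i k → pos 2 * (π i * A i k)) (λ i k → - 1ℤ * (π i * (A i k * π k))))
      (trans (cong₂ _+_ (trans (∑∑-* (pos 2) (λ i k → π i * A i k)) (cong (pos 2 *_) sum-πA)) (∑∑-* (- 1ℤ) (λ i k → π i * (A i k * π k))))
        (collect Π Λ))))
      where
      walks : ∀ i p → (∀ k → A i k ≡ δ p k) → (A² ⊗ A²) i i ≡ sumℤ (λ k → A i k * e k)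
      walks i p Ai = trans (sum-cong (λ j → trans (cong₂ _*_ (leaf-sum Ai (λ k → A k j)) (trans (square-sym j i) (leaf-sum Ai (λ k → A k j)))) (idem p j)))
        (sym (leaf-sum Ai e))
      expand : ∀ p a x → p * (a * x) ≡ pos 2 * (p * a) + - 1ℤ * (p * (a * (pos 2 - x)))
      expand = solve-∀
      collect : ∀ x y → pos 2 * x + - 1ℤ * y ≡ pos 2 * x - y
      collect = solve-∀

    -- π is the indicator of the leaves, and X is the block of Q − 3 of K₁ ∨ A away from the cone vertex
    X : Matrix n
    X = loops (λ i → - π i) A

    X-sym : ∀ i j → X i j ≡ X j i
    X-sym i j with i FinP.≟ j
    ... | yes refl = refl
    ... | no i≢j = cong₂ _+_ (trans (cong (_* - π i) (δ-≢ i≢j)) (trans (ℤP.*-zeroˡ (- π i)) (sym (trans (cong (_* - π j) (δ-≢ (i≢j ∘ sym))) (ℤP.*-zeroˡ (- π j)))))) (symm i j)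

    -- The correction that the loops `- π` add to `A²` when `X` is squared.
    E : Matrix n
    E i j = δ i j * π i - (π i + π j) * A i j

    X²≡ : ∀ i j → (X ⊗ X) i j ≡ A² i j + E i j
    X²≡ i j = trans (loops-square (λ i → - π i) A i j)
      (trans (arrange (δ i j) (π i) (π j) (A i j) (A² i j)) (cong (λ u → A² i j + (δ i j * u - (π i + π j) * A i j)) (π-idem i)))
      where
      arrange : ∀ d p q a s → d * (- p * - p) + (- p + - q) * a + s ≡ s + (d * (p * p) - (p + q) * a)
      arrange = solve-∀

    row-sum-X : ∀ i → sumℤ (X i) ≡ pos 2 - pos 2 * π i
    row-sum-X i = trans (sum-+ (λ j → δ i j * - π i) (A i)) (trans (cong (_+ e i) (sum-δ i (λ _ → - π i))) (total (e i)))
      where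
      total : ∀ x → - (pos 2 - x) + x ≡ pos 2 - pos 2 * (pos 2 - x)
      total = solve-∀

    sx≡ : sumℤ (λ i → sumℤ (X i)) ≡ pos 2 * pos n - pos 2 * Π
    sx≡ = trans (sum-cong row-sum-X) (trans (sum-minus (λ _ → pos 2) (λ i → pos 2 * π i))
      (cong₂ _-_ (trans (sum-const n (pos 2)) (ℤP.*-comm (pos n) (pos 2))) (sum-*ˡ (pos 2) π)))

    qx≡ : sumℤ (λ i → sumℤ (X i) * sumℤ (X i)) ≡ pos 4 * pos n - pos 4 * Π
    qx≡ = trans (sum-cong (λ i → trans (cong₂ _*_ (row-sum-X i) (row-sum-X i)) (square (π i) (π-idem i))))
      (trans (sum-minus (λ _ → pos 4) (λ i → pos 4 * π i))
      (cong₂ _-_ (trans (sum-const n (pos 4)) (ℤP.*-comm (pos n) (pos 4))) (sum-*ˡ (pos 4) π)))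
      where
      expand : ∀ p → (pos 2 - pos 2 * p) * (pos 2 - pos 2 * p) ≡ pos 4 - pos 8 * p + pos 4 * (p * p)
      expand = solve-∀
      collect : ∀ p → pos 4 - pos 8 * p + pos 4 * p ≡ pos 4 - pos 4 * p
      collect = solve-∀
      square : ∀ p → p * p ≡ p → (pos 2 - pos 2 * p) * (pos 2 - pos 2 * p) ≡ pos 4 - pos 4 * p
      square p pp = trans (expand p) (trans (cong (λ u → pos 4 - pos 8 * p + pos 4 * u) pp) (collect p))

    -- The border sums `sx` and `qx` depend on `n` and `Π` only. `w` is the first to see how leaves
    -- are attached; its coefficient 4 at `Λ`, with the factor 5 in `trace⁵`, is the origin of the
    -- 20 in `same-Q₅`.
    w≡ : sumℤ (λ i → sumℤ (X i) * sumℤ (λ k → X i k * sumℤ (X k))) ≡ pos 8 * pos n - pos 12 * Π + pos 4 * Λ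
    w≡ = trans (sum-cong (λ i → trans (cong₂ _*_ (row-sum-X i) (y≡ i)) (product i)))
      (trans (sum-+ (λ i → pos 4 * e i + - pos 4 * π i) (λ i → sumℤ (λ k → - pos 4 * (π k * A i k) + pos 4 * (π i * (A i k * π k)))))
      (trans (cong₂ _+_
        (trans (sum-+ (λ i → pos 4 * e i) (λ i → - pos 4 * π i)) (cong₂ _+_ (trans (sum-*ˡ (pos 4) e) (cong (pos 4 *_) sum-e)) (sum-*ˡ (- pos 4) π)))
        (trans (∑∑-+ (λ i k → - pos 4 * (π k * A i k)) (λ i k → pos 4 * (π i * (A i k * π k))))
          (cong₂ _+_ (trans (∑∑-* (- pos 4) (λ i k → π k * A i k)) (cong (- pos 4 *_) sum-Aπ)) (∑∑-* (pos 4) (λ i k → π i * (A i k * π k))))))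
        (collect (pos n) Π Λ)))
      where
      y≡ : ∀ i → sumℤ (λ k → X i k * sumℤ (X k)) ≡ pos 2 * e i - pos 2 * sumℤ (λ k → A i k * π k)
      y≡ i = trans (sum-cong (λ k → trans (cong (X i k *_) (row-sum-X k)) (expand (δ i k) (π i) (A i k) (π k))))
        (trans (sum-+ (λ k → δ i k * (- π i * (pos 2 - pos 2 * π k))) (λ k → pos 2 * A i k - pos 2 * (A i k * π k)))
        (trans (cong₂ _+_ (trans (sum-δ i (λ k → - π i * (pos 2 - pos 2 * π k))) (vanish (π i) (π-idem i)))
          (trans (sum-minus (λ k → pos 2 * A i k) (λ k → pos 2 * (A i k * π k))) (cong₂ _-_ (sum-*ˡ (pos 2) (A i)) (sum-*ˡ (pos 2) (λ k → A i k * π k)))))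
          (ℤP.+-identityˡ (pos 2 * e i - pos 2 * sumℤ (λ k → A i k * π k)))))
        where
        expand : ∀ d p a q → (d * - p + a) * (pos 2 - pos 2 * q) ≡ d * (- p * (pos 2 - pos 2 * q)) + (pos 2 * a - pos 2 * (a * q))
        expand = solve-∀
        vanish : ∀ p → p * p ≡ p → - p * (pos 2 - pos 2 * p) ≡ 0ℤ
        vanish p pp = trans (open-up p) (trans (cong (λ u → pos 2 * u - pos 2 * p) pp) (cancel p))
          where
          open-up : ∀ p → - p * (pos 2 - pos 2 * p) ≡ pos 2 * (p * p) - pos 2 * p
          open-up = solve-∀
          cancel : ∀ p → pos 2 * p - pos 2 * p ≡ 0ℤ
          cancel = solve-∀
      product : ∀ i → (pos 2 - pos 2 * π i) * (pos 2 * e i - pos 2 * sumℤ (λ k → A i k * π k)) ≡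
        (pos 4 * e i + - pos 4 * π i) + sumℤ (λ k → - pos 4 * (π k * A i k) + pos 4 * (π i * (A i k * π k)))
      product i = trans (expand (π i) (e i) s) (trans (cong₂ (λ u v → pos 4 * e i - pos 4 * u + (- pos 4 * s + v)) (πe≡π i) refl)
        (trans (arrange (e i) (π i) (- pos 4 * s + pos 4 * (π i * s)))
          (cong (_+_ (pos 4 * e i + - pos 4 * π i)) (sym (trans (sum-+ (λ k → - pos 4 * (π k * A i k)) (λ k → pos 4 * (π i * (A i k * π k))))
            (cong₂ _+_ (trans (sum-*ˡ (- pos 4) (λ k → π k * A i k)) (cong (- pos 4 *_) (sum-cong (λ k → ℤP.*-comm (π k) (A i k)))))
              (trans (sum-*ˡ (pos 4) (λ k → π i * (A i k * π k))) (cong (pos 4 *_) (sum-*ˡ (π i) (λ k → A i k * π k))))))))))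
        where
        s = sumℤ (λ k → A i k * π k)
        expand : ∀ p x s → (pos 2 - pos 2 * p) * (pos 2 * x - pos 2 * s) ≡ pos 4 * x - pos 4 * (p * x) + (- pos 4 * s + pos 4 * (p * s))
        expand = solve-∀
        arrange : ∀ x p r → pos 4 * x - pos 4 * p + r ≡ (pos 4 * x + - pos 4 * p) + r
        arrange = solve-∀
      collect : ∀ n p l → (pos 4 * (pos 2 * n - p) + - pos 4 * p) + (- pos 4 * p + pos 4 * l) ≡ pos 8 * n - pos 12 * p + pos 4 * l
      collect = solve-∀

    -- Off the diagonal, the cross terms between `A²` and `E` carry a closed 3-walk through a leaf
    -- and vanish. On the diagonal they give `2 π i`, which together with the square of `E` makes
    -- the `3 π i`.
    X²-squared : ∀ i j → (X ⊗ X) i j * (X ⊗ X) j i ≡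
      A² i j * A² j i + δ i j * (pos 3 * π i) + (π i * A i j + π j * A i j + pos 2 * (π i * (A i j * π j)))
    X²-squared i j = trans (cong₂ _*_ (X²≡ i j) (trans (sum-cong (λ k → trans (cong₂ _*_ (X-sym j k) (X-sym k i)) (ℤP.*-comm (X k j) (X i k)))) (X²≡ i j)))
      (trans (pointwise i j) (cong (λ u → A² i j * u + δ i j * (pos 3 * π i) + (π i * A i j + π j * A i j + pos 2 * (π i * (A i j * π j)))) (square-sym i j)))
      where
      pointwise : ∀ i j → (A² i j + E i j) * (A² i j + E i j) ≡
        A² i j * A² i j + δ i j * (pos 3 * π i) + (π i * A i j + π j * A i j + pos 2 * (π i * (A i j * π j)))
      pointwise i j with i FinP.≟ j
      ... | yes refl = trans (cong₂ (λ u v → (A² i i + (u * π i - (π i + π i) * v)) * (A² i i + (u * π i - (π i + π i) * v))) (δ-≡ i) (loopless i))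
          (trans (expand (A² i i) (π i)) (trans (cong₂ (λ u v → A² i i * A² i i + pos 2 * u + v) (trans (cong (π i *_) (square-diagonal i)) (πe≡π i)) (π-idem i))
            (trans (collect (A² i i) (π i)) (cong₂ (λ u v → A² i i * A² i i + u * (pos 3 * π i) + (π i * v + π i * v + pos 2 * (π i * (v * π i)))) (sym (δ-≡ i)) (sym (loopless i))))))
        where
        expand : ∀ s p → (s + (1ℤ * p - (p + p) * 0ℤ)) * (s + (1ℤ * p - (p + p) * 0ℤ)) ≡ s * s + pos 2 * (p * s) + p * p
        expand = solve-∀
        collect : ∀ s p → s * s + pos 2 * p + p ≡ s * s + 1ℤ * (pos 3 * p) + (p * 0ℤ + p * 0ℤ + pos 2 * (p * (0ℤ * p)))
        collect = solve-∀
      ... | no i≢j = trans (cong (λ u → (A² i j + (u * π i - (π i + π j) * A i j)) * (A² i j + (u * π i - (π i + π j) * A i j))) (δ-≢ i≢j))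
          (trans (expand (A² i j) (π i) (π j) (A i j))
          (trans (cong₂ (λ u v → A² i j * A² i j - pos 2 * u - pos 2 * v + (π i * π i + π j * π j + pos 2 * (π i * π j)) * (A i j * A i j)) (leaf-codegree i j) (leaf-codegree′ i j))
          (trans (cong₂ (λ u v → A² i j * A² i j - pos 2 * 0ℤ - pos 2 * 0ℤ + (u + v + pos 2 * (π i * π j)) * (A i j * A i j)) (π-idem i) (π-idem j))
          (trans (cong (λ u → A² i j * A² i j - pos 2 * 0ℤ - pos 2 * 0ℤ + (π i + π j + pos 2 * (π i * π j)) * u) (idem i j))
          (trans (collect (A² i j) (π i) (π j) (A i j))
            (cong (λ u → A² i j * A² i j + u * (pos 3 * π i) + (π i * A i j + π j * A i j + pos 2 * (π i * (A i j * π j)))) (sym (δ-≢ i≢j))))))))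
        where
        expand : ∀ s p q a → (s + (0ℤ * p - (p + q) * a)) * (s + (0ℤ * p - (p + q) * a)) ≡
          s * s - pos 2 * (p * (a * s)) - pos 2 * (q * (a * s)) + (p * p + q * q + pos 2 * (p * q)) * (a * a)
        expand = solve-∀
        collect : ∀ s p q a → s * s - pos 2 * 0ℤ - pos 2 * 0ℤ + (p + q + pos 2 * (p * q)) * a ≡
          s * s + 0ℤ * (pos 3 * p) + (p * a + q * a + pos 2 * (p * (a * q)))
        collect = solve-∀

    t₄≡ : trace ((X ⊗ X) ⊗ (X ⊗ X)) ≡ Q₄ + pos 5 * Π + pos 2 * Λ
    t₄≡ = trans (∑∑-cong X²-squared)
      (trans (∑∑-+ (λ i j → A² i j * A² j i + δ i j * (pos 3 * π i)) (λ i j → π i * A i j + π j * A i j + pos 2 * (π i * (A i j * π j))))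
      (trans (cong₂ _+_
        (trans (∑∑-+ (λ i j → A² i j * A² j i) (λ i j → δ i j * (pos 3 * π i)))
          (cong (_+_ Q₄) (trans (sum-cong (λ i → sum-δ i (λ _ → pos 3 * π i))) (sum-*ˡ (pos 3) π))))
        (trans (∑∑-+ (λ i j → π i * A i j + π j * A i j) (λ i j → pos 2 * (π i * (A i j * π j))))
          (cong₂ _+_ (trans (∑∑-+ (λ i j → π i * A i j) (λ i j → π j * A i j)) (cong₂ _+_ sum-πA sum-Aπ)) (∑∑-* (pos 2) (λ i j → π i * (A i j * π j))))))
        (collect Q₄ Π Λ)))
      where
      collect : ∀ q p l → (q + pos 3 * p) + ((p + p) + pos 2 * l) ≡ q + pos 5 * p + pos 2 * l
      collect = solve-∀

    private
      trace-E : ∀ (Z : Matrix n) → trace (E ⊗ Z) ≡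
        sumℤ (λ i → π i * Z i i) - sumℤ (λ i → π i * (A ⊗ Z) i i) - sumℤ (λ i → π i * (Z ⊗ A) i i)
      trace-E Z = trans (∑∑-cong (λ i j → expand (δ i j) (π i) (π j) (A i j) (Z j i)))
        (trans (∑∑-+ (λ i j → δ i j * (π i * Z j i) + - 1ℤ * (π i * (A i j * Z j i))) (λ i j → - 1ℤ * (π j * (Z j i * A i j))))
        (trans (cong₂ _+_
          (trans (∑∑-+ (λ i j → δ i j * (π i * Z j i)) (λ i j → - 1ℤ * (π i * (A i j * Z j i))))
            (cong₂ _+_ (sum-cong (λ i → sum-δ i (λ j → π i * Z j i)))
              (trans (∑∑-* (- 1ℤ) (λ i j → π i * (A i j * Z j i))) (cong (- 1ℤ *_) (sum-cong (λ i → sum-*ˡ (π i) (λ j → A i j * Z j i)))))))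
          (trans (∑∑-* (- 1ℤ) (λ i j → π j * (Z j i * A i j))) (cong (- 1ℤ *_) (trans (sum-swap (λ i j → π j * (Z j i * A i j)))
            (sum-cong (λ j → sum-*ˡ (π j) (λ i → Z j i * A i j)))))))
          (collect (sumℤ (λ i → π i * Z i i)) (sumℤ (λ i → π i * (A ⊗ Z) i i)) (sumℤ (λ i → π i * (Z ⊗ A) i i)))))
        where
        expand : ∀ d p q a z → (d * p - (p + q) * a) * z ≡ (d * (p * z) + - 1ℤ * (p * (a * z))) + - 1ℤ * (q * (z * a))
        expand = solve-∀
        collect : ∀ x y z → (x + - 1ℤ * y) + - 1ℤ * z ≡ x - y - z
        collect = solve-∀

      α : ℤ
      α = sumℤ (λ i → π i * (A² ⊗ A²) i i)

      -- `Z` is A³, supplied in both bracketings because `trace-E` multiplies it by `A` on either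
      -- side. Its diagonal at leaves vanishes, as no leaf lies on a triangle.
      trace-E-A³ : ∀ (Z : Matrix n) → Z ≈ A ⊗ A² → Z ≈ A² ⊗ A → trace (E ⊗ Z) ≡ - (pos 2 * α)
      trace-E-A³ Z Z≈ Z≈′ = trans (trace-E Z) (trans (cong₂ _-_ (cong₂ _-_ closed₃ left) right) (collect α))
        where
        closed₃ : sumℤ (λ i → π i * Z i i) ≡ 0ℤ
        closed₃ = sum-zero (λ i → trans (cong (π i *_) (Z≈ i i)) (trans (sym (sum-*ˡ (π i) (λ j → A i j * A² j i)))
          (sum-zero (λ j → trans (cong (λ u → π i * (A i j * u)) (square-sym j i)) (leaf-codegree i j)))))
        left : sumℤ (λ i → π i * (A ⊗ Z) i i) ≡ α
        left = sum-cong (λ i → cong (π i *_) (trans (⊗-cong {A = A} {A} {Z} {A ⊗ A²} (λ _ _ → refl) Z≈ i i) (sym (⊗-assoc A A A² i i))))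
        right : sumℤ (λ i → π i * (Z ⊗ A) i i) ≡ α
        right = sum-cong (λ i → cong (π i *_) (trans (⊗-cong {A = Z} {A² ⊗ A} {A} {A} Z≈′ (λ _ _ → refl) i i) (⊗-assoc A² A A i i)))
        collect : ∀ x → 0ℤ - x - x ≡ - (pos 2 * x)
        collect = solve-∀

      -- every triangle term below is multiplied by the leaf indicator of one of its vertices
      trace-E-AE : trace (E ⊗ (A ⊗ E)) ≡ - (pos 2 * Π + pos 2 * Λ)
      trace-E-AE = trans (trace-E (A ⊗ E)) (trans (cong₂ _-_ (cong₂ _-_ edges left) right) (collect Π Λ))
        where
        edges : sumℤ (λ i → π i * (A ⊗ E) i i) ≡ - (Π + Λ)
        edges = trans (sum-cong (λ i → trans (sym (sum-*ˡ (π i) (λ k → A i k * E k i))) (sum-cong (λ k → term i k))))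
          (trans (∑∑-+ (λ i k → - 1ℤ * (π i * A i k)) (λ i k → - 1ℤ * (π i * (A i k * π k))))
            (trans (cong₂ _+_ (trans (∑∑-* (- 1ℤ) (λ i k → π i * A i k)) (cong (- 1ℤ *_) sum-πA)) (∑∑-* (- 1ℤ) (λ i k → π i * (A i k * π k)))) (neg Π Λ)))
          where
          term : ∀ i k → π i * (A i k * E k i) ≡ - 1ℤ * (π i * A i k) + - 1ℤ * (π i * (A i k * π k))
          term i k = trans (cong₂ (λ u v → π i * (A i k * (u * π k - (π k + π i) * v))) (δ-sym k i) (symm k i))
            (trans (expand (δ i k) (π i) (π k) (A i k))
            (trans (cong₂ (λ u v → π i * π k * u - (π i * π k + v) * (A i k * A i k)) (δA≡0 i k) (π-idem i))
            (trans (cong (λ u → π i * π k * 0ℤ - (π i * π k + π i) * u) (idem i k)) (finish (π i) (π k) (A i k)))))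
            where
            expand : ∀ d p q a → p * (a * (d * q - (q + p) * a)) ≡ p * q * (d * a) - (p * q + p * p) * (a * a)
            expand = solve-∀
            finish : ∀ p q a → p * q * 0ℤ - (p * q + p) * a ≡ - 1ℤ * (p * a) + - 1ℤ * (p * (a * q))
            finish = solve-∀
          neg : ∀ x y → - 1ℤ * x + - 1ℤ * y ≡ - (x + y)
          neg = solve-∀
        triangle-terms : ∀ i j k → π i * ((π k + π i) * (A i j * A j k * A k i)) ≡ 0ℤ
        triangle-terms i j k = trans (swap (π i) (π k + π i) (A i j * A j k * A k i)) (trans (cong ((π k + π i) *_) (leaf-in-no-triangle i j k)) (ℤP.*-zeroʳ (π k + π i)))
          where
          swap : ∀ p q t → p * (q * t) ≡ q * (p * t)
          swap = solve-∀
        left : sumℤ (λ i → π i * (A ⊗ (A ⊗ E)) i i) ≡ Π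
        left = sum-cong row
          where
          row : ∀ i → π i * (A ⊗ (A ⊗ E)) i i ≡ π i
          row i = trans (sym (sum-*ˡ (π i) (λ j → A i j * (A ⊗ E) j i)))
            (trans (sum-cong (λ j → inside j)) (trans (sum-*ˡ (π i) (A i)) (πe≡π i)))
            where
            cell : ∀ j k → π i * (A i j * (A j k * E k i)) ≡ δ i k * (π i * (A i j * A j k) * π k)
            cell j k = trans (expand (π i) (π k) (A i j) (A j k) (δ k i) (A k i)) (trans (cong (_-_ (δ k i * (π i * (A i j * A j k) * π k))) (triangle-terms i j k))
              (trans (ℤP.+-identityʳ (δ k i * (π i * (A i j * A j k) * π k))) (cong (_* (π i * (A i j * A j k) * π k)) (δ-sym k i))))
              where
              expand : ∀ p q a b d c → p * (a * (b * (d * q - (q + p) * c))) ≡ d * (p * (a * b) * q) - p * ((q + p) * (a * b * c))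
              expand = solve-∀
            inside : ∀ j → π i * (A i j * (A ⊗ E) j i) ≡ π i * A i j
            inside j = trans (cong (π i *_) (sym (sum-*ˡ (A i j) (λ k → A j k * E k i)))) (trans (sym (sum-*ˡ (π i) (λ k → A i j * (A j k * E k i))))
              (trans (sum-cong (cell j)) (trans (sum-δ i (λ k → π i * (A i j * A j k) * π k))
                (trans (cong (λ u → π i * (A i j * u) * π i) (symm j i)) (trans (arrange (π i) (A i j)) (cong₂ _*_ (π-idem i) (idem i j)))))))
              where
              arrange : ∀ p a → p * (a * a) * p ≡ (p * p) * (a * a)
              arrange = solve-∀
        right : sumℤ (λ i → π i * ((A ⊗ E) ⊗ A) i i) ≡ Λ
        right = sum-cong row
          where
          row : ∀ i → π i * ((A ⊗ E) ⊗ A) i i ≡ sumℤ (λ j → π i * (A i j * π j))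
          row i = trans (cong (π i *_) (⊗-assoc A E A i i)) (trans (sym (sum-*ˡ (π i) (λ j → A i j * (E ⊗ A) j i))) (sum-cong (λ j → inside j)))
            where
            cell : ∀ j k → π i * (A i j * (E j k * A k i)) ≡ δ j k * (π i * (A i j * A k i) * π j)
            cell j k = trans (expand (π i) (π j) (π k) (A i j) (A j k) (δ j k) (A k i))
              (trans (cong (λ u → δ j k * (π i * (A i j * A k i) * π j) - (π j + π k) * u) (leaf-in-no-triangle i j k))
                (drop (δ j k * (π i * (A i j * A k i) * π j)) (π j + π k)))
              where
              expand : ∀ p q r a b d c → p * (a * ((d * q - (q + r) * b) * c)) ≡ d * (p * (a * c) * q) - (q + r) * (p * (a * b * c))
              expand = solve-∀
              drop : ∀ x y → x - y * 0ℤ ≡ x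
              drop = solve-∀
            inside : ∀ j → π i * (A i j * (E ⊗ A) j i) ≡ π i * (A i j * π j)
            inside j = trans (cong (π i *_) (sym (sum-*ˡ (A i j) (λ k → E j k * A k i)))) (trans (sym (sum-*ˡ (π i) (λ k → A i j * (E j k * A k i))))
              (trans (sum-cong (cell j)) (trans (sum-δ j (λ k → π i * (A i j * A k i) * π j))
                (trans (cong (λ u → π i * (A i j * u) * π j) (symm j i)) (trans (cong (λ u → π i * u * π j) (idem i j)) (ℤP.*-assoc (π i) (A i j) (π j)))))))
        collect : ∀ p l → - (p + l) - p - l ≡ - (pos 2 * p + pos 2 * l)
        collect = solve-∀

    -- One factor `X` is split into `A` and its loops, and each remaining square into `A²` and `E`.
    -- The contributions to `Λ` are -2 from the loops and 4 - 2 from the walks, so that `Λ` drops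
    -- out.
    t₅≡ : trace ((X ⊗ X) ⊗ (X ⊗ (X ⊗ X))) ≡ Q₅ - pos 16 * Π
    t₅≡ = trans (∑∑-cong (λ i j → trans (cong (X² i j *_) (loops-⊗ (λ i → - π i) A X² j i)) (distrib (X² i j) (π j) (X² j i) ((A ⊗ X²) j i))))
      (trans (∑∑-+ (λ i j → - 1ℤ * (π j * (X² i j * X² j i))) (λ i j → X² i j * (A ⊗ X²) j i))
      (trans (cong₂ _+_ (trans (∑∑-* (- 1ℤ) (λ i j → π j * (X² i j * X² j i))) (cong (- 1ℤ *_) loop-part)) walk-part)
      (trans (cong (λ u → - 1ℤ * (u + pos 4 * Π + pos 3 * Λ) + (Q₅ - pos 4 * u - (pos 2 * Π + pos 2 * Λ))) leaf-walks⁴) (collect Q₅ Π Λ))))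
      where
      X² = X ⊗ X
      distrib : ∀ a p b c → a * (- p * b + c) ≡ - 1ℤ * (p * (a * b)) + a * c
      distrib = solve-∀
      collect : ∀ q p l → - 1ℤ * ((pos 2 * p - l) + pos 4 * p + pos 3 * l) + (q - pos 4 * (pos 2 * p - l) - (pos 2 * p + pos 2 * l)) ≡ q - pos 16 * p
      collect = solve-∀
      loop-part : sumℤ (λ i → sumℤ (λ j → π j * (X² i j * X² j i))) ≡ α + pos 4 * Π + pos 3 * Λ
      loop-part = trans (∑∑-cong (λ i j → trans (cong (π j *_) (X²-squared i j)) (trans (cong (λ u → π j * (A² i j * A² j i + u * (pos 3 * π i) + (π i * A i j + π j * A i j + pos 2 * (π i * (A i j * π j))))) (δ-sym i j))
          (reduce (π i) (π j) (A² i j) (A² j i) (δ j i) (A i j) (π-idem j)))))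
        (trans (sum-swap (λ i j → (π j * (A² j i * A² i j) + δ j i * (pos 3 * (π i * π j))) + (π j * A i j + pos 3 * (π i * (A i j * π j)))))
        (trans (∑∑-+ (λ j i → π j * (A² j i * A² i j) + δ j i * (pos 3 * (π i * π j))) (λ j i → π j * A i j + pos 3 * (π i * (A i j * π j))))
        (trans (cong₂ _+_
          (trans (∑∑-+ (λ j i → π j * (A² j i * A² i j)) (λ j i → δ j i * (pos 3 * (π i * π j))))
            (cong₂ _+_ (sum-cong (λ j → sum-*ˡ (π j) (λ i → A² j i * A² i j)))
              (trans (sum-cong (λ j → trans (sum-δ j (λ i → pos 3 * (π i * π j))) (cong (pos 3 *_) (π-idem j)))) (sum-*ˡ (pos 3) π))))
          (trans (∑∑-+ (λ j i → π j * A i j) (λ j i → pos 3 * (π i * (A i j * π j))))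
            (cong₂ _+_ (trans (sum-swap (λ j i → π j * A i j)) sum-Aπ)
              (trans (∑∑-* (pos 3) (λ j i → π i * (A i j * π j))) (cong (pos 3 *_) (sum-swap (λ j i → π i * (A i j * π j))))))))
          (gather α Π Λ))))
        where
        reduce : ∀ p q s t d a → q * q ≡ q → q * (s * t + d * (pos 3 * p) + (p * a + q * a + pos 2 * (p * (a * q)))) ≡
          (q * (t * s) + d * (pos 3 * (p * q))) + (q * a + pos 3 * (p * (a * q)))
        reduce p q s t d a qq = trans (expand p q s t d a) (trans (cong (λ u → (q * (t * s) + d * (pos 3 * (p * q))) + (p * (a * q) + u * a + pos 2 * (p * (a * u)))) qq) (gather′ p q s t d a))
          where
          expand : ∀ p q s t d a → q * (s * t + d * (pos 3 * p) + (p * a + q * a + pos 2 * (p * (a * q)))) ≡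
            (q * (t * s) + d * (pos 3 * (p * q))) + (p * (a * q) + (q * q) * a + pos 2 * (p * (a * (q * q))))
          expand = solve-∀
          gather′ : ∀ p q s t d a → (q * (t * s) + d * (pos 3 * (p * q))) + (p * (a * q) + q * a + pos 2 * (p * (a * q))) ≡
            (q * (t * s) + d * (pos 3 * (p * q))) + (q * a + pos 3 * (p * (a * q)))
          gather′ = solve-∀
        gather : ∀ x p l → (x + pos 3 * p) + (p + pos 3 * l) ≡ x + pos 4 * p + pos 3 * l
        gather = solve-∀
      walk-part : trace (X² ⊗ (A ⊗ X²)) ≡ Q₅ - pos 4 * α - (pos 2 * Π + pos 2 * Λ)
      walk-part = trans (∑∑-cong (λ i j → trans (cong₂ _*_ (X²≡ i j) (AX² j i)) (expand (A² i j) (E i j) ((A ⊗ A²) j i) ((A ⊗ E) j i))))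
        (trans (∑∑-+ (λ i j → A² i j * (A ⊗ A²) j i + A² i j * (A ⊗ E) j i) (λ i j → E i j * (A ⊗ A²) j i + E i j * (A ⊗ E) j i))
        (trans (cong₂ _+_
          (trans (∑∑-+ (λ i j → A² i j * (A ⊗ A²) j i) (λ i j → A² i j * (A ⊗ E) j i)) (cong (_+_ Q₅) A²AE))
          (trans (∑∑-+ (λ i j → E i j * (A ⊗ A²) j i) (λ i j → E i j * (A ⊗ E) j i))
            (cong₂ _+_ (trace-E-A³ (A ⊗ A²) (λ _ _ → refl) (λ i j → sym (⊗-assoc A A A i j))) trace-E-AE)))
          (gather Q₅ α (pos 2 * Π + pos 2 * Λ))))
        where
        AX² : ∀ i j → (A ⊗ X²) i j ≡ (A ⊗ A²) i j + (A ⊗ E) i j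
        AX² i j = trans (sum-cong (λ k → trans (cong (A i k *_) (X²≡ k j)) (ℤP.*-distribˡ-+ (A i k) (A² k j) (E k j)))) (sum-+ (λ k → A i k * A² k j) (λ k → A i k * E k j))
        A²AE : trace (A² ⊗ (A ⊗ E)) ≡ - (pos 2 * α)
        A²AE = trans (sym (trace-cong (⊗-assoc A² A E))) (trans (trace-comm (A² ⊗ A) E) (trace-E-A³ (A² ⊗ A) (⊗-assoc A A A) (λ _ _ → refl)))
        expand : ∀ s x u v → (s + x) * (u + v) ≡ (s * u + s * v) + (x * u + x * v)
        expand = solve-∀
        gather : ∀ q a c → (q + - (pos 2 * a)) + (- (pos 2 * a) + - c) ≡ q - pos 4 * a - c
        gather = solve-∀

open SmallDegrees

-- The eigenvalue 5 and the spectral invariants of a cone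

module HubMatrices where
  open import Data.Integer using (_≤_; -_; _-_; _+_; _*_) renaming (+_ to pos)

  i*j≡0⇒ : ∀ x {y} → x ≢ 0ℤ → x * y ≡ 0ℤ → y ≡ 0ℤ
  i*j≡0⇒ x x≢0 e with ℤP.i*j≡0⇒i≡0∨j≡0 x e
  ... | inj₁ p = ⊥-elim (x≢0 p)
  ... | inj₂ p = p

  square≡0 : ∀ x → x * x ≡ 0ℤ → x ≡ 0ℤ
  square≡0 x e with ℤP.i*j≡0⇒i≡0∨j≡0 x e
  ... | inj₁ p = p
  ... | inj₂ p = p

  0≤square : ∀ x → 0ℤ ≤ x * x
  0≤square (pos m) = subst (0ℤ ≤_) (ℤP.pos-* m m) (0≤pos (m ℕ.* m))
  0≤square (ℤ.negsuc m) = 0≤pos (suc m ℕ.* suc m)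

  module HubMatrix {n} {A : Matrix n} (adjA : Adjacency A) (small : Small A) where
    open Adjacency adjA
    open SmallDegree adjA small

    c : ℤ
    c = pos n - pos 3

    -- B₀ is Q − 3, so that charMatrix B₀ (pos 2) is 5 − Q
    B₀ : Matrix (suc n)
    B₀ = bordered c X

    -- Constancy along edges, hence on components, in a form that can be substituted into sums
    -- without deciding adjacency.
    AdjacencyConstant : (Fin n → ℤ) → Set
    AdjacencyConstant v = ∀ i j → A i j * (v i - v j) ≡ 0ℤ

    private
      X-apply : ∀ (v : Fin n → ℤ) i → sumℤ (λ j → (pos 2 * δ i j - X i j) * v j) ≡
        pos 2 * v i + π i * v i - sumℤ (λ j → A i j * v j)
      X-apply v i = trans (sum-cong (λ j → expand (δ i j) (π i) (A i j) (v j)))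
        (trans (sum-minus (λ j → δ i j * (pos 2 * v j + π i * v j)) (λ j → A i j * v j))
          (cong (_- sumℤ (λ j → A i j * v j)) (sum-δ i (λ j → pos 2 * v j + π i * v j))))
        where
        expand : ∀ d p a v → (pos 2 * d - (d * - p + a)) * v ≡ d * (pos 2 * v + p * v) - a * v
        expand = solve-∀

    -- `f` is extended by 0 at the apex, whose row of 5 - Q then reads off minus the total of `f`.
    -- At an interior vertex Q multiplies by 3 from the degree plus 2 from the neighbours; the
    -- leaves carry 0, and so do their neighbours by constancy.
    constant-kernel : det (charMatrix B₀ (pos 2)) ≢ 0ℤ → ∀ f → sumℤ f ≡ 0ℤ → AdjacencyConstant f →
      (∀ i → π i * f i ≡ 0ℤ) → ∀ j → f j ≡ 0ℤ
    constant-kernel det≢0 f Σf≡0 const leaf≡0 j with f j ℤP.≟ 0ℤ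
    ... | yes p = p
    ... | no fj≢0 = ⊥-elim (det≢0 (kernel⇒det≡0 (charMatrix B₀ (pos 2)) v kernel (suc j) fj≢0))
      where
      v : Fin (suc n) → ℤ
      v = 0ℤ ∷ f
      kernel : ∀ i → sumℤ (λ j → charMatrix B₀ (pos 2) i j * v j) ≡ 0ℤ
      kernel zero = trans (cong₂ _+_ (ℤP.*-zeroʳ (pos 2 * 1ℤ - c)) (trans (sum-*ˡ (- 1ℤ) f) (cong (- 1ℤ *_) Σf≡0))) refl
      kernel (suc i) = trans (ℤP.+-identityˡ _) (trans (X-apply f i)
        (trans (cong₂ (λ u s → pos 2 * f i + u - s) (leaf≡0 i)
            (trans (sum-cong (λ k → trans (swap (A i k) (f i) (f k)) (trans (cong (λ u → A i k * f i - u) (const i k)) (ℤP.+-identityʳ (A i k * f i))))) (sum-*ʳ (f i) (A i))))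
          (trans (finish (e i) (f i)) (leaf≡0 i))))
        where
        swap : ∀ a x y → a * y ≡ a * x - a * (x - y)
        swap = solve-∀
        finish : ∀ e x → pos 2 * x + 0ℤ - e * x ≡ (pos 2 - e) * x
        finish = solve-∀

    interior-exists : pos n - Π ≢ 0ℤ → ∃ λ i → π i ≡ 0ℤ
    interior-exists interior≢0 with all-zero? (λ i → 1ℤ - π i)
    ... | inj₁ all-leaves = ⊥-elim (interior≢0 (trans (sym (cong (_- Π) (trans (sum-const n 1ℤ) (ℤP.*-identityʳ (pos n)))))
            (trans (sym (sum-minus (λ _ → 1ℤ) π)) (sum-zero all-leaves))))
    ... | inj₂ (i , 1-πi≢0) with view i
    ...   | leaf _ πi _ _ = ⊥-elim (1-πi≢0 (cong (_-_ 1ℤ) πi))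
    ...   | interior _ _ _ πi _ _ = i , πi

    -- The hypotheses hold in the canonical graph. The apex entry of a kernel vector of 5 - Q
    -- vanishes by pairing with the indicator of the interior. The rest has zero energy, so it is
    -- constant on components and 0 at the leaves, hence a multiple of that indicator, and the row
    -- of the apex makes the multiple 0.
    module Nonsingular
      (unmixed : AdjacencyConstant π)
      (connected : ∀ v → AdjacencyConstant v → ∀ i j → π i ≡ 0ℤ → π j ≡ 0ℤ → v i ≡ v j)
      (interior≢0 : pos n - Π ≢ 0ℤ) where

      private
        interior-sum : sumℤ (λ i → 1ℤ - π i) ≡ pos n - Π
        interior-sum = trans (sum-minus (λ _ → 1ℤ) π) (cong (_- Π) (trans (sum-const n 1ℤ) (ℤP.*-identityʳ (pos n))))

      module _ (v : Fin (suc n) → ℤ) (kernel : ∀ i → sumℤ (λ j → charMatrix B₀ (pos 2) i j * v j) ≡ 0ℤ) where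
        private
          v₀ : ℤ
          v₀ = v zero
          u r : Fin n → ℤ
          u i = v (suc i)
          r i = pos 2 * u i + π i * u i - sumℤ (λ j → A i j * u j)

          r≡v₀ : ∀ i → r i ≡ v₀
          r≡v₀ i = trans (sym (X-apply u i)) (trans (isolate v₀ _) (trans (cong (_+ v₀) (kernel (suc i))) (ℤP.+-identityˡ v₀)))
            where
            isolate : ∀ x s → s ≡ ((pos 2 * 0ℤ - 1ℤ) * x + s) + x
            isolate = solve-∀

          -- pairing the kernel equation with the indicator of the interior, which is an eigenvector
          interior-pairing : sumℤ (λ i → (1ℤ - π i) * r i) ≡ 0ℤ
          interior-pairing = trans (sum-cong (λ i → trans (expand (π i) (u i) (sumℤ (λ j → A i j * u j)))
              (cong₂ (λ s t → (pos 2 - pos 1 * π i - s) * u i - t) (π-idem i) (sym (sum-*ˡ (1ℤ - π i) (λ j → A i j * u j))))))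
            (trans (sum-minus (λ i → (pos 2 - pos 1 * π i - π i) * u i) (λ i → sumℤ (λ j → (1ℤ - π i) * (A i j * u j))))
            (ℤP.i≡j⇒i-j≡0 (sym (trans (∑∑-cong (λ i j → mixed i j)) (trans (sum-swap (λ i j → A i j * ((1ℤ - π j) * u j)))
              (sum-cong (λ j → trans (sum-*ʳ ((1ℤ - π j) * u j) (λ i → A i j)) (column j))))))))
            where
            expand : ∀ p x s → (1ℤ - p) * (pos 2 * x + p * x - s) ≡ (pos 2 - pos 1 * p - p * p) * x - (1ℤ - p) * s
            expand = solve-∀
            mixed : ∀ i j → (1ℤ - π i) * (A i j * u j) ≡ A i j * ((1ℤ - π j) * u j)
            mixed i j = trans (split (A i j) (π i) (π j) (u j)) (trans (cong (λ s → A i j * ((1ℤ - π j) * u j) - s * u j) (unmixed i j)) (drop (A i j * ((1ℤ - π j) * u j)) (u j)))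
              where
              split : ∀ a p q x → (1ℤ - p) * (a * x) ≡ a * ((1ℤ - q) * x) - (a * (p - q)) * x
              split = solve-∀
              drop : ∀ x y → x - 0ℤ * y ≡ x
              drop = solve-∀
            column : ∀ j → sumℤ (λ i → A i j) * ((1ℤ - π j) * u j) ≡ (pos 2 - pos 1 * π j - π j) * u j
            column j = trans (cong (_* ((1ℤ - π j) * u j)) (sum-cong (λ i → symm i j)))
              (trans (product (e j) (u j)) (trans (cong (λ s → (e j - s) * u j) (πe≡π j)) (finish (e j) (u j))))
              where
              product : ∀ e x → e * ((1ℤ - (pos 2 - e)) * x) ≡ (e - (pos 2 - e) * e) * x
              product = solve-∀
              finish : ∀ e x → (e - (pos 2 - e)) * x ≡ (pos 2 - pos 1 * (pos 2 - e) - (pos 2 - e)) * x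
              finish = solve-∀

          v₀≡0 : v₀ ≡ 0ℤ
          v₀≡0 = i*j≡0⇒ (pos n - Π) interior≢0 (trans (cong (_* v₀) (sym interior-sum))
            (trans (sym (sum-*ʳ v₀ (λ i → 1ℤ - π i))) (trans (sum-cong (λ i → cong ((1ℤ - π i) *_) (sym (r≡v₀ i)))) interior-pairing)))

          Σu≡0 : sumℤ u ≡ 0ℤ
          Σu≡0 = trans (solve-u v₀ (sumℤ u)) (trans (cong₂ (λ s t → (pos 2 - c) * s - t) v₀≡0 row₀) (zero-out (pos 2 - c)))
            where
            row₀ : (pos 2 * 1ℤ - c) * v₀ + - 1ℤ * sumℤ u ≡ 0ℤ
            row₀ = trans (cong ((pos 2 * 1ℤ - c) * v₀ +_) (sym (sum-*ˡ (- 1ℤ) u))) (kernel zero)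
            solve-u : ∀ x s → s ≡ (pos 2 - c) * x - ((pos 2 * 1ℤ - c) * x + - 1ℤ * s)
            solve-u x s = general c x s
              where
              general : ∀ c x s → s ≡ (pos 2 - c) * x - ((pos 2 * 1ℤ - c) * x + - 1ℤ * s)
              general = solve-∀
            zero-out : ∀ x → x * 0ℤ - 0ℤ ≡ 0ℤ
            zero-out = solve-∀

          -- As `e` is `2 - π`, the inner block of 5 - Q is the Laplacian of `A` plus `2 π`. This is
          -- twice its quadratic form at `u`, which vanishes because `r` does.
          energy : sumℤ (λ i → sumℤ (λ j → A i j * ((u i - u j) * (u i - u j)))) + sumℤ (λ i → pos 4 * (π i * (u i * u i))) ≡ 0ℤ
          energy = trans (cong (_+ sumℤ (λ i → pos 4 * (π i * (u i * u i)))) (trans (∑∑-cong (λ i j → expand (A i j) (u i) (u j)))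
              (trans (∑∑-+ (λ i j → A i j * (u i * u i) + A i j * (u j * u j)) (λ i j → - pos 2 * (u i * (A i j * u j))))
                (cong₂ _+_ (trans (∑∑-+ (λ i j → A i j * (u i * u i)) (λ i j → A i j * (u j * u j))) (cong₂ _+_ rows columns))
                  (trans (∑∑-* (- pos 2) (λ i j → u i * (A i j * u j))) (cong (- pos 2 *_) (sum-cong (λ i → sum-*ˡ (u i) (λ j → A i j * u j)))))))))
            (trans (collect W (sumℤ (λ i → u i * sumℤ (λ j → A i j * u j))) (sumℤ (λ i → pos 4 * (π i * (u i * u i)))))
            (trans (cong (λ s → pos 2 * W + s - pos 2 * U) (sum-*ˡ (pos 4) (λ i → π i * (u i * u i))))
            (trans (factor W (sumℤ (λ i → π i * (u i * u i))) U) (trans (cong (pos 2 *_) pairing) refl))))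
            where
            W U : ℤ
            W = sumℤ (λ i → e i * (u i * u i))
            U = sumℤ (λ i → u i * sumℤ (λ j → A i j * u j))
            expand : ∀ a x y → a * ((x - y) * (x - y)) ≡ (a * (x * x) + a * (y * y)) + - pos 2 * (x * (a * y))
            expand = solve-∀
            rows : sumℤ (λ i → sumℤ (λ j → A i j * (u i * u i))) ≡ W
            rows = sum-cong (λ i → sum-*ʳ (u i * u i) (A i))
            columns : sumℤ (λ i → sumℤ (λ j → A i j * (u j * u j))) ≡ W
            columns = trans (sum-swap (λ i j → A i j * (u j * u j))) (sum-cong (λ j → trans (sum-*ʳ (u j * u j) (λ i → A i j)) (cong (_* (u j * u j)) (sum-cong (λ i → symm i j)))))
            collect : ∀ w s t → ((w + w) + - pos 2 * s) + t ≡ pos 2 * w + t - pos 2 * s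
            collect = solve-∀
            factor : ∀ w p s → pos 2 * w + pos 4 * p - pos 2 * s ≡ pos 2 * (w + pos 2 * p - s)
            factor = solve-∀
            pairing : W + pos 2 * sumℤ (λ i → π i * (u i * u i)) - U ≡ 0ℤ
            pairing = trans (cong (λ s → W + s - U) (sym (sum-*ˡ (pos 2) (λ i → π i * (u i * u i)))))
              (trans (cong (_- U) (sym (sum-+ (λ i → e i * (u i * u i)) (λ i → pos 2 * (π i * (u i * u i))))))
              (trans (sym (sum-minus (λ i → e i * (u i * u i) + pos 2 * (π i * (u i * u i))) (λ i → u i * sumℤ (λ j → A i j * u j))))
              (trans (sum-cong (λ i → refold (e i) (u i) (sumℤ (λ j → A i j * u j))))
                (sum-zero (λ i → trans (cong (u i *_) (trans (r≡v₀ i) v₀≡0)) (ℤP.*-zeroʳ (u i)))))))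
              where
              refold : ∀ e x s → e * (x * x) + pos 2 * ((pos 2 - e) * (x * x)) - x * s ≡ x * (pos 2 * x + (pos 2 - e) * x - s)
              refold = solve-∀

          energies : sumℤ (λ i → sumℤ (λ j → A i j * ((u i - u j) * (u i - u j)))) ≡ 0ℤ × sumℤ (λ i → pos 4 * (π i * (u i * u i))) ≡ 0ℤ
          energies = 0≤x,0≤y,x+y≡0
            (0≤sum (λ i → 0≤sum (λ j → 0≤-* (0≤A i j) (0≤square (u i - u j)))))
            (0≤sum (λ i → 0≤-* (0≤pos 4) (0≤-* (0≤π i) (0≤square (u i))))) energy

          u-constant : AdjacencyConstant u
          u-constant i j with binary i j
          ... | inj₁ p = trans (cong (_* (u i - u j)) p) (ℤP.*-zeroˡ (u i - u j))
          ... | inj₂ p = trans (cong (_* (u i - u j)) p) (trans (ℤP.*-identityˡ (u i - u j)) (square≡0 (u i - u j)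
              (trans (sym (ℤP.*-identityˡ ((u i - u j) * (u i - u j)))) (trans (cong (_* ((u i - u j) * (u i - u j))) (sym p))
                (sum-nonneg≡0 (λ j → 0≤-* (0≤A i j) (0≤square (u i - u j)))
                  (sum-nonneg≡0 (λ i → 0≤sum (λ j → 0≤-* (0≤A i j) (0≤square (u i - u j)))) (proj₁ energies) i) j)))))

          u-leaf : ∀ i → π i ≡ 1ℤ → u i ≡ 0ℤ
          u-leaf i πi≡1 = square≡0 (u i) (trans (sym (ℤP.*-identityˡ (u i * u i))) (trans (cong (_* (u i * u i)) (sym πi≡1))
            (i*j≡0⇒ (pos 4) (λ ()) (sum-nonneg≡0 (λ i → 0≤-* (0≤pos 4) (0≤-* (0≤π i) (0≤square (u i)))) (proj₂ energies) i))))

          base : Fin n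
          base = proj₁ (interior-exists interior≢0)

          u≡ : ∀ i → u i ≡ (1ℤ - π i) * u base
          u≡ i with view i
          ... | leaf _ πi _ _ = trans (u-leaf i πi) (sym (trans (cong (λ p → (1ℤ - p) * u base) πi) (ℤP.*-zeroˡ (u base))))
          ... | interior _ _ _ πi _ _ = trans (connected u u-constant i base πi (proj₂ (interior-exists interior≢0)))
              (sym (trans (cong (λ p → (1ℤ - p) * u base) πi) (ℤP.*-identityˡ (u base))))

          u-base : u base ≡ 0ℤ
          u-base = i*j≡0⇒ (pos n - Π) interior≢0 (trans (cong (_* u base) (sym interior-sum))
            (trans (sym (sum-*ʳ (u base) (λ i → 1ℤ - π i))) (trans (sum-cong (λ i → sym (u≡ i))) Σu≡0)))

        kernel-trivial : ∀ j → v j ≡ 0ℤ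
        kernel-trivial zero = v₀≡0
        kernel-trivial (suc j) = trans (u≡ j) (trans (cong ((1ℤ - π j) *_) u-base) (ℤP.*-zeroʳ (1ℤ - π j)))

      nonsingular : det (charMatrix B₀ (pos 2)) ≢ 0ℤ
      nonsingular = trivial-kernel⇒det≢0 (charMatrix B₀ (pos 2)) kernel-trivial

  module _ {n} (G : SimpleGraph (suc n)) (cone : IsCone G) where
    open IsCone cone using (small; apex; apex′; degree-apex; degree-inner)
    open SmallDegree (inner-adjacency G) small
    open HubMatrix (inner-adjacency G) small

    signless-shift : ∀ x → charMatrix (signless G) (x + pos 3) ≈ charMatrix B₀ x
    signless-shift x zero zero = trans (cong₂ (λ u v → (x + pos 3) * 1ℤ - (1ℤ * u + v)) degree-apex (Adjacency.loopless (adjMatrix-adjacency G) zero)) (shift x (pos n))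
      where
      shift : ∀ x m → (x + pos 3) * 1ℤ - (1ℤ * m + 0ℤ) ≡ x * 1ℤ - (m - pos 3)
      shift = solve-∀
    signless-shift x zero (suc j) = trans (cong (λ u → (x + pos 3) * 0ℤ - (0ℤ * degrees G zero + u)) (apex j)) (shift x (degrees G zero))
      where
      shift : ∀ x m → (x + pos 3) * 0ℤ - (0ℤ * m + 1ℤ) ≡ x * 0ℤ - 1ℤ
      shift = solve-∀
    signless-shift x (suc i) zero = trans (cong (λ u → (x + pos 3) * 0ℤ - (0ℤ * degrees G (suc i) + u)) (apex′ i)) (shift x (degrees G (suc i)))
      where
      shift : ∀ x m → (x + pos 3) * 0ℤ - (0ℤ * m + 1ℤ) ≡ x * 0ℤ - 1ℤ
      shift = solve-∀
    signless-shift x (suc i) (suc j) = trans (cong (λ u → (x + pos 3) * δ i j - (δ i j * u + inner G i j)) (degree-inner i)) (shift x (δ i j) (π i) (inner G i j))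
      where
      shift : ∀ x d p a → (x + pos 3) * d - (d * (pos 3 - p) + a) ≡ x * d - (d * - p + a)
      shift = solve-∀

  module ConeInvariants {n} {H G : SimpleGraph (suc n)} (cospectral : QCospectral H G) (coneH : IsCone H) (coneG : IsCone G) where
    private
      module H = SmallDegree (inner-adjacency H) (IsCone.small coneH)
      module G = SmallDegree (inner-adjacency G) (IsCone.small coneG)
      module HH = HubMatrix (inner-adjacency H) (IsCone.small coneH)
      module GG = HubMatrix (inner-adjacency G) (IsCone.small coneG)
      module HB = Bordered HH.c H.X H.X-sym
      module GB = Bordered GG.c G.X G.X-sym

    same-det : ∀ x → det (charMatrix HH.B₀ x) ≡ det (charMatrix GG.B₀ x)
    same-det x = trans (sym (det-cong (signless-shift H coneH x)))
      (trans (sym (charQ≡det H (x + pos 3))) (trans (cospectral (x + pos 3)) (trans (charQ≡det G (x + pos 3)) (det-cong (signless-shift G coneG x)))))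

    same-traces : ∀ k → trace (power HH.B₀ k) ≡ trace (power GG.B₀ k)
    same-traces = trace-powers HH.B₀ GG.B₀ same-det

    module _ (sameΠ : H.Π ≡ G.Π) where
      private
        same-sx : HB.sx ≡ GB.sx
        same-sx = trans H.sx≡ (trans (cong (λ u → pos 2 * pos n - pos 2 * u) sameΠ) (sym G.sx≡))
        same-qx : HB.qx ≡ GB.qx
        same-qx = trans H.qx≡ (trans (cong (λ u → pos 4 * pos n - pos 4 * u) sameΠ) (sym G.qx≡))

        +-cancelˡ : ∀ x {y z} → x + y ≡ x + z → y ≡ z
        +-cancelˡ x {y} {z} e = +-cancelʳ y z x (trans (ℤP.+-comm y x) (trans e (ℤP.+-comm x z)))

      -- Since `sx` and `qx` are determined by `n` and `Π`, the fourth trace determines `t₄`.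
      same-Q₄ : H.Q₄ + pos 2 * H.Λ ≡ G.Q₄ + pos 2 * G.Λ
      same-Q₄ = +-cancelʳ (H.Q₄ + pos 2 * H.Λ) (G.Q₄ + pos 2 * G.Λ) (pos 5 * G.Π)
        (trans (swap H.Q₄ (pos 2 * H.Λ) (pos 5 * G.Π)) (trans (cong (λ u → H.Q₄ + pos 5 * u + pos 2 * H.Λ) (sym sameΠ))
          (trans (sym H.t₄≡) (trans t₄-equal (trans G.t₄≡ (sym (swap G.Q₄ (pos 2 * G.Λ) (pos 5 * G.Π))))))))
        where
        swap : ∀ x y z → x + y + z ≡ x + z + y
        swap = solve-∀
        F : ℤ → ℤ → ℤ
        F s q = (GG.c * GG.c + pos n) * (GG.c * GG.c + pos n) + pos 2 * (pos n * (GG.c * GG.c) + pos 2 * GG.c * s) + pos n * pos n + pos 4 * q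
        t₄-equal : HB.t₄ ≡ GB.t₄
        t₄-equal = +-cancelˡ (F GB.sx GB.qx) {HB.t₄} {GB.t₄} (trans (cong (_+ HB.t₄) (cong₂ F (sym same-sx) (sym same-qx)))
          (trans (sym HB.trace⁴) (trans (same-traces 4) GB.trace⁴)))

      same-Q₅ : H.Q₅ + pos 20 * H.Λ ≡ G.Q₅ + pos 20 * G.Λ
      same-Q₅ = trans (expose H.Q₅ H.Λ (pos n) H.Π) (trans (cong₂ (λ u v → u - pos 5 * (pos 8 * pos n - pos 12 * v) + pos 16 * v) w+t sameΠ)
          (sym (expose G.Q₅ G.Λ (pos n) G.Π)))
        where
        expose : ∀ q l m p → q + pos 20 * l ≡ (pos 5 * (pos 8 * m - pos 12 * p + pos 4 * l) + (q - pos 16 * p)) - pos 5 * (pos 8 * m - pos 12 * p) + pos 16 * p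
        expose = solve-∀
        F : ℤ → ℤ → ℤ
        F s q = (GG.c * GG.c + pos n) * (GG.c * (GG.c * GG.c + pos n) + (pos n * GG.c + s))
          + pos 2 * (pos n * (GG.c * (GG.c * GG.c + pos n)) + (pos 2 * (GG.c * GG.c) + pos n) * s + pos 2 * GG.c * q)
          + (pos n * pos n * GG.c + pos 2 * pos n * s + GG.c * q)
        w+t : pos 5 * (pos 8 * pos n - pos 12 * H.Π + pos 4 * H.Λ) + (H.Q₅ - pos 16 * H.Π) ≡
              pos 5 * (pos 8 * pos n - pos 12 * G.Π + pos 4 * G.Λ) + (G.Q₅ - pos 16 * G.Π)
        w+t = trans (sym (cong₂ (λ u v → pos 5 * u + v) H.w≡ H.t₅≡)) (trans (+-cancelˡ (F GB.sx GB.qx) {pos 5 * HB.w + HB.t₅} {pos 5 * GB.w + GB.t₅}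
            (trans (cong (_+ (pos 5 * HB.w + HB.t₅)) (cong₂ F (sym same-sx) (sym same-qx)))
            (trans (sym (ℤP.+-assoc (F HB.sx HB.qx) (pos 5 * HB.w) HB.t₅)) (trans (sym HB.trace⁵) (trans (same-traces 5) (trans GB.trace⁵ (ℤP.+-assoc (F GB.sx GB.qx) (pos 5 * GB.w) GB.t₅)))))))
          (cong₂ (λ u v → pos 5 * u + v) G.w≡ G.t₅≡))

open HubMatrices

-- The graph with one cycle and q copies of K₂

module CanonicalCone where
  open import Data.Integer using (_≤_; -_; _-_; _+_; _*_) renaming (+_ to pos)

  module CanonicalGraph (s q : ℕ) (3≤s : 3 ℕ.≤ s) where
    size : ℕ
    size = s ℕ.+ 2 ℕ.* q

    G : SimpleGraph (suc size)
    G = KCK s q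

    -- The numbering omits the apex: `0` to `s - 1` form the cycle and the pairs follow. As in
    -- `relKCK`, an edge is listed from its smaller end only.
    data Edge (a b : ℕ) : Set where
      step  : b ℕ.< s → b ≡ suc a → Edge a b
      close : a ≡ 0 → suc b ≡ s → Edge a b
      match : s ℕ.≤ a → (a ℕ.∸ s) ℕ.% 2 ≡ 0 → b ≡ suc a → Edge a b

    edge⇒rel : ∀ {a b} → Edge a b → relKCK s (suc a) (suc b) ≡ true
    edge⇒rel {a} {b} edge = Equivalence.to BoolP.T-≡ (Equivalence.from BoolP.T-∧ (ℕP.<⇒<ᵇ (a<b edge) , inside edge))
      where
      a<b : Edge a b → a ℕ.< b
      a<b (step _ refl) = ℕP.n<1+n a
      a<b (close refl refl) = ℕP.≤-trans (ℕ.s≤s ℕ.z≤n) (ℕP.≤-pred 3≤s)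
      a<b (match _ _ refl) = ℕP.n<1+n a
      inside : Edge a b → T ((((suc b ≤ᵇ s) ∧ ((b ≡ᵇ suc a) ∨ ((a ≡ᵇ 0) ∧ (suc b ≡ᵇ s))))) ∨ ((s <ᵇ suc a) ∧ (((a ℕ.∸ s) ℕ.% 2) ≡ᵇ 0) ∧ (b ≡ᵇ suc a)))
      inside (step b<s e) = Equivalence.from BoolP.T-∨ (inj₁ (Equivalence.from BoolP.T-∧ (ℕP.≤⇒≤ᵇ b<s , Equivalence.from BoolP.T-∨ (inj₁ (ℕP.≡⇒≡ᵇ b (suc a) e)))))
      inside (close e e′) = Equivalence.from BoolP.T-∨ (inj₁ (Equivalence.from BoolP.T-∧ (ℕP.≤⇒≤ᵇ (ℕP.≤-reflexive e′) , Equivalence.from BoolP.T-∨ (inj₂ (Equivalence.from BoolP.T-∧ (ℕP.≡⇒≡ᵇ a 0 e , ℕP.≡⇒≡ᵇ (suc b) s e′))))))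
      inside (match s≤a e e′) = Equivalence.from BoolP.T-∨ (inj₂ (Equivalence.from BoolP.T-∧ (ℕP.<⇒<ᵇ (ℕ.s≤s s≤a) , Equivalence.from BoolP.T-∧ (ℕP.≡⇒≡ᵇ ((a ℕ.∸ s) ℕ.% 2) 0 e , ℕP.≡⇒≡ᵇ b (suc a) e′))))

    rel⇒edge : ∀ {a b} → relKCK s (suc a) (suc b) ≡ true → Edge a b
    rel⇒edge {a} {b} e with Equivalence.to BoolP.T-∨ (proj₂ (Equivalence.to (BoolP.T-∧ {a <ᵇ b}) (Equivalence.from BoolP.T-≡ e)))
    ... | inj₁ p with Equivalence.to (BoolP.T-∧ {suc b ≤ᵇ s}) p
    ...   | b<s , p′ with Equivalence.to (BoolP.T-∨ {b ≡ᵇ suc a}) p′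
    ...     | inj₁ b≡ = step (ℕP.≤ᵇ⇒≤ (suc b) s b<s) (ℕP.≡ᵇ⇒≡ b (suc a) b≡)
    ...     | inj₂ p″ with Equivalence.to (BoolP.T-∧ {a ≡ᵇ 0}) p″
    ...       | a≡0 , b≡ = close (ℕP.≡ᵇ⇒≡ a 0 a≡0) (ℕP.≡ᵇ⇒≡ (suc b) s b≡)
    rel⇒edge {a} {b} e | inj₂ p with Equivalence.to (BoolP.T-∧ {s <ᵇ suc a}) p
    ...   | s≤a , p′ with Equivalence.to (BoolP.T-∧ {((a ℕ.∸ s) ℕ.% 2) ≡ᵇ 0}) p′
    ...     | even , b≡ = match (ℕP.≤-pred (ℕP.<ᵇ⇒< s (suc a) s≤a)) (ℕP.≡ᵇ⇒≡ ((a ℕ.∸ s) ℕ.% 2) 0 even) (ℕP.≡ᵇ⇒≡ b (suc a) b≡)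

    Linked : ℕ → ℕ → Set
    Linked a b = Edge a b ⊎ Edge b a

    A : Matrix size
    A = inner G

    linked⇒A : ∀ i j → Linked (toℕ i) (toℕ j) → A i j ≡ 1ℤ
    linked⇒A i j l = cong b2z (Equivalence.to BoolP.T-≡ (Equivalence.from BoolP.T-∨ (truth l)))
      where
      truth : Linked (toℕ i) (toℕ j) → T (relKCK s (suc (toℕ i)) (suc (toℕ j))) ⊎ T (relKCK s (suc (toℕ j)) (suc (toℕ i)))
      truth (inj₁ x) = inj₁ (Equivalence.from BoolP.T-≡ (edge⇒rel x))
      truth (inj₂ x) = inj₂ (Equivalence.from BoolP.T-≡ (edge⇒rel x))

    A⇒linked : ∀ i j → A i j ≡ 1ℤ → Linked (toℕ i) (toℕ j)
    A⇒linked i j e with Equivalence.to (BoolP.T-∨ {relKCK s (suc (toℕ i)) (suc (toℕ j))}) (Equivalence.from BoolP.T-≡ (b2z-injective (adj G (suc i) (suc j)) e))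
      where
      b2z-injective : ∀ b → b2z b ≡ 1ℤ → b ≡ true
      b2z-injective true _ = refl
    ... | inj₁ x = inj₁ (rel⇒edge (Equivalence.to BoolP.T-≡ x))
    ... | inj₂ x = inj₂ (rel⇒edge (Equivalence.to BoolP.T-≡ x))

    A-adj : Adjacency A
    A-adj = inner-adjacency G

    open Adjacency A-adj

    unlinked : ∀ i j → ¬ Linked (toℕ i) (toℕ j) → A i j ≡ 0ℤ
    unlinked i j ¬l with binary i j
    ... | inj₁ p = p
    ... | inj₂ p = ⊥-elim (¬l (A⇒linked i j p))

    δ-sum : ∀ {n} (p : Fin n) → sumℤ (δ p) ≡ 1ℤ
    δ-sum p = trans (sum-cong (λ k → sym (ℤP.*-identityʳ (δ p k)))) (sum-δ p (λ _ → 1ℤ))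

    deg-one : ∀ i {a} → a ℕ.< size → Linked (toℕ i) a → (∀ {b} → Linked (toℕ i) b → b ≡ a) → deg A i ≡ 1ℤ
    deg-one i {a} a< l only = trans (sum-cong row) (δ-sum p)
      where
      p = Fin.fromℕ< a<
      p≡ : toℕ p ≡ a
      p≡ = FinP.toℕ-fromℕ< a<
      row : ∀ j → A i j ≡ δ p j
      row j with p FinP.≟ j
      ... | yes refl = trans (linked⇒A i p (subst (Linked (toℕ i)) (sym p≡) l)) (sym (δ-≡ p))
      ... | no p≢j = trans (unlinked i j (λ l′ → p≢j (FinP.toℕ-injective (trans p≡ (sym (only l′)))))) (sym (δ-≢ p≢j))

    deg-two : ∀ i {a b} → a ℕ.< size → b ℕ.< size → a ≢ b → Linked (toℕ i) a → Linked (toℕ i) b →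
      (∀ {c} → Linked (toℕ i) c → c ≡ a ⊎ c ≡ b) → deg A i ≡ pos 2
    deg-two i {a} {b} a< b< a≢b la lb only = trans (sum-cong row) (trans (sum-+ (δ p) (δ r)) (cong₂ _+_ (δ-sum p) (δ-sum r)))
      where
      p = Fin.fromℕ< a<
      r = Fin.fromℕ< b<
      p≡ : toℕ p ≡ a
      p≡ = FinP.toℕ-fromℕ< a<
      r≡ : toℕ r ≡ b
      r≡ = FinP.toℕ-fromℕ< b<
      p≢r : p ≢ r
      p≢r e = a≢b (trans (sym p≡) (trans (cong toℕ e) r≡))
      row : ∀ j → A i j ≡ δ p j + δ r j
      row j with p FinP.≟ j | r FinP.≟ j
      ... | yes refl | _ = trans (linked⇒A i p (subst (Linked (toℕ i)) (sym p≡) la)) (sym (cong₂ _+_ (δ-≡ p) (δ-≢ (p≢r ∘ sym))))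
      ... | no _ | yes refl = trans (linked⇒A i r (subst (Linked (toℕ i)) (sym r≡) lb)) (sym (cong₂ _+_ (δ-≢ p≢r) (δ-≡ r)))
      ... | no p≢j | no r≢j = trans (unlinked i j (λ l′ → excluded (only l′))) (sym (cong₂ _+_ (δ-≢ p≢j) (δ-≢ r≢j)))
        where
        excluded : toℕ j ≡ a ⊎ toℕ j ≡ b → ⊥
        excluded (inj₁ e) = p≢j (FinP.toℕ-injective (trans p≡ (sym e)))
        excluded (inj₂ e) = r≢j (FinP.toℕ-injective (trans r≡ (sym e)))

    parity : ∀ m → (m ℕ.% 2 ≡ 0 × suc m ℕ.% 2 ≡ 1) ⊎ (m ℕ.% 2 ≡ 1 × suc m ℕ.% 2 ≡ 0)
    parity zero = inj₁ (refl , refl)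
    parity (suc zero) = inj₂ (refl , refl)
    parity (suc (suc m)) = parity m

    s≤size : s ℕ.≤ size
    s≤size = ℕP.m≤m+n s (2 ℕ.* q)

    link-side : ∀ {a b} → Linked a b → a ℕ.< s → b ℕ.< s
    link-side (inj₁ (step b<s _)) _ = b<s
    link-side (inj₁ (close _ e)) _ = ℕP.≤-reflexive e
    link-side (inj₁ (match s≤a _ _)) a<s = ⊥-elim (ℕP.<⇒≱ a<s s≤a)
    link-side (inj₂ (step a<s refl)) _ = ℕP.<-trans (ℕP.n<1+n _) a<s
    link-side (inj₂ (close refl e)) _ = ℕP.≤-trans (ℕ.s≤s ℕ.z≤n) 3≤s
    link-side (inj₂ (match s≤b _ refl)) a<s = ⊥-elim (ℕP.<⇒≱ a<s (ℕP.m≤n⇒m≤1+n s≤b))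

    interior-deg : ∀ i → toℕ i ℕ.< s → deg A i ≡ pos 2
    interior-deg i i<s = by-position (toℕ i) refl i<s (suc (toℕ i) ℕP.≟ s)
      where
      by-position : ∀ k → toℕ i ≡ k → k ℕ.< s → Dec (suc k ≡ s) → deg A i ≡ pos 2
      by-position zero i≡ i<s _ = deg-two i (bound 1 (ℕP.≤-trans (ℕ.s≤s (ℕ.s≤s ℕ.z≤n)) 3≤s)) (bound s-1 s-1<s) 1≢ (subst (λ k → Linked k 1) (sym i≡) (inj₁ (step (ℕP.≤-trans (ℕ.s≤s (ℕ.s≤s ℕ.z≤n)) 3≤s) refl)))
          (subst (λ k → Linked k s-1) (sym i≡) (inj₁ (close refl suc-s-1))) (λ {c} l → only (subst (λ k → Linked k c) i≡ l))
        where
        bound : ∀ k → k ℕ.< s → k ℕ.< size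
        bound k k<s = ℕP.<-≤-trans k<s s≤size
        s-1 = ℕ.pred s
        suc-s-1 : suc s-1 ≡ s
        suc-s-1 = ℕP.suc-pred s {{ℕ.>-nonZero (ℕP.≤-trans (ℕ.s≤s ℕ.z≤n) 3≤s)}}
        s-1<s : s-1 ℕ.< s
        s-1<s = ℕP.≤-reflexive suc-s-1
        -- Here `3 ≤ s` enters: the two neighbours of vertex `0` are distinct.
        1≢ : 1 ≢ s-1
        1≢ e = ℕP.<⇒≢ 3≤s (trans (cong suc e) suc-s-1)
        only : ∀ {c} → Linked 0 c → c ≡ 1 ⊎ c ≡ s-1
        only (inj₁ (step _ e)) = inj₁ e
        only (inj₁ (close _ e)) = inj₂ (ℕP.suc-injective (trans e (sym suc-s-1)))
        only (inj₁ (match s≤0 _ _)) = ⊥-elim (ℕP.<⇒≱ (ℕP.≤-trans (ℕ.s≤s ℕ.z≤n) 3≤s) s≤0)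
        only (inj₂ (close _ 1≡s)) = ⊥-elim (ℕP.<⇒≢ (ℕP.≤-trans (ℕ.s≤s (ℕ.s≤s ℕ.z≤n)) 3≤s) 1≡s)
      by-position (suc a) i≡ i<s (yes e′) = deg-two i (bound a (ℕP.<-trans (ℕP.n<1+n a) i<s)) (bound 0 (ℕP.≤-trans (ℕ.s≤s ℕ.z≤n) 3≤s)) a≢0
          (subst (λ k → Linked k a) (sym i≡) (inj₂ (step i<s refl))) (subst (λ k → Linked k 0) (sym i≡) (inj₂ (close refl e′))) (λ {c} l → only (subst (λ k → Linked k c) i≡ l))
        where
        bound : ∀ k → k ℕ.< s → k ℕ.< size
        bound k k<s = ℕP.<-≤-trans k<s s≤size
        a≢0 : a ≢ 0
        a≢0 refl = ℕP.<⇒≢ 3≤s e′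
        only : ∀ {c} → Linked (suc a) c → c ≡ a ⊎ c ≡ 0
        only (inj₁ (step c<s refl)) = ⊥-elim (ℕP.<⇒≢ c<s e′)
        only (inj₁ (match s≤ _ _)) = ⊥-elim (ℕP.<⇒≱ i<s s≤)
        only (inj₂ (step _ e)) = inj₁ (sym (ℕP.suc-injective e))
        only (inj₂ (close e _)) = inj₂ e
        only (inj₂ (match s≤c _ refl)) = ⊥-elim (ℕP.<⇒≱ i<s (ℕP.m≤n⇒m≤1+n s≤c))
      by-position (suc a) i≡ i<s (no 2+a≢s) = deg-two i (bound a (ℕP.<-trans (ℕP.n<1+n a) i<s)) (bound (suc (suc a)) 2+a<s) (λ e → ℕP.<⇒≢ (ℕP.<-trans (ℕP.n<1+n a) (ℕP.n<1+n (suc a))) e)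
          (subst (λ k → Linked k a) (sym i≡) (inj₂ (step i<s refl))) (subst (λ k → Linked k (suc (suc a))) (sym i≡) (inj₁ (step 2+a<s refl))) (λ {c} l → only (subst (λ k → Linked k c) i≡ l))
        where
        bound : ∀ k → k ℕ.< s → k ℕ.< size
        bound k k<s = ℕP.<-≤-trans k<s s≤size
        2+a<s : suc (suc a) ℕ.< s
        2+a<s = ℕP.≤∧≢⇒< i<s 2+a≢s
        only : ∀ {c} → Linked (suc a) c → c ≡ a ⊎ c ≡ suc (suc a)
        only (inj₁ (step _ e)) = inj₂ e
        only (inj₁ (match s≤ _ _)) = ⊥-elim (ℕP.<⇒≱ i<s s≤)
        only (inj₂ (step _ e)) = inj₁ (sym (ℕP.suc-injective e))
        only (inj₂ (close _ e)) = ⊥-elim (2+a≢s e)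
        only (inj₂ (match s≤c _ refl)) = ⊥-elim (ℕP.<⇒≱ i<s (ℕP.m≤n⇒m≤1+n s≤c))

    leaf-deg : ∀ i → s ℕ.≤ toℕ i → deg A i ≡ 1ℤ
    leaf-deg i s≤i with parity (toℕ i ℕ.∸ s)
    ... | inj₁ (even , odd′) = deg-one i (ℕP.≤∧≢⇒< (FinP.toℕ<n i) i+1≢) (inj₁ (match s≤i even refl)) only
      where
      -- The first member of a pair is not the last vertex, because `2 q` vertices follow the cycle,
      -- an even number.
      i+1≢ : suc (toℕ i) ≢ size
      i+1≢ e with trans (sym odd′) (trans (cong (ℕ._% 2) (trans (sym (ℕP.+-∸-assoc 1 s≤i)) (trans (cong (ℕ._∸ s) e) (ℕP.m+n∸m≡n s (2 ℕ.* q))))) (trans (cong (ℕ._% 2) (ℕP.*-comm 2 q)) (DivMod.m*n%n≡0 q 2)))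
      ... | ()
      only : ∀ {b} → Linked (toℕ i) b → b ≡ suc (toℕ i)
      only (inj₁ (step b<s refl)) = ⊥-elim (ℕP.<⇒≱ b<s (ℕP.m≤n⇒m≤1+n s≤i))
      only (inj₁ (close e _)) = ⊥-elim (ℕP.<⇒≱ (ℕP.≤-trans (ℕ.s≤s ℕ.z≤n) 3≤s) (subst (s ℕ.≤_) e s≤i))
      only (inj₁ (match _ _ e)) = e
      only (inj₂ (step i<s _)) = ⊥-elim (ℕP.<⇒≱ i<s s≤i)
      only (inj₂ (close _ e)) = ⊥-elim (ℕP.<⇒≱ (ℕP.≤-reflexive e) s≤i)
      only {b} (inj₂ (match s≤b even′ e)) with trans (sym odd) even
        where
        odd : (toℕ i ℕ.∸ s) ℕ.% 2 ≡ 1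
        odd with parity (b ℕ.∸ s)
        ... | inj₁ (_ , o) = trans (cong (ℕ._% 2) (trans (cong (ℕ._∸ s) e) (ℕP.+-∸-assoc 1 s≤b))) o
        ... | inj₂ (o , _) with trans (sym o) even′
        ...   | ()
      ... | ()
    ... | inj₂ (odd , _) = deg-one i (ℕP.<-trans (ℕP.≤-reflexive (sym i≡)) (FinP.toℕ<n i)) (inj₂ (match s≤a even i≡)) only
      where
      s≢i : s ≢ toℕ i
      s≢i e with trans (sym odd) (trans (cong (λ u → (u ℕ.∸ s) ℕ.% 2) (sym e)) (cong (ℕ._% 2) (ℕP.n∸n≡0 s)))
      ... | ()
      s<i : s ℕ.< toℕ i
      s<i = ℕP.≤∧≢⇒< s≤i s≢i
      a = ℕ.pred (toℕ i)
      i≡ : toℕ i ≡ suc a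
      i≡ = sym (ℕP.suc-pred (toℕ i) {{ℕ.>-nonZero (ℕP.≤-trans (ℕ.s≤s ℕ.z≤n) s<i)}})
      s≤a : s ℕ.≤ a
      s≤a = ℕP.≤-pred (ℕP.≤-trans s<i (ℕP.≤-reflexive i≡))
      even : (a ℕ.∸ s) ℕ.% 2 ≡ 0
      even with parity (a ℕ.∸ s)
      ... | inj₁ (e , _) = e
      ... | inj₂ (_ , e) with trans (sym odd) (trans (cong (ℕ._% 2) (trans (cong (ℕ._∸ s) i≡) (ℕP.+-∸-assoc 1 s≤a))) e)
      ...   | ()
      only : ∀ {b} → Linked (toℕ i) b → b ≡ a
      only (inj₁ (step b<s refl)) = ⊥-elim (ℕP.<⇒≱ b<s (ℕP.m≤n⇒m≤1+n s≤i))
      only (inj₁ (close e _)) = ⊥-elim (ℕP.<⇒≱ (ℕP.≤-trans (ℕ.s≤s ℕ.z≤n) 3≤s) (subst (s ℕ.≤_) e s≤i))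
      only (inj₁ (match _ even′ _)) with trans (sym odd) even′
      ... | ()
      only (inj₂ (step i<s _)) = ⊥-elim (ℕP.<⇒≱ i<s s≤i)
      only (inj₂ (close _ e)) = ⊥-elim (ℕP.<⇒≱ (ℕP.≤-reflexive e) s≤i)
      only (inj₂ (match _ _ e)) = ℕP.suc-injective (trans (sym e) i≡)

    side : ∀ i → (toℕ i ℕ.< s × deg A i ≡ pos 2) ⊎ (s ℕ.≤ toℕ i × deg A i ≡ 1ℤ)
    side i with toℕ i ℕP.<? s
    ... | yes i<s = inj₁ (i<s , interior-deg i i<s)
    ... | no i≮s = inj₂ (ℕP.≮⇒≥ i≮s , leaf-deg i (ℕP.≮⇒≥ i≮s))

    small : Small A
    small i with side i
    ... | inj₁ (_ , e) = inj₂ e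
    ... | inj₂ (_ , e) = inj₁ e

    cone : IsCone G
    cone = record { apex = λ i → refl ; small = small }

    open SmallDegree A-adj small
    open HubMatrix A-adj small using (AdjacencyConstant)

    π-interior : ∀ i → toℕ i ℕ.< s → π i ≡ 0ℤ
    π-interior i i<s = cong (_-_ (pos 2)) (interior-deg i i<s)

    π-leaf : ∀ i → s ℕ.≤ toℕ i → π i ≡ 1ℤ
    π-leaf i s≤i = cong (_-_ (pos 2)) (leaf-deg i s≤i)

    interior-position : ∀ i → π i ≡ 0ℤ → toℕ i ℕ.< s
    interior-position i πi with toℕ i ℕP.<? s
    ... | yes i<s = i<s
    ... | no i≮s with trans (sym πi) (π-leaf i (ℕP.≮⇒≥ i≮s))
    ...   | ()

    unmixed : AdjacencyConstant π
    unmixed i j with binary i j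
    ... | inj₁ p = trans (cong (_* (π i - π j)) p) (ℤP.*-zeroˡ (π i - π j))
    ... | inj₂ p = trans (cong (A i j *_) (ℤP.i≡j⇒i-j≡0 same)) (ℤP.*-zeroʳ (A i j))
      where
      l = A⇒linked i j p
      flip-link : Linked (toℕ i) (toℕ j) → Linked (toℕ j) (toℕ i)
      flip-link (inj₁ x) = inj₂ x
      flip-link (inj₂ x) = inj₁ x
      same : π i ≡ π j
      same with toℕ i ℕP.<? s | toℕ j ℕP.<? s
      ... | yes i<s | _ = trans (π-interior i i<s) (sym (π-interior j (link-side l i<s)))
      ... | no i≮s | yes j<s = ⊥-elim (i≮s (link-side (flip-link l) j<s))
      ... | no i≮s | no j≮s = trans (π-leaf i (ℕP.≮⇒≥ i≮s)) (sym (π-leaf j (ℕP.≮⇒≥ j≮s)))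

    connected : ∀ v → AdjacencyConstant v → ∀ i j → π i ≡ 0ℤ → π j ≡ 0ℤ → v i ≡ v j
    connected v const i j πi πj = trans (to-first (toℕ i) i refl (interior-position i πi)) (sym (to-first (toℕ j) j refl (interior-position j πj)))
      where
      0<size : 0 ℕ.< size
      0<size = ℕP.<-≤-trans (ℕP.≤-trans (ℕ.s≤s ℕ.z≤n) 3≤s) s≤size
      first = Fin.fromℕ< 0<size
      to-first : ∀ k i → toℕ i ≡ k → toℕ i ℕ.< s → v i ≡ v first
      to-first zero i e _ = cong v (FinP.toℕ-injective (trans e (sym (FinP.toℕ-fromℕ< 0<size))))
      to-first (suc k) i e i<s = trans (sym (ℤP.i-j≡0⇒i≡j (v i′) (v i) (trans (sym (ℤP.*-identityˡ (v i′ - v i)))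
          (trans (cong (_* (v i′ - v i)) (sym (linked⇒A i′ i (inj₁ (step i<s (trans e (cong suc (sym i′≡)))))))) (const i′ i)))))
        (to-first k i′ i′≡ (ℕP.<-trans (ℕP.≤-reflexive (trans (cong suc i′≡) (sym e))) i<s))
        where
        k<size : k ℕ.< size
        k<size = ℕP.<-trans (ℕP.≤-reflexive (sym e)) (FinP.toℕ<n i)
        i′ = Fin.fromℕ< k<size
        i′≡ : toℕ i′ ≡ k
        i′≡ = FinP.toℕ-fromℕ< k<size

    leaf-count : Π ≡ pos 2 * pos q
    leaf-count = trans (count s (2 ℕ.* q) π π-interior π-leaf) (ℤP.pos-* 2 q)
      where
      count : ∀ a b (f : Fin (a ℕ.+ b) → ℤ) → (∀ i → toℕ i ℕ.< a → f i ≡ 0ℤ) → (∀ i → a ℕ.≤ toℕ i → f i ≡ 1ℤ) → sumℤ f ≡ pos b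
      count zero b f _ ones = trans (sum-cong (λ i → ones i ℕ.z≤n)) (trans (sum-const b 1ℤ) (ℤP.*-identityʳ (pos b)))
      count (suc a) b f zeros ones = trans (cong₂ _+_ (zeros zero (ℕ.s≤s ℕ.z≤n))
        (count a b (f ∘ suc) (λ i i<a → zeros (suc i) (ℕ.s≤s i<a)) (λ i a≤i → ones (suc i) (ℕ.s≤s a≤i)))) (ℤP.+-identityˡ (pos b))

    size≡ : pos size ≡ pos s + pos 2 * pos q
    size≡ = cong (_+_ (pos s)) (ℤP.pos-* 2 q)

open CanonicalCone

-- Cycle components, 4-cycles and closed 5-walks

module CycleComponents where
  open import Data.Integer using (_≤_; -_; _-_; _+_; _*_) renaming (+_ to pos)

  sum≢0 : ∀ {n} (f : Fin n → ℤ) → sumℤ f ≢ 0ℤ → ∃ λ i → f i ≢ 0ℤ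
  sum≢0 f Σf≢0 with all-zero? f
  ... | inj₁ zeros = ⊥-elim (Σf≢0 (sum-zero zeros))
  ... | inj₂ nonzero = nonzero

  -- Turns walk counts into walks: a nonzero entry of a product of matrices yields a middle vertex.
  ⊗≢0 : ∀ {n} (M N : Matrix n) i j → (M ⊗ N) i j ≢ 0ℤ → ∃ λ k → M i k ≢ 0ℤ × N k j ≢ 0ℤ
  ⊗≢0 M N i j ≢0 with sum≢0 (λ k → M i k * N k j) ≢0
  ... | k , p = k , (λ e → p (trans (cong (_* N k j) e) (ℤP.*-zeroˡ (N k j)))) , (λ e → p (trans (cong (M i k *_) e) (ℤP.*-zeroʳ (M i k))))

  module CodegreeExcess {n} {A : Matrix n} (adjA : Adjacency A) (small : Small A) where
    open Adjacency adjA
    open AdjacencyProperties adjA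
    open SmallDegree adjA small

    -- Off the diagonal this is c(c - 1) for the codegree c, the number of ordered pairs of distinct
    -- common neighbours. Its total counts every 4-cycle eight times.
    excess : Fin n → Fin n → ℤ
    excess i j = A² i j * A² j i - A² i j - δ i j * (e i * e i - e i)

    excess-diagonal : ∀ i → excess i i ≡ 0ℤ
    excess-diagonal i = trans (cong₂ (λ u v → u * u - u - v * (e i * e i - e i)) (square-diagonal i) (δ-≡ i)) (cancel (e i))
      where
      cancel : ∀ x → x * x - x - 1ℤ * (x * x - x) ≡ 0ℤ
      cancel = solve-∀

    excess-off : ∀ {i j} → i ≢ j → excess i j ≡ A² i j * (A² i j - 1ℤ)
    excess-off {i} {j} i≢j = trans (cong₂ (λ u v → A² i j * u - A² i j - v * (e i * e i - e i)) (square-sym j i) (δ-≢ i≢j)) (factor (A² i j) (e i * e i - e i))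
      where
      factor : ∀ x y → x * x - x - 0ℤ * y ≡ x * (x - 1ℤ)
      factor = solve-∀

    0≤excess : ∀ i j → 0ℤ ≤ excess i j
    0≤excess i j with i FinP.≟ j
    ... | yes refl = ℤP.≤-reflexive (sym (excess-diagonal i))
    ... | no i≢j = subst (0ℤ ≤_) (trans (shift (A² i j)) (sym (excess-off i≢j))) (consecutive-product-nonneg (A² i j + pos 2))
      where
      shift : ∀ x → (x + pos 2 - pos 2) * (x + pos 2 - pos 3) ≡ x * (x - 1ℤ)
      shift = solve-∀

    totalExcess : ℤ
    totalExcess = sumℤ (λ i → sumℤ (excess i))

    0≤totalExcess : 0ℤ ≤ totalExcess
    0≤totalExcess = 0≤sum (λ i → 0≤sum (0≤excess i))

    -- The closed 4-walks that do not run around a 4-cycle depend on degrees only: `2 e² - e` of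
    -- them per vertex in total, which is 6 at degree 2 and 1 at degree 1.
    Q₄≡ : Q₄ ≡ totalExcess + (pos 6 * pos n - pos 5 * Π)
    Q₄≡ = trans (expose Q₄ S R) (cong₂ _+_ (sym total) rest)
      where
      S R : ℤ
      S = sumℤ (λ i → sumℤ (A² i))
      R = sumℤ (λ i → e i * e i - e i)
      expose : ∀ q s r → q ≡ (q + - 1ℤ * s + - 1ℤ * r) + (s + r)
      expose = solve-∀
      spread : ∀ x s d r → x - s - d * r ≡ (x + - 1ℤ * s) + - 1ℤ * (d * r)
      spread = solve-∀
      total : totalExcess ≡ Q₄ + - 1ℤ * S + - 1ℤ * R
      total = trans (∑∑-cong (λ i j → spread (A² i j * A² j i) (A² i j) (δ i j) (e i * e i - e i)))
        (trans (∑∑-+ (λ i j → A² i j * A² j i + - 1ℤ * A² i j) (λ i j → - 1ℤ * (δ i j * (e i * e i - e i))))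
          (cong₂ _+_ (trans (∑∑-+ (λ i j → A² i j * A² j i) (λ i j → - 1ℤ * A² i j)) (cong (_+_ Q₄) (∑∑-* (- 1ℤ) A²)))
            (trans (∑∑-* (- 1ℤ) (λ i j → δ i j * (e i * e i - e i))) (cong (- 1ℤ *_) (sum-cong (λ i → sum-δ i (λ _ → e i * e i - e i)))))))
      S≡ : S ≡ sumℤ (λ k → e k * e k)
      S≡ = trans (sum-cong (λ i → sum-swap (λ j k → A i k * A k j))) (trans (sum-cong (λ i → sum-cong (λ k → sum-*ˡ (A i k) (A k))))
        (trans (sum-swap (λ i k → A i k * e k)) (sum-cong (λ k → trans (sum-*ʳ (e k) (λ i → A i k)) (cong (_* e k) (sum-cong (λ i → symm i k)))))))
      rest : S + R ≡ pos 6 * pos n - pos 5 * Π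
      rest = trans (cong (_+ R) S≡) (trans (sym (sum-+ (λ i → e i * e i) (λ i → e i * e i - e i)))
        (trans (sum-cong (λ i → trans (pointwise (e i)) (cong (λ u → pos 6 - pos 7 * π i + pos 2 * u) (π-idem i)))) (trans (sum-cong (λ i → merge (π i))) (trans (sum-minus (λ _ → pos 6) (λ i → pos 5 * π i))
          (cong₂ _-_ (trans (sum-const n (pos 6)) (ℤP.*-comm (pos n) (pos 6))) (sum-*ˡ (pos 5) π))))))
        where
        pointwise : ∀ e → e * e + (e * e - e) ≡ pos 6 - pos 7 * (pos 2 - e) + pos 2 * ((pos 2 - e) * (pos 2 - e))
        pointwise = solve-∀
        merge : ∀ p → pos 6 - pos 7 * p + pos 2 * p ≡ pos 6 - pos 5 * p
        merge = solve-∀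

    -- The number μ: each adjacent pair of a leaf and an interior vertex is counted once, from the
    -- leaf.
    mixing : ℤ
    mixing = sumℤ (λ i → sumℤ (λ j → π i * (A i j * (1ℤ - π j))))

    0≤mixed : ∀ i j → 0ℤ ≤ π i * (A i j * (1ℤ - π j))
    0≤mixed i j = 0≤-* (0≤π i) (0≤-* (0≤A i j) (0≤1-π j))

    0≤mixing : 0ℤ ≤ mixing
    0≤mixing = 0≤sum (λ i → 0≤sum (0≤mixed i))

    Λ≡ : Λ ≡ Π - mixing
    Λ≡ = trans (expose Λ mixing) (cong (_- mixing) (trans (sym (∑∑-+ (λ i j → π i * (A i j * π j)) (λ i j → π i * (A i j * (1ℤ - π j)))))
      (trans (∑∑-cong (λ i j → merge (π i) (A i j) (π j))) sum-πA)))
      where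
      expose : ∀ x y → x ≡ (x + y) - y
      expose = solve-∀
      merge : ∀ p a q → p * (a * q) + p * (a * (1ℤ - q)) ≡ p * a
      merge = solve-∀

    Q₅-nonneg : 0ℤ ≤ Q₅
    Q₅-nonneg = 0≤sum (λ i → 0≤sum (λ j → 0≤-* (0≤A² i j) (0≤sum (λ k → 0≤-* (0≤A j k) (0≤A² k i)))))
      where
      0≤A² : ∀ i j → 0ℤ ≤ A² i j
      0≤A² i j = 0≤sum (λ k → 0≤-* (0≤A i k) (0≤A k j))

    open HubMatrix adjA small using (AdjacencyConstant)

    unmixed⇒mixing≡0 : AdjacencyConstant π → mixing ≡ 0ℤ
    unmixed⇒mixing≡0 const = sum-zero (λ i → sum-zero (λ j → trans (expand (π i) (A i j) (π j))
        (trans (cong (λ v → A i j * (π i - π i * π i) + π i * v) (const i j)) (trans (cong (λ u → A i j * (π i - u) + π i * 0ℤ) (π-idem i)) (vanish (A i j) (π i))))))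
      where
      expand : ∀ p a q → p * (a * (1ℤ - q)) ≡ a * (p - p * p) + p * (a * (p - q))
      expand = solve-∀
      vanish : ∀ a p → a * (p - p) + p * 0ℤ ≡ 0ℤ
      vanish = solve-∀

    mixing≡0⇒unmixed : mixing ≡ 0ℤ → AdjacencyConstant π
    mixing≡0⇒unmixed mixing≡0 i j = trans (difference (A i j) (π i) (π j)) (cong₂ _-_ (zeros i j) (trans (cong (λ u → π j * (u * (1ℤ - π i))) (symm i j)) (zeros j i)))
      where
      zeros : ∀ i j → π i * (A i j * (1ℤ - π j)) ≡ 0ℤ
      zeros i j = sum-nonneg≡0 (0≤mixed i) (sum-nonneg≡0 (λ i → 0≤sum (0≤mixed i)) mixing≡0 i) j
      difference : ∀ a p q → a * (p - q) ≡ p * (a * (1ℤ - q)) - q * (a * (1ℤ - p))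
      difference = solve-∀

  -- `rigid`, that 5 is not an eigenvalue, is all that this module takes from the spectrum.
  module Cycles {n} {A : Matrix n} (adjA : Adjacency A) (small : Small A)
    (rigid : det (charMatrix (HubMatrix.B₀ adjA small) (pos 2)) ≢ 0ℤ) where
    open Adjacency adjA
    open AdjacencyProperties adjA
    open SmallDegree adjA small
    open HubMatrix adjA small
    open CodegreeExcess adjA small

    _~_ : Fin n → Fin n → Set
    i ~ j = A i j ≡ 1ℤ

    ~-sym : ∀ {i j} → i ~ j → j ~ i
    ~-sym {i} {j} p = trans (symm j i) p

    ~-irrefl : ∀ {i} → ¬ (i ~ i)
    ~-irrefl {i} p with trans (sym (loopless i)) p
    ... | ()

    ~⇒≢ : ∀ {i j} → i ~ j → i ≢ j
    ~⇒≢ p refl = ~-irrefl p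

    ~? : ∀ i j → Dec (i ~ j)
    ~? i j = A i j ℤP.≟ 1ℤ

    A≢0⇒~ : ∀ {i j} → A i j ≢ 0ℤ → i ~ j
    A≢0⇒~ {i} {j} ≢0 with binary i j
    ... | inj₁ p = ⊥-elim (≢0 p)
    ... | inj₂ p = p

    δ≡1 : ∀ {m} {i j : Fin m} → δ i j ≡ 1ℤ → i ≡ j
    δ≡1 {i = i} {j} p with i FinP.≟ j
    ... | yes e = e
    ... | no i≢j with trans (sym (δ-≢ i≢j)) p
    ...   | ()

    leaf-neighbour : ∀ {i p} → (∀ k → A i k ≡ δ p k) → ∀ {k} → i ~ k → p ≡ k
    leaf-neighbour Ai {k} i~k = δ≡1 (trans (sym (Ai k)) i~k)

    interior-neighbour : ∀ {i p q} → (∀ k → A i k ≡ δ p k + δ q k) → ∀ {k} → i ~ k → p ≡ k ⊎ q ≡ k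
    interior-neighbour {i} {p} {q} Ai {k} i~k with p FinP.≟ k | q FinP.≟ k
    ... | yes e | _ = inj₁ e
    ... | no _ | yes e = inj₂ e
    ... | no p≢k | no q≢k with trans (sym i~k) (trans (Ai k) (cong₂ _+_ (δ-≢ p≢k) (δ-≢ q≢k)))
    ...   | ()

    -- The bound 2 on degrees, in the form that drives the walk arguments below.
    third-neighbour : ∀ {x a b c} → a ≢ b → x ~ a → x ~ b → x ~ c → c ≡ a ⊎ c ≡ b
    third-neighbour {x} a≢b xa xb xc with view x
    ... | leaf p _ _ Ax = ⊥-elim (a≢b (trans (sym (leaf-neighbour {x} {p} Ax xa)) (leaf-neighbour {x} {p} Ax xb)))
    ... | interior p q _ _ _ Ax with interior-neighbour {x} {p} {q} Ax xa | interior-neighbour {x} {p} {q} Ax xb | interior-neighbour {x} {p} {q} Ax xc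
    ...   | inj₁ refl | inj₁ refl | _ = ⊥-elim (a≢b refl)
    ...   | inj₂ refl | inj₂ refl | _ = ⊥-elim (a≢b refl)
    ...   | inj₁ refl | inj₂ refl | inj₁ refl = inj₁ refl
    ...   | inj₁ refl | inj₂ refl | inj₂ refl = inj₂ refl
    ...   | inj₂ refl | inj₁ refl | inj₁ refl = inj₂ refl
    ...   | inj₂ refl | inj₁ refl | inj₂ refl = inj₁ refl

    two-neighbours⇒interior : ∀ {x a b} → a ≢ b → x ~ a → x ~ b → π x ≡ 0ℤ
    two-neighbours⇒interior {x} a≢b xa xb with view x
    ... | leaf p _ _ Ax = ⊥-elim (a≢b (trans (sym (leaf-neighbour {x} {p} Ax xa)) (leaf-neighbour {x} {p} Ax xb)))
    ... | interior _ _ _ πx _ _ = πx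

    -- a union of cycle components
    record Cyclic (D : Fin n → Set) : Set where
      field
        member? : ∀ x → Dec (D x)
        neighbours : ∀ {x} → D x → ∃ λ a → ∃ λ b → D a × D b × a ≢ b × x ~ a × x ~ b

      closed : ∀ {x y} → D x → x ~ y → D y
      closed Dx x~y with neighbours Dx
      ... | a , b , Da , Db , a≢b , xa , xb with third-neighbour a≢b xa xb x~y
      ...   | inj₁ refl = Da
      ...   | inj₂ refl = Db

      indicator : Fin n → ℤ
      indicator x with member? x
      ... | yes _ = 1ℤ
      ... | no _ = 0ℤ

      indicator-in : ∀ {x} → D x → indicator x ≡ 1ℤ
      indicator-in {x} Dx with member? x
      ... | yes _ = refl
      ... | no ¬Dx = ⊥-elim (¬Dx Dx)

      indicator-out : ∀ {x} → ¬ D x → indicator x ≡ 0ℤ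
      indicator-out {x} ¬Dx with member? x
      ... | yes Dx = ⊥-elim (¬Dx Dx)
      ... | no _ = refl

      0≤indicator : ∀ x → 0ℤ ≤ indicator x
      0≤indicator x with member? x
      ... | yes _ = 0≤pos 1
      ... | no _ = 0≤pos 0

      indicator-constant : AdjacencyConstant indicator
      indicator-constant i j with binary i j
      ... | inj₁ p = trans (cong (_* (indicator i - indicator j)) p) (ℤP.*-zeroˡ (indicator i - indicator j))
      ... | inj₂ p = trans (cong (A i j *_) (ℤP.i≡j⇒i-j≡0 same)) (ℤP.*-zeroʳ (A i j))
        where
        same : indicator i ≡ indicator j
        same with member? i
        ... | yes Di = sym (indicator-in (closed Di p))
        ... | no ¬Di = sym (indicator-out (λ Dj → ¬Di (closed Dj (~-sym p))))

      indicator-leaf : ∀ i → π i * indicator i ≡ 0ℤ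
      indicator-leaf i with member? i
      ... | no _ = ℤP.*-zeroʳ (π i)
      ... | yes Di with neighbours Di
      ...   | a , b , _ , _ , a≢b , ia , ib = trans (cong (_* 1ℤ) (two-neighbours⇒interior a≢b ia ib)) refl

      size≢0 : ∀ {x} → D x → sumℤ indicator ≢ 0ℤ
      size≢0 {x} Dx e with trans (sym (indicator-in Dx)) (sum-nonneg≡0 0≤indicator e x)
      ... | ()

    -- The indicators of the two sets are constant along edges and 0 at leaves, so a combination
    -- with total 0 contradicts `rigid`.
    no-disjoint-cycles : ∀ {D D′ x y} → Cyclic D → Cyclic D′ → D x → D′ y → ¬ (∀ {z} → D z → D′ z → ⊥)
    no-disjoint-cycles {D} {D′} {x} {y} cyc cyc′ Dx D′y disjoint =
      product≢0 {size′} {1ℤ} (C′.size≢0 D′y) (λ ()) (trans (sym at-x) (constant-kernel rigid f Σf≡0 f-constant f-leaf x))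
      where
      module C = Cyclic cyc
      module C′ = Cyclic cyc′
      size size′ : ℤ
      size = sumℤ C.indicator
      size′ = sumℤ C′.indicator
      f : Fin n → ℤ
      -- Cross-weighting by the sizes makes the total vanish, as the apex row of 5 - Q requires.
      f z = size′ * C.indicator z - size * C′.indicator z
      Σf≡0 : sumℤ f ≡ 0ℤ
      Σf≡0 = trans (sum-minus (λ z → size′ * C.indicator z) (λ z → size * C′.indicator z))
        (trans (cong₂ _-_ (sum-*ˡ size′ C.indicator) (sum-*ˡ size C′.indicator)) (cancel size size′))
        where
        cancel : ∀ a b → b * a - a * b ≡ 0ℤ
        cancel = solve-∀
      f-constant : AdjacencyConstant f
      f-constant i j = trans (expand (A i j) size size′ (C.indicator i) (C.indicator j) (C′.indicator i) (C′.indicator j))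
        (trans (cong₂ (λ u v → size′ * u - size * v) (C.indicator-constant i j) (C′.indicator-constant i j)) (zeros size size′))
        where
        expand : ∀ a s t x y z w → a * ((t * x - s * z) - (t * y - s * w)) ≡ t * (a * (x - y)) - s * (a * (z - w))
        expand = solve-∀
        zeros : ∀ s t → t * 0ℤ - s * 0ℤ ≡ 0ℤ
        zeros = solve-∀
      f-leaf : ∀ i → π i * f i ≡ 0ℤ
      f-leaf i = trans (expand (π i) size size′ (C.indicator i) (C′.indicator i))
        (trans (cong₂ (λ u v → size′ * u - size * v) (C.indicator-leaf i) (C′.indicator-leaf i)) (zeros size size′))
        where
        expand : ∀ p s t x z → p * (t * x - s * z) ≡ t * (p * x) - s * (p * z)
        expand = solve-∀
        zeros : ∀ s t → t * 0ℤ - s * 0ℤ ≡ 0ℤ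
        zeros = solve-∀
      at-x : f x ≡ size′ * 1ℤ
      at-x = trans (cong₂ (λ u v → size′ * u - size * v) (C.indicator-in Dx) (C′.indicator-out (λ D′x → disjoint Dx D′x))) (drop size size′)
        where
        drop : ∀ s t → t * 1ℤ - s * 0ℤ ≡ t * 1ℤ
        drop = solve-∀

    Square : (i j p q : Fin n) → Fin n → Set
    Square i j p q x = (x ≡ i ⊎ x ≡ j) ⊎ (x ≡ p ⊎ x ≡ q)

    square-cyclic : ∀ {i j p q} → i ≢ j → p ≢ q → i ~ p → i ~ q → j ~ p → j ~ q → Cyclic (Square i j p q)
    square-cyclic {i} {j} {p} {q} i≢j p≢q ip iq jp jq = record
      { member? = λ x → ((x FinP.≟ i) ⊎-dec (x FinP.≟ j)) ⊎-dec ((x FinP.≟ p) ⊎-dec (x FinP.≟ q))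
      ; neighbours = λ
          { (inj₁ (inj₁ refl)) → p , q , inj₂ (inj₁ refl) , inj₂ (inj₂ refl) , p≢q , ip , iq
          ; (inj₁ (inj₂ refl)) → p , q , inj₂ (inj₁ refl) , inj₂ (inj₂ refl) , p≢q , jp , jq
          ; (inj₂ (inj₁ refl)) → i , j , inj₁ (inj₁ refl) , inj₁ (inj₂ refl) , i≢j , ~-sym ip , ~-sym jp
          ; (inj₂ (inj₂ refl)) → i , j , inj₁ (inj₁ refl) , inj₁ (inj₂ refl) , i≢j , ~-sym iq , ~-sym jq }
      }

    -- With degrees at most 2, these are the vertices of triangle and of 5-cycle components; closed
    -- walks treat both kinds alike and come straight from `Q₅`.
    ClosedWalk⁵ : Fin n → Set
    ClosedWalk⁵ z = ∃ λ a → ∃ λ b → ∃ λ c → ∃ λ d → z ~ a × a ~ b × b ~ c × c ~ d × d ~ z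

    triangle⇒closedWalk⁵ : ∀ {x y z} → x ~ y → y ~ z → z ~ x → ClosedWalk⁵ x
    triangle⇒closedWalk⁵ xy yz zx = _ , _ , _ , _ , xy , ~-sym xy , xy , yz , zx

    -- When the first and the last step of the walk use different neighbours, its rotations show
    -- that both of these start closed 5-walks themselves.
    closedWalk⁵-cyclic : Cyclic ClosedWalk⁵
    closedWalk⁵-cyclic = record
      { member? = λ z → FinP.any? λ a → FinP.any? λ b → FinP.any? λ c → FinP.any? λ d →
          ~? z a ×-dec ~? a b ×-dec ~? b c ×-dec ~? c d ×-dec ~? d z
      ; neighbours = λ (a , b , c , d , za , ab , bc , cd , dz) → neighbours za ab bc cd dz (a FinP.≟ d)
      }
      where
      -- if the walk leaves and returns through the same neighbour, that neighbour and z lie on a triangle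
      neighbours : ∀ {z a b c d} → z ~ a → a ~ b → b ~ c → c ~ d → d ~ z → Dec (a ≡ d) →
        ∃ λ u → ∃ λ v → ClosedWalk⁵ u × ClosedWalk⁵ v × u ≢ v × z ~ u × z ~ v
      neighbours {z} {a} {b} {c} {d} za ab bc cd dz (no a≢d) =
        a , d , (b , c , d , z , ab , bc , cd , dz , za) , (z , a , b , c , dz , za , ab , bc , cd) , a≢d , za , ~-sym dz
      neighbours {z} {a} {b} {c} za ab bc ca az (yes refl) with third-neighbour (~⇒≢ bc) ab (~-sym ca) az
      ... | inj₁ refl = a , c , triangle⇒closedWalk⁵ ab bc ca , triangle⇒closedWalk⁵ ca ab bc , (λ e → ~⇒≢ ca (sym e)) , za , bc
      ... | inj₂ refl = a , b , triangle⇒closedWalk⁵ ab bc ca , triangle⇒closedWalk⁵ bc ca ab , ~⇒≢ ab , za , ~-sym bc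

    -- The 4-cycle is a whole component and bipartite with sides `I` and `P`, so five steps always
    -- end on the other side.
    square-walk-disjoint : ∀ {i j p q} → i ≢ j → p ≢ q → i ~ p → i ~ q → j ~ p → j ~ q →
      ∀ {z} → Square i j p q z → ClosedWalk⁵ z → ⊥
    square-walk-disjoint {i} {j} {p} {q} i≢j p≢q ip iq jp jq Dz (a , b , c , d , za , ab , bc , cd , dz) = go Dz
      where
      I P : Fin n → Set
      I x = x ≡ i ⊎ x ≡ j
      P x = x ≡ p ⊎ x ≡ q
      I→P : ∀ {x y} → I x → x ~ y → P y
      I→P (inj₁ refl) xy = third-neighbour p≢q ip iq xy
      I→P (inj₂ refl) xy = third-neighbour p≢q jp jq xy
      P→I : ∀ {x y} → P x → x ~ y → I y
      P→I (inj₁ refl) xy = third-neighbour i≢j (~-sym ip) (~-sym jp) xy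
      P→I (inj₂ refl) xy = third-neighbour i≢j (~-sym iq) (~-sym jq) xy
      apart : ∀ {x} → I x → P x → ⊥
      apart (inj₁ refl) (inj₁ refl) = ~-irrefl ip
      apart (inj₁ refl) (inj₂ refl) = ~-irrefl iq
      apart (inj₂ refl) (inj₁ refl) = ~-irrefl jp
      apart (inj₂ refl) (inj₂ refl) = ~-irrefl jq
      go : Square i j p q _ → ⊥
      go (inj₁ Iz) = apart Iz (I→P (P→I (I→P (P→I (I→P Iz za) ab) bc) cd) dz)
      go (inj₂ Pz) = apart (P→I (I→P (P→I (I→P (P→I Pz za) ab) bc) cd) dz) Pz

    -- x(x - 1) vanishes at 0 and 1, so the codegree is 2: both neighbours of `i` are adjacent to
    -- `j`.
    excess⇒square : ∀ i j → excess i j ≢ 0ℤ → ∃ λ p → ∃ λ q → i ≢ j × p ≢ q × i ~ p × i ~ q × j ~ p × j ~ q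
    excess⇒square i j ≢0 with i FinP.≟ j
    ... | yes refl = ⊥-elim (≢0 (excess-diagonal i))
    ... | no i≢j with view i
    ...   | leaf p _ _ Ai = ⊥-elim (≢0 (trans (excess-off i≢j) (trans (cong (λ u → u * (u - 1ℤ)) (leaf-sum Ai (λ k → A k j))) (pronic (A p j) (binary p j)))))
      where
      pronic : ∀ x → x ≡ 0ℤ ⊎ x ≡ 1ℤ → x * (x - 1ℤ) ≡ 0ℤ
      pronic _ (inj₁ refl) = refl
      pronic _ (inj₂ refl) = refl
    ...   | interior p q p≢q _ _ Ai = p , q , i≢j , p≢q , trans (Ai p) (cong₂ _+_ (δ-≡ p) (δ-≢ (p≢q ∘ sym))) , trans (Ai q) (cong₂ _+_ (δ-≢ p≢q) (δ-≡ q)) , ~-sym (proj₁ both) , ~-sym (proj₂ both)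
      where
      codegree : A² i j ≡ A p j + A q j
      codegree = trans (sum-cong (λ k → trans (cong (_* A k j) (Ai k)) (ℤP.*-distribʳ-+ (A k j) (δ p k) (δ q k))))
        (trans (sum-+ (λ k → δ p k * A k j) (λ k → δ q k * A k j)) (cong₂ _+_ (sum-δ p (λ k → A k j)) (sum-δ q (λ k → A k j))))
      zero-excess : ∀ {x y} → A p j ≡ x → A q j ≡ y → (x + y) * (x + y - 1ℤ) ≡ 0ℤ → ⊥
      zero-excess ex ey z = ≢0 (trans (excess-off i≢j) (trans (cong (λ u → u * (u - 1ℤ)) (trans codegree (cong₂ _+_ ex ey))) z))
      both : p ~ j × q ~ j
      both with binary p j | binary q j
      ... | inj₂ x | inj₂ y = x , y
      ... | inj₁ x | inj₁ y = ⊥-elim (zero-excess x y refl)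
      ... | inj₁ x | inj₂ y = ⊥-elim (zero-excess x y refl)
      ... | inj₂ x | inj₁ y = ⊥-elim (zero-excess x y refl)

    Q₅⇒closedWalk⁵ : Q₅ ≢ 0ℤ → ∃ ClosedWalk⁵
    Q₅⇒closedWalk⁵ Q₅≢0 = diagonal (sum≢0 (λ i → (A² ⊗ (A ⊗ A²)) i i) Q₅≢0)
      where
      assemble : ∀ {i j} → (∃ λ l → A i l ≢ 0ℤ × A l j ≢ 0ℤ) → ∀ {k} → A j k ≢ 0ℤ → (∃ λ m → A k m ≢ 0ℤ × A m i ≢ 0ℤ) → ∃ ClosedWalk⁵
      assemble {i} {j} (l , il , lj) {k} jk (m , km , mi) = i , l , j , k , m , A≢0⇒~ il , A≢0⇒~ lj , A≢0⇒~ jk , A≢0⇒~ km , A≢0⇒~ mi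
      second : ∀ {i j} → A² i j ≢ 0ℤ → (∃ λ k → A j k ≢ 0ℤ × A² k i ≢ 0ℤ) → ∃ ClosedWalk⁵
      second {i} {j} ij (k , jk , ki) = assemble (⊗≢0 A A i j ij) jk (⊗≢0 A A k i ki)
      first : ∀ {i} → (∃ λ j → A² i j ≢ 0ℤ × (A ⊗ A²) j i ≢ 0ℤ) → ∃ ClosedWalk⁵
      first {i} (j , ij , ji) = second ij (⊗≢0 A A² j i ji)
      diagonal : (∃ λ i → (A² ⊗ (A ⊗ A²)) i i ≢ 0ℤ) → ∃ ClosedWalk⁵
      diagonal (i , ii) = first (⊗≢0 A² (A ⊗ A²) i i ii)

    excess-or-Q₅-vanishes : totalExcess ≢ 0ℤ → Q₅ ≢ 0ℤ → ⊥
    excess-or-Q₅-vanishes excess≢0 Q₅≢0 = row (sum≢0 (λ i → sumℤ (excess i)) excess≢0)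
      where
      clash : ∀ {i j} → (∃ λ p → ∃ λ q → i ≢ j × p ≢ q × i ~ p × i ~ q × j ~ p × j ~ q) → ∃ ClosedWalk⁵ → ⊥
      clash (p , q , i≢j , p≢q , ip , iq , jp , jq) (z , walk) =
        no-disjoint-cycles (square-cyclic i≢j p≢q ip iq jp jq) closedWalk⁵-cyclic (inj₁ (inj₁ refl)) walk
          (square-walk-disjoint i≢j p≢q ip iq jp jq)
      entry : ∀ {i} → (∃ λ j → excess i j ≢ 0ℤ) → ⊥
      entry {i} (j , ij) = clash (excess⇒square i j ij) (Q₅⇒closedWalk⁵ Q₅≢0)
      row : (∃ λ i → sumℤ (excess i) ≢ 0ℤ) → ⊥
      row (i , i≢0) = entry (sum≢0 (excess i) i≢0)

    module Walk (unmixed : AdjacencyConstant π) where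

      interior-closed : ∀ {x y} → x ~ y → π x ≡ 0ℤ → π y ≡ 0ℤ
      interior-closed {x} {y} xy πx = trans (sym (ℤP.i-j≡0⇒i≡j (π x) (π y)
        (trans (sym (ℤP.*-identityˡ (π x - π y))) (trans (cong (_* (π x - π y)) (sym xy)) (unmixed x y))))) πx

      other-neighbour : ∀ {x a} → π x ≡ 0ℤ → x ~ a → ∃ λ b → b ≢ a × x ~ b
      other-neighbour {x} {a} πx xa with view x
      ... | leaf _ πx≡1 _ _ = ⊥-elim (0≢1 (trans (sym πx) πx≡1))
        where
        0≢1 : 0ℤ ≢ 1ℤ
        0≢1 ()
      ... | interior p q p≢q _ _ Ax with p FinP.≟ a
      ...   | yes refl = q , (λ e → p≢q (sym e)) , trans (Ax q) (cong₂ _+_ (δ-≢ p≢q) (δ-≡ q))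
      ...   | no p≢a = p , p≢a , trans (Ax p) (cong₂ _+_ (δ-≡ p) (δ-≢ (p≢q ∘ sym)))

      -- A directed edge: to go on without turning back, the walk has to remember where it comes
      -- from. Only the tail is asked to be interior, as `interior-closed` supplies the head.
      Dart : Set
      Dart = ∃ λ a → ∃ λ b → π a ≡ 0ℤ × a ~ b

      next : Dart → Dart
      next (a , b , πa , ab) = b , proj₁ (other-neighbour πb (~-sym ab)) , πb , proj₂ (proj₂ (other-neighbour πb (~-sym ab)))
        where
        πb = interior-closed ab πa

      start : ∀ {x} → π x ≡ 0ℤ → Dart
      start {x} πx with view x
      ... | leaf _ πx≡1 _ _ = ⊥-elim (0≢1 (trans (sym πx) πx≡1))
        where
        0≢1 : 0ℤ ≢ 1ℤ
        0≢1 ()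
      ... | interior p q p≢q _ _ Ax = x , p , πx , trans (Ax p) (cong₂ _+_ (δ-≡ p) (δ-≢ (p≢q ∘ sym)))

      module From (origin : Dart) where
        dart : ℕ → Dart
        dart zero = origin
        dart (suc k) = next (dart k)

        walk : ℕ → Fin n
        walk k = proj₁ (dart k)

        walk-step : ∀ k → walk k ~ walk (suc k)
        walk-step k = proj₂ (proj₂ (proj₂ (dart k)))

        walk-interior : ∀ k → π (walk k) ≡ 0ℤ
        walk-interior k = proj₁ (proj₂ (proj₂ (dart k)))

        no-backtrack : ∀ k → walk (suc (suc k)) ≢ walk k
        no-backtrack k = proj₁ (proj₂ (other-neighbour (interior-closed (walk-step k) (walk-interior k)) (~-sym (walk-step k))))

        Repeats : ℕ → Set
        Repeats b = ∃ λ (a : Fin b) → walk (toℕ a) ≡ walk b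

        repeats? : ∀ b → Dec (Repeats b)
        repeats? b = FinP.any? (λ a → walk (toℕ a) FinP.≟ walk b)

        repeat-at : ∀ {a b} → a ℕ.< b → walk a ≡ walk b → Repeats b
        repeat-at {a} {b} a<b e = Fin.fromℕ< a<b , trans (cong walk (FinP.toℕ-fromℕ< a<b)) e

        some-repeat : ∃ Repeats
        some-repeat with FinP.pigeonhole (ℕP.n<1+n n) (λ (k : Fin (suc n)) → walk (toℕ k))
        ... | i , j , i<j , e = toℕ j , repeat-at i<j e

        first-repeat : ∀ fuel → Repeats fuel → ∃ λ b → Repeats b × (∀ k → k ℕ.< b → ¬ Repeats k)
        first-repeat fuel r = search fuel zero (ℕP.+-identityʳ fuel) (λ _ ())
          where
          search : ∀ m b → m ℕ.+ b ≡ fuel → (∀ k → k ℕ.< b → ¬ Repeats k) → ∃ λ b → Repeats b × (∀ k → k ℕ.< b → ¬ Repeats k)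
          search m b e none with repeats? b
          ... | yes rb = b , rb , none
          search zero b e none | no ¬rb = ⊥-elim (¬rb (subst Repeats (sym e) r))
          search (suc m) b e none | no ¬rb = search m (suc b) (trans (ℕP.+-suc m b) e) λ k k<1+b → extend k (ℕP.m<1+n⇒m<n∨m≡n k<1+b)
            where
            extend : ∀ k → k ℕ.< b ⊎ k ≡ b → ¬ Repeats k
            extend k (inj₁ k<b) = none k k<b
            extend k (inj₂ refl) = ¬rb

        private
          found : ∃ λ b → Repeats b × (∀ k → k ℕ.< b → ¬ Repeats k)
          found = first-repeat (proj₁ some-repeat) (proj₂ some-repeat)

        len : ℕ
        len = proj₁ found

        distinct : ∀ {a b} → a ℕ.< b → b ℕ.< len → walk a ≢ walk b
        distinct {a} {b} a<b b<len e = proj₂ (proj₂ found) b b<len (repeat-at a<b e)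

        -- The first repetition cannot return to a vertex other than the origin. The vertex visited
        -- just before the return is a neighbour of the repeated one, hence its predecessor or its
        -- successor on the walk, and this gives an earlier repetition, a step back or a loop.
        returns : walk 0 ≡ walk len
        returns = to-zero (toℕ (proj₁ (proj₁ (proj₂ found)))) len (FinP.toℕ<n (proj₁ (proj₁ (proj₂ found)))) refl (proj₂ (proj₁ (proj₂ found)))
          where
          to-zero : ∀ a b → a ℕ.< b → b ≡ len → walk a ≡ walk b → walk 0 ≡ walk b
          to-zero zero b _ _ e = e
          to-zero (suc a) (suc b) 1+a<1+b 1+b≡len e
            with third-neighbour (λ e′ → no-backtrack a (sym e′)) (~-sym (walk-step a)) (walk-step (suc a)) (~-sym (subst (walk b ~_) (sym e) (walk-step b)))
          ... | inj₁ e′ = ⊥-elim (distinct (ℕP.≤-pred 1+a<1+b) (ℕP.≤-reflexive 1+b≡len) (sym e′))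
          ... | inj₂ e′ with ℕP.<-cmp (suc (suc a)) b
          ...   | tri< lt _ _ = ⊥-elim (distinct lt (ℕP.≤-reflexive 1+b≡len) (sym e′))
          ...   | tri≈ _ refl _ = ⊥-elim (no-backtrack (suc a) (sym e))
          ...   | tri> _ _ gt with ℕP.≤-antisym (ℕP.≤-pred 1+a<1+b) (ℕP.≤-pred gt)
          ...     | refl = ⊥-elim (~⇒≢ (walk-step (suc a)) e)

        3≤len : 3 ℕ.≤ len
        3≤len = at-least len refl
          where
          at-least : ∀ b → b ≡ len → 3 ℕ.≤ b
          at-least zero e with subst Repeats (sym e) (proj₁ (proj₂ found))
          ... | () , _
          at-least (suc zero) e = ⊥-elim (~⇒≢ (walk-step 0) (trans returns (cong walk (sym e))))
          at-least (suc (suc zero)) e = ⊥-elim (no-backtrack 0 (sym (trans returns (cong walk (sym e)))))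
          at-least (suc (suc (suc b))) e = ℕ.s≤s (ℕ.s≤s (ℕ.s≤s ℕ.z≤n))

        OnCycle : Fin n → Set
        OnCycle x = ∃ λ (k : Fin len) → walk (toℕ k) ≡ x

        on-cycle : ∀ {k} → k ℕ.< len → OnCycle (walk k)
        on-cycle k<len = Fin.fromℕ< k<len , cong walk (FinP.toℕ-fromℕ< k<len)

        last : ℕ
        last = ℕ.pred len

        suc-last : suc last ≡ len
        suc-last = ℕP.suc-pred len {{ℕ.>-nonZero (ℕP.≤-trans (ℕ.s≤s ℕ.z≤n) 3≤len)}}

        wrap : walk 0 ~ walk last
        wrap = ~-sym (subst (walk last ~_) (trans (cong walk suc-last) (sym returns)) (walk-step last))

        next-on-cycle : ∀ {k} → k ℕ.< len → OnCycle (walk (suc k))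
        next-on-cycle {k} k<len with ℕP.m≤n⇒m<n∨m≡n k<len
        ... | inj₁ lt = on-cycle lt
        ... | inj₂ e = subst OnCycle (trans returns (cong walk (sym e))) (on-cycle (ℕP.≤-trans (ℕ.s≤s ℕ.z≤n) 3≤len))

        cycle-cyclic : Cyclic OnCycle
        cycle-cyclic = record
          { member? = λ x → FinP.any? (λ k → walk (toℕ k) FinP.≟ x)
          ; neighbours = λ { (k , refl) → neighbours (toℕ k) (FinP.toℕ<n k) }
          }
          where
          neighbours : ∀ k → k ℕ.< len → ∃ λ a → ∃ λ b → OnCycle a × OnCycle b × a ≢ b × walk k ~ a × walk k ~ b
          neighbours zero 0<len = walk 1 , walk last , next-on-cycle 0<len , on-cycle (ℕP.≤-reflexive suc-last) ,
            distinct (ℕP.≤-pred (ℕP.≤-trans 3≤len (ℕP.≤-reflexive (sym suc-last)))) (ℕP.≤-reflexive suc-last) , walk-step 0 , wrap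
          neighbours (suc k) k<len = walk k , walk (suc (suc k)) , on-cycle (ℕP.<-trans (ℕP.n<1+n k) k<len) , next-on-cycle k<len ,
            (λ e → no-backtrack k (sym e)) , ~-sym (walk-step k) , walk-step (suc k)

        -- The interior vertices off the cycle keep both of their neighbours among themselves. If
        -- there were any, they would be a second union of cycle components.
        complement-cyclic : Cyclic (λ x → π x ≡ 0ℤ × ¬ OnCycle x)
        complement-cyclic = record
          { member? = λ x → (π x ℤP.≟ 0ℤ) ×-dec ¬? (Cyclic.member? cycle-cyclic x)
          ; neighbours = λ { {x} (πx , ¬Dx) → neighbours x πx ¬Dx (view x) }
          }
          where
          neighbours : ∀ x → π x ≡ 0ℤ → ¬ OnCycle x → View x → _
          neighbours x πx ¬Dx (leaf p πx≡1 _ Ax) with trans (sym πx) πx≡1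
          ... | ()
          neighbours x πx ¬Dx (interior p q p≢q _ _ Ax) = p , q ,
              (interior-closed xp πx , (λ Dp → ¬Dx (Cyclic.closed cycle-cyclic Dp (~-sym xp)))) ,
              (interior-closed xq πx , (λ Dq → ¬Dx (Cyclic.closed cycle-cyclic Dq (~-sym xq)))) , p≢q , xp , xq
            where
            xp = trans (Ax p) (cong₂ _+_ (δ-≡ p) (δ-≢ (p≢q ∘ sym)))
            xq = trans (Ax q) (cong₂ _+_ (δ-≢ p≢q) (δ-≡ q))

        interior⇒on-cycle : ∀ x → π x ≡ 0ℤ → OnCycle x
        interior⇒on-cycle x πx with Cyclic.member? cycle-cyclic x
        ... | yes Dx = Dx
        ... | no ¬Dx = ⊥-elim (no-disjoint-cycles cycle-cyclic complement-cyclic (on-cycle (ℕP.≤-trans (ℕ.s≤s ℕ.z≤n) 3≤len)) (πx , ¬Dx) (λ Dz (_ , ¬Dz) → ¬Dz Dz))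

        -- Double counting of the pairs of a position and the vertex visited there: interior
        -- vertices are visited once, leaves never.
        len≡ : pos len ≡ pos n - Π
        len≡ = trans (sym (trans (sum-const len 1ℤ) (ℤP.*-identityʳ (pos len))))
          (trans (sum-cong {len} (λ k → sym (trans (sum-cong (λ x → sym (ℤP.*-identityʳ (δ (walk (toℕ k)) x)))) (sum-δ (walk (toℕ k)) (λ _ → 1ℤ)))))
          (trans (sum-swap (λ (k : Fin len) x → δ (walk (toℕ k)) x))
          (trans (sum-cong multiplicity) (trans (sum-minus (λ _ → 1ℤ) π) (cong (_- Π) (trans (sum-const n 1ℤ) (ℤP.*-identityʳ (pos n))))))))
          where
          injective : ∀ (k l : Fin len) → walk (toℕ k) ≡ walk (toℕ l) → k ≡ l
          injective k l e with ℕP.<-cmp (toℕ k) (toℕ l)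
          ... | tri< lt _ _ = ⊥-elim (distinct lt (FinP.toℕ<n l) e)
          ... | tri≈ _ eq _ = FinP.toℕ-injective eq
          ... | tri> _ _ gt = ⊥-elim (distinct gt (FinP.toℕ<n k) (sym e))
          multiplicity : ∀ x → sumℤ (λ (k : Fin len) → δ (walk (toℕ k)) x) ≡ 1ℤ - π x
          multiplicity x with view x
          ... | leaf _ πx≡1 _ _ = trans (sum-zero {len} (λ k → δ-≢ (off k))) (sym (cong (_-_ 1ℤ) πx≡1))
            where
            off : ∀ k → walk (toℕ k) ≢ x
            off k e with trans (sym πx≡1) (trans (cong π (sym e)) (walk-interior (toℕ k)))
            ... | ()
          ... | interior _ _ _ πx _ _ with interior⇒on-cycle x πx
          ...   | k , refl = trans (sum-single (λ (l : Fin len) → δ (walk (toℕ l)) (walk (toℕ k))) k (λ l l≢k → δ-≢ (λ e → l≢k (injective l k e)))) (trans (δ-≡ (walk (toℕ k))) (sym (cong (_-_ 1ℤ) πx)))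

open CycleComponents

-- Building the isomorphism

module Isomorphisms where
  open import Data.Integer using (_≤_; -_; _-_; _+_; _*_) renaming (+_ to pos)

  injective⇒permutation : ∀ {n} (f : Fin n → Fin n) → (∀ {i j} → f i ≡ f j → i ≡ j) → Σ (Permutation n n) λ ρ → ∀ i → ρ ⟨$⟩ʳ i ≡ f i
  injective⇒permutation {n} f inj = permutation f inverse (λ y → proj₂ (preimage y)) (λ x → inj (proj₂ (preimage (f x)))) , λ i → refl
    where
    hit : ∀ {n} (f : Fin n → Fin n) → (∀ {i j} → f i ≡ f j → i ≡ j) → ∀ y → ∃ λ x → f x ≡ y
    hit {suc m} f inj y with FinP.any? (λ x → f x FinP.≟ y)
    ... | yes found = found
    ... | no missed = ⊥-elim (ℕP.1+n≰n (FinP.injective⇒≤ {f = λ x → punchOut (avoids x)} (λ {x} {x′} e → inj (FinP.punchOut-injective (avoids x) (avoids x′) e))))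
      where
      avoids : ∀ x → y ≢ f x
      avoids x e = missed (x , sym e)
    preimage : ∀ y → ∃ λ x → f x ≡ y
    preimage = hit f inj
    inverse : Fin n → Fin n
    inverse y = proj₁ (preimage y)

  module Embedding (s q : ℕ) (3≤s : 3 ℕ.≤ s) where
    open CanonicalGraph s q 3≤s using (size; Edge; step; close; match; parity)

    module Extend {A : Matrix size} (adjA : Adjacency A) (small : Small A)
      (rigid : det (charMatrix (HubMatrix.B₀ adjA small) (pos 2)) ≢ 0ℤ)
      (unmixed : HubMatrix.AdjacencyConstant adjA small (SmallDegree.π adjA small))
      (interior-count : pos size - SmallDegree.Π adjA small ≡ pos s) where
      open SmallDegree adjA small
      open HubMatrix adjA small
      open Cycles adjA small rigid
      open Walk unmixed

      interior≢0 : pos size - Π ≢ 0ℤ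
      interior≢0 e = ℕP.<⇒≢ (ℕP.≤-trans (ℕ.s≤s ℕ.z≤n) 3≤s) (sym (ℤP.+-injective (trans (sym interior-count) e)))

      open From (start (proj₂ (interior-exists interior≢0)))

      len≡s : len ≡ s
      len≡s = ℤP.+-injective (trans len≡ interior-count)

      -- an embedding of the vertices 0 , … , k − 1 of the canonical graph whose image is a union of components
      record Partial (k : ℕ) : Set where
        field
          place     : ℕ → Fin size
          injective : ∀ {a b} → a ℕ.< k → b ℕ.< k → place a ≡ place b → a ≡ b
          closed    : ∀ {a y} → a ℕ.< k → place a ~ y → ∃ λ b → b ℕ.< k × place b ≡ y
          covers    : ∀ y → π y ≡ 0ℤ → ∃ λ b → b ℕ.< k × place b ≡ y
          links     : ∀ {a b} → a ℕ.< k → b ℕ.< k → Edge a b → place a ~ place b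

      cycle : Partial s
      cycle = record
        { place = walk
        ; injective = injective
        ; closed = λ {a} {y} a<s ay → from-cycle (Cyclic.closed cycle-cyclic (on-cycle (to-len a<s)) ay)
        ; covers = λ y πy → from-cycle (interior⇒on-cycle y πy)
        ; links = links
        }
        where
        to-len : ∀ {a} → a ℕ.< s → a ℕ.< len
        to-len = subst (_ ℕ.<_) (sym len≡s)
        from-cycle : ∀ {y} → OnCycle y → ∃ λ b → b ℕ.< s × walk b ≡ y
        from-cycle (k , e) = toℕ k , subst (toℕ k ℕ.<_) len≡s (FinP.toℕ<n k) , e
        injective : ∀ {a b} → a ℕ.< s → b ℕ.< s → walk a ≡ walk b → a ≡ b
        injective {a} {b} a<s b<s e with ℕP.<-cmp a b
        ... | tri< lt _ _ = ⊥-elim (distinct lt (to-len b<s) e)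
        ... | tri≈ _ eq _ = eq
        ... | tri> _ _ gt = ⊥-elim (distinct gt (to-len a<s) (sym e))
        links : ∀ {a b} → a ℕ.< s → b ℕ.< s → Edge a b → walk a ~ walk b
        links {a} _ _ (step _ refl) = walk-step a
        links {b = b} _ _ (close refl e) = subst (λ k → walk 0 ~ walk k) (ℕP.suc-injective (trans suc-last (trans len≡s (sym e)))) wrap
        links a<s _ (match s≤a _ _) = ⊥-elim (ℕP.<⇒≱ a<s s≤a)

      -- By `unmixed` the neighbour of a leaf is again a leaf, so the two form a component K₂.
      leaf⇒pair : ∀ {x} → π x ≡ 1ℤ → ∃ λ p → x ~ p × (∀ {y} → x ~ y → y ≡ p) × (∀ {y} → p ~ y → y ≡ x)
      leaf⇒pair {x} πx with view x
      ... | interior _ _ _ πx≡0 _ _ = ⊥-elim (1≢0 (trans (sym πx) πx≡0))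
        where
        1≢0 : 1ℤ ≢ 0ℤ
        1≢0 ()
      ... | leaf p _ _ Ax = p , xp , (λ xy → sym (leaf-neighbour {x} {p} Ax xy)) , back
        where
        xp : x ~ p
        xp = trans (Ax p) (δ-≡ p)
        back : ∀ {y} → p ~ y → y ≡ x
        back {y} py with view p
        ... | leaf r _ _ Ap = trans (sym (leaf-neighbour {p} {r} Ap py)) (leaf-neighbour {p} {r} Ap (~-sym xp))
        ... | interior _ _ _ πp≡0 _ _ = ⊥-elim (1≢0 (trans (sym πx) (interior-closed (~-sym xp) πp≡0)))
          where
          1≢0 : 1ℤ ≢ 0ℤ
          1≢0 ()

      -- By counting, some vertex lies outside the image. It is a leaf, since `covers` puts all
      -- interior vertices into the image, and its neighbour is outside too, since the image is
      -- closed under adjacency. The two receive the positions `k` and `suc k`.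
      module AddPair (t : ℕ) (t<q : t ℕ.< q) (P : Partial (s ℕ.+ 2 ℕ.* t)) where
        open Partial P

        k : ℕ
        k = s ℕ.+ 2 ℕ.* t

        Used : Fin size → Set
        Used x = ∃ λ (b : Fin k) → place (toℕ b) ≡ x

        used : ∀ {x} → (∃ λ b → b ℕ.< k × place b ≡ x) → Used x
        used (b , b<k , e) = Fin.fromℕ< b<k , trans (cong place (FinP.toℕ-fromℕ< b<k)) e

        k<size : k ℕ.< size
        k<size = ℕP.+-monoʳ-< s (ℕP.*-monoʳ-< 2 t<q)

        fresh : ∃ λ x → ¬ Used x
        fresh with FinP.any? (λ x → ¬? (FinP.any? (λ (b : Fin k) → place (toℕ b) FinP.≟ x)))
        ... | yes found = found
        ... | no none = ⊥-elim (FinP.<⇒notInjective {f = λ x → proj₁ (index x)} k<size (λ {x} {y} e → trans (sym (proj₂ (index x))) (trans (cong (place ∘ toℕ) e) (proj₂ (index y)))))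
          where
          index : ∀ x → Used x
          index x with FinP.any? (λ (b : Fin k) → place (toℕ b) FinP.≟ x)
          ... | yes u = u
          ... | no ¬u = ⊥-elim (none (x , ¬u))

        x : Fin size
        x = proj₁ fresh

        πx : π x ≡ 1ℤ
        πx with view x
        ... | leaf _ e _ _ = e
        ... | interior _ _ _ e _ _ = ⊥-elim (proj₂ fresh (used (covers x e)))

        p : Fin size
        p = proj₁ (leaf⇒pair πx)

        x~p : x ~ p
        x~p = proj₁ (proj₂ (leaf⇒pair πx))

        p-fresh : ¬ Used p
        p-fresh (b , e) = proj₂ fresh (used (closed (FinP.toℕ<n b) (~-sym (subst (x ~_) (sym e) x~p))))

        place′ : ℕ → Fin size
        place′ c with c ℕP.<? k | c ℕP.≟ k
        ... | yes _ | _ = place c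
        ... | no _ | yes _ = x
        ... | no _ | no _ = p

        place′-old : ∀ {c} → c ℕ.< k → place′ c ≡ place c
        place′-old {c} c<k with c ℕP.<? k | c ℕP.≟ k
        ... | yes _ | _ = refl
        ... | no c≮k | _ = ⊥-elim (c≮k c<k)

        place′-x : place′ k ≡ x
        place′-x with k ℕP.<? k | k ℕP.≟ k
        ... | yes k<k | _ = ⊥-elim (ℕP.n≮n k k<k)
        ... | no _ | yes _ = refl
        ... | no _ | no k≢k = ⊥-elim (k≢k refl)

        place′-p : place′ (suc k) ≡ p
        place′-p with suc k ℕP.<? k | suc k ℕP.≟ k
        ... | yes lt | _ = ⊥-elim (ℕP.<⇒≱ lt (ℕP.n≤1+n k))
        ... | no _ | yes e = ⊥-elim (ℕP.1+n≢n e)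
        ... | no _ | no _ = refl

        data Position : ℕ → Set where
          old    : ∀ {c} → c ℕ.< k → Position c
          first  : Position k
          second : Position (suc k)

        position : ∀ {c} → c ℕ.< suc (suc k) → Position c
        position c<2+k with ℕP.m<1+n⇒m<n∨m≡n c<2+k
        ... | inj₂ refl = second
        ... | inj₁ c<1+k with ℕP.m<1+n⇒m<n∨m≡n c<1+k
        ...   | inj₂ refl = first
        ...   | inj₁ c<k = old c<k

        old≢ : ∀ {c y} → c ℕ.< k → ¬ Used y → place′ c ≢ y
        old≢ {c} c<k ¬u e = ¬u (used (c , c<k , trans (sym (place′-old c<k)) e))

        result : Partial (suc (suc k))
        result = record
          { place = place′
          ; injective = λ a< b< → inj′ (position a<) (position b<)
          ; closed = λ a< → closed′ (position a<)
          ; covers = λ y πy → keep (covers y πy)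
          ; links = λ a< b< → links′ (position a<) (position b<)
          }
          where
          keep : ∀ {y} → (∃ λ b → b ℕ.< k × place b ≡ y) → ∃ λ b → b ℕ.< suc (suc k) × place′ b ≡ y
          keep (b , b<k , e) = b , ℕP.m<n⇒m<1+n (ℕP.m<n⇒m<1+n b<k) , trans (place′-old b<k) e
          inj′ : ∀ {a b} → Position a → Position b → place′ a ≡ place′ b → a ≡ b
          inj′ (old a<k) (old b<k) e = injective a<k b<k (trans (sym (place′-old a<k)) (trans e (place′-old b<k)))
          inj′ (old a<k) first e = ⊥-elim (old≢ a<k (proj₂ fresh) (trans e place′-x))
          inj′ (old a<k) second e = ⊥-elim (old≢ a<k p-fresh (trans e place′-p))
          inj′ first (old b<k) e = ⊥-elim (old≢ b<k (proj₂ fresh) (trans (sym e) place′-x))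
          inj′ second (old b<k) e = ⊥-elim (old≢ b<k p-fresh (trans (sym e) place′-p))
          inj′ first first e = refl
          inj′ second second e = refl
          inj′ first second e = ⊥-elim (~⇒≢ x~p (trans (sym place′-x) (trans e place′-p)))
          inj′ second first e = ⊥-elim (~⇒≢ x~p (trans (sym place′-x) (trans (sym e) place′-p)))
          closed′ : ∀ {a y} → Position a → place′ a ~ y → ∃ λ b → b ℕ.< suc (suc k) × place′ b ≡ y
          closed′ {y = y} (old a<k) ay = keep (closed a<k (subst (_~ y) (place′-old a<k) ay))
          closed′ {y = y} first xy = suc k , ℕP.n<1+n (suc k) , trans place′-p (sym (proj₁ (proj₂ (proj₂ (leaf⇒pair πx))) (subst (_~ y) place′-x xy)))
          closed′ {y = y} second py = k , ℕP.m<n⇒m<1+n (ℕP.n<1+n k) , trans place′-x (sym (proj₂ (proj₂ (proj₂ (leaf⇒pair πx))) (subst (_~ y) place′-p py)))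
          -- As `k - s` is even, no matching edge straddles the border between old and new
          -- positions.
          no-odd : ∀ {a} → s ℕ.≤ a → (a ℕ.∸ s) ℕ.% 2 ≡ 0 → suc a ≢ k
          no-odd {a} s≤a even e with parity (a ℕ.∸ s)
          ... | inj₂ (odd , _) with trans (sym odd) even
          ...   | ()
          no-odd {a} s≤a even e | inj₁ (_ , odd) with trans (sym odd) (trans (cong (ℕ._% 2) (trans (sym (ℕP.+-∸-assoc 1 s≤a)) (trans (cong (ℕ._∸ s) e) (ℕP.m+n∸m≡n s (2 ℕ.* t))))) (trans (cong (ℕ._% 2) (ℕP.*-comm 2 t)) (DivMod.m*n%n≡0 t 2)))
          ... | ()
          below : ∀ {c} → c ℕ.< s → c ℕ.< k
          below c<s = ℕP.<-≤-trans c<s (ℕP.m≤m+n s (2 ℕ.* t))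
          old-links : ∀ {a b} → a ℕ.< k → b ℕ.< k → Edge a b → place′ a ~ place′ b
          old-links a<k b<k e = trans (cong₂ A (place′-old a<k) (place′-old b<k)) (links a<k b<k e)
          links′ : ∀ {a b} → Position a → Position b → Edge a b → place′ a ~ place′ b
          links′ _ _ e@(step b<s refl) = old-links (below (ℕP.<-trans (ℕP.n<1+n _) b<s)) (below b<s) e
          links′ _ _ e@(close refl b<s) = old-links (below (ℕP.≤-trans (ℕ.s≤s ℕ.z≤n) 3≤s)) (below (ℕP.≤-reflexive b<s)) e
          links′ (old a<k) (old b<k) e@(match _ _ _) = old-links a<k b<k e
          links′ (old a<k) first (match s≤a even e) = ⊥-elim (no-odd s≤a even (sym e))
          links′ (old a<k) second (match _ _ refl) = ⊥-elim (ℕP.n≮n k a<k)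
          links′ first (old b<k) (match _ _ refl) = ⊥-elim (ℕP.<⇒≱ b<k (ℕP.n≤1+n k))
          links′ first first (match _ _ e) = ⊥-elim (ℕP.1+n≢n (sym e))
          links′ first second (match _ _ _) = trans (cong₂ A place′-x place′-p) x~p
          links′ second (old b<k) (match _ _ refl) = ⊥-elim (ℕP.<⇒≱ b<k (ℕP.m≤n⇒m≤1+n (ℕP.n≤1+n k)))
          links′ second first (match _ _ e) = ⊥-elim (ℕP.<⇒≢ (ℕP.m<n⇒m<1+n (ℕP.n<1+n k)) e)
          links′ second second (match _ _ e) = ⊥-elim (ℕP.1+n≢n (sym e))

      embed : ∀ t → t ℕ.≤ q → Partial (s ℕ.+ 2 ℕ.* t)
      embed zero _ = subst Partial (sym (ℕP.+-identityʳ s)) cycle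
      embed (suc t) t<q = subst Partial (double s t) (AddPair.result t t<q (embed t (ℕP.<⇒≤ t<q)))
        where
        double : ∀ s t → suc (suc (s ℕ.+ 2 ℕ.* t)) ≡ s ℕ.+ 2 ℕ.* suc t
        double = ℕ-solve-∀

      full : Partial size
      full = embed q ℕP.≤-refl

      placement : Σ (Permutation size size) λ ρ → ∀ i → ρ ⟨$⟩ʳ i ≡ Partial.place full (toℕ i)
      placement = injective⇒permutation (λ i → Partial.place full (toℕ i))
        (λ {i} {j} e → FinP.toℕ-injective (Partial.injective full (FinP.toℕ<n i) (FinP.toℕ<n j) e))

      placement-links : ∀ {i j} → Edge (toℕ i) (toℕ j) → (proj₁ placement ⟨$⟩ʳ i) ~ (proj₁ placement ⟨$⟩ʳ j)
      placement-links {i} {j} e = trans (cong₂ A (proj₂ placement i) (proj₂ placement j)) (Partial.links full (FinP.toℕ<n i) (FinP.toℕ<n j) e)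

  equal-total⇒≈ : ∀ {n} (A B : Matrix n) → (∀ i j → B i j ≤ A i j) → ∑∑ A ≡ ∑∑ B → A ≈ B
  equal-total⇒≈ A B B≤A e i j = ℤP.i-j≡0⇒i≡j (A i j) (B i j)
    (sum-nonneg≡0 (λ j → 0≤y-x (B≤A i j)) (sum-nonneg≡0 (λ i → 0≤sum (λ j → 0≤y-x (B≤A i j))) total i) j)
    where
    total : sumℤ (λ i → sumℤ (λ j → A i j - B i j)) ≡ 0ℤ
    total = trans (sum-cong (λ i → sum-minus (A i) (B i))) (trans (sum-minus (λ i → sumℤ (A i)) (λ i → sumℤ (B i))) (ℤP.i≡j⇒i-j≡0 e))

  b2z-injective : ∀ {a b} → b2z a ≡ b2z b → a ≡ b
  b2z-injective {true} {true} _ = refl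
  b2z-injective {false} {false} _ = refl

  -- Carrying edges to edges is enough: both inner graphs have equally many, so no non-edge can
  -- become an edge.
  cone-isomorphism : ∀ {n} {H G : SimpleGraph (suc n)} → IsCone H → IsCone G → (ρ : Permutation n n) →
    (∀ i j → inner G i j ≡ 1ℤ → inner H (ρ ⟨$⟩ʳ i) (ρ ⟨$⟩ʳ j) ≡ 1ℤ) → ∑∑ (inner H) ≡ ∑∑ (inner G) → Isomorphic H G
  cone-isomorphism {n} {H} {G} coneH coneG ρ linked same-size = flip L , λ i j →
    trans (cong₂ (adj H) (sym (inverseʳ L)) (sym (inverseʳ L))) (b2z-injective (full-equal (L ⟨$⟩ˡ i) (L ⟨$⟩ˡ j)))
    where
    H-adj = inner-adjacency H
    below : ∀ i j → inner G i j ≤ inner H (ρ ⟨$⟩ʳ i) (ρ ⟨$⟩ʳ j)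
    below i j with Adjacency.binary (inner-adjacency G) i j
    ... | inj₁ e = subst (_≤ inner H (ρ ⟨$⟩ʳ i) (ρ ⟨$⟩ʳ j)) (sym e) (Adjacency.0≤A H-adj (ρ ⟨$⟩ʳ i) (ρ ⟨$⟩ʳ j))
    ... | inj₂ e = ℤP.≤-reflexive (trans e (sym (linked i j e)))
    inner-equal : ∀ i j → inner H (ρ ⟨$⟩ʳ i) (ρ ⟨$⟩ʳ j) ≡ inner G i j
    inner-equal = equal-total⇒≈ (λ i j → inner H (ρ ⟨$⟩ʳ i) (ρ ⟨$⟩ʳ j)) (inner G) below
      (trans (sum-cong (λ i → sum-permute (inner H (ρ ⟨$⟩ʳ i)) ρ)) (trans (sum-permute (deg (inner H)) ρ) same-size))
    L : Permutation (suc n) (suc n)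
    L = lift₀ ρ
    full-equal : ∀ i j → adjMatrix H (L ⟨$⟩ʳ i) (L ⟨$⟩ʳ j) ≡ adjMatrix G i j
    full-equal zero zero = trans (Adjacency.loopless (adjMatrix-adjacency H) zero) (sym (Adjacency.loopless (adjMatrix-adjacency G) zero))
    full-equal zero (suc j) = trans (IsCone.apex coneH (ρ ⟨$⟩ʳ j)) (sym (IsCone.apex coneG j))
    full-equal (suc i) zero = trans (IsCone.apex′ coneH (ρ ⟨$⟩ʳ i)) (sym (IsCone.apex′ coneG i))
    full-equal (suc i) (suc j) = inner-equal i j

  cone-degree-sum : ∀ {n} {G : SimpleGraph (suc n)} (cone : IsCone G) →
    sumℤ (degrees G) ≡ pos n + (pos n * pos 3 - sumℤ (IsCone.leaf cone))
  cone-degree-sum {n} cone = cong₂ _+_ degree-apex (trans (sum-cong degree-inner)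
      (trans (sum-minus (λ _ → pos 3) leaf) (cong (_- sumℤ leaf) (sum-const n (pos 3)))))
    where open IsCone cone

  module ConeCase (s q : ℕ) (3≤s : 3 ℕ.≤ s) (H : SimpleGraph (suc (s ℕ.+ 2 ℕ.* q))) (coneH : IsCone H)
    (cospectral : QCospectral H (KCK s q)) where
    private
      module C = CanonicalGraph s q 3≤s
      n = C.size
      module K = SmallDegree C.A-adj C.small
      module S = SmallDegree (inner-adjacency H) (IsCone.small coneH)
      module KE = CodegreeExcess C.A-adj C.small
      module SE = CodegreeExcess (inner-adjacency H) (IsCone.small coneH)
      module I = ConeInvariants {H = H} {KCK s q} cospectral coneH C.cone

      sameΠ : S.Π ≡ K.Π
      sameΠ = trans (expose (pos n) S.Π) (trans (cong (λ u → pos n + pos n * pos 3 - u)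
          (trans (sym (cone-degree-sum {G = H} coneH)) (trans (same-moment₁ {H = H} {KCK s q} cospectral) (cone-degree-sum {G = KCK s q} C.cone)))) (sym (expose (pos n) K.Π)))
        where
        expose : ∀ n p → p ≡ n + n * pos 3 - (n + (n * pos 3 - p))
        expose = solve-∀

      interior-count-K : pos n - K.Π ≡ pos s
      interior-count-K = trans (cong₂ _-_ C.size≡ C.leaf-count) (cancel (pos s) (pos q))
        where
        cancel : ∀ s q → s + pos 2 * q - pos 2 * q ≡ s
        cancel = solve-∀

      s≢0 : pos s ≢ 0ℤ
      s≢0 e = ℕP.<⇒≢ (ℕP.≤-trans (ℕ.s≤s ℕ.z≤n) 3≤s) (sym (ℤP.+-injective e))

      -- `Nonsingular` needs the structure of the graph, so it is applied to the canonical one; the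
      -- value of the determinant carries the result over to `H`.
      rigid : det (charMatrix (HubMatrix.B₀ (inner-adjacency H) (IsCone.small coneH)) (pos 2)) ≢ 0ℤ
      rigid e = HubMatrix.Nonsingular.nonsingular C.A-adj C.small C.unmixed C.connected
        (λ z → s≢0 (trans (sym interior-count-K) z)) (trans (sym (I.same-det (pos 2))) e)

      Λ-K : K.Λ ≡ K.Π
      Λ-K = trans KE.Λ≡ (trans (cong (_-_ K.Π) (KE.unmixed⇒mixing≡0 C.unmixed)) (ℤP.+-identityʳ K.Π))

      Λ-S : S.Λ ≡ K.Π - SE.mixing
      Λ-S = trans SE.Λ≡ (cong (_- SE.mixing) sameΠ)

      -- In the canonical graph leaves are adjacent to leaves only, so its `Λ` is `Π`; in `H` it is
      -- `Π - mixing`. The invariance of `Q₄ + 2 Λ` turns this deficit into additional 4-cycles.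
      excess-balance : SE.totalExcess ≡ KE.totalExcess + pos 2 * SE.mixing
      excess-balance = trans (expose SE.totalExcess (pos 6 * pos n - pos 5 * K.Π) K.Π SE.mixing)
        (trans (cong (λ u → u - (pos 6 * pos n - pos 5 * K.Π) - pos 2 * (K.Π - SE.mixing))
          (trans (sym (cong₂ (λ u v → u + pos 2 * v) (trans SE.Q₄≡ (cong (λ u → SE.totalExcess + (pos 6 * pos n - pos 5 * u)) sameΠ)) Λ-S))
            (trans (I.same-Q₄ sameΠ) (cong₂ (λ u v → u + pos 2 * v) KE.Q₄≡ Λ-K))))
          (finish KE.totalExcess (pos 6 * pos n - pos 5 * K.Π) K.Π SE.mixing))
        where
        expose : ∀ x c p m → x ≡ (x + c + pos 2 * (p - m)) - c - pos 2 * (p - m)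
        expose = solve-∀
        finish : ∀ x c p m → (x + c + pos 2 * p) - c - pos 2 * (p - m) ≡ x + pos 2 * m
        finish = solve-∀

      Q₅-balance : S.Q₅ ≡ K.Q₅ + pos 20 * SE.mixing
      Q₅-balance = trans (expose S.Q₅ K.Π SE.mixing)
        (trans (cong (λ u → u - pos 20 * (K.Π - SE.mixing))
          (trans (cong (λ v → S.Q₅ + pos 20 * v) (sym Λ-S)) (trans (I.same-Q₅ sameΠ) (cong (λ v → K.Q₅ + pos 20 * v) Λ-K))))
          (finish K.Q₅ K.Π SE.mixing))
        where
        expose : ∀ x p m → x ≡ (x + pos 20 * (p - m)) - pos 20 * (p - m)
        expose = solve-∀
        finish : ∀ x p m → (x + pos 20 * p) - pos 20 * (p - m) ≡ x + pos 20 * m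
        finish = solve-∀

      -- Used contrapositively: a positive `mixing` makes both `totalExcess` and `Q₅` of `H`
      -- nonzero.
      vanish : ∀ {x y} c → c ≢ 0ℤ → 0ℤ ≤ c → 0ℤ ≤ x → y ≡ x + c * SE.mixing → y ≡ 0ℤ → SE.mixing ≡ 0ℤ
      vanish {x} c c≢0 0≤c 0≤x e y≡0 = i*j≡0⇒ c c≢0 (proj₂ (0≤x,0≤y,x+y≡0 0≤x (0≤-* 0≤c SE.0≤mixing) (trans (sym e) y≡0)))

      mixing≡0 : SE.mixing ≡ 0ℤ
      mixing≡0 with SE.mixing ℤP.≟ 0ℤ
      ... | yes e = e
      ... | no mixing≢0 = ⊥-elim (Cycles.excess-or-Q₅-vanishes (inner-adjacency H) (IsCone.small coneH) rigid
        (λ e → mixing≢0 (vanish (pos 2) (λ ()) (0≤pos 2) KE.0≤totalExcess excess-balance e))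
        (λ e → mixing≢0 (vanish (pos 20) (λ ()) (0≤pos 20) KE.Q₅-nonneg Q₅-balance e)))

      module X = Embedding.Extend s q 3≤s (inner-adjacency H) (IsCone.small coneH) rigid (SE.mixing≡0⇒unmixed mixing≡0)
        (trans (cong (_-_ (pos n)) sameΠ) interior-count-K)

      linked : ∀ i j → C.A i j ≡ 1ℤ → inner H (proj₁ X.placement ⟨$⟩ʳ i) (proj₁ X.placement ⟨$⟩ʳ j) ≡ 1ℤ
      linked i j e = from-link (C.A⇒linked i j e)
        where
        from-link : C.Linked (toℕ i) (toℕ j) → inner H (proj₁ X.placement ⟨$⟩ʳ i) (proj₁ X.placement ⟨$⟩ʳ j) ≡ 1ℤ
        from-link (inj₁ l) = X.placement-links l
        from-link (inj₂ l) = trans (Adjacency.symm (inner-adjacency H) (proj₁ X.placement ⟨$⟩ʳ i) (proj₁ X.placement ⟨$⟩ʳ j)) (X.placement-links l)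

    isomorphic : Isomorphic H (KCK s q)
    isomorphic = cone-isomorphism {H = H} {KCK s q} coneH C.cone (proj₁ X.placement) linked
      (trans S.sum-e (trans (cong (_-_ (pos 2 * pos n)) sameΠ) (sym K.sum-e)))

  module GeneralCase (s q : ℕ) (3≤s : 3 ℕ.≤ s) (15≤size : 15 ℕ.≤ s ℕ.+ 2 ℕ.* q)
    (H : SimpleGraph (suc (s ℕ.+ 2 ℕ.* q))) (cospectral : QCospectral H (KCK s q)) where
    private
      module C = CanonicalGraph s q 3≤s
      module M = IsCone.Moments C.cone (pos s) (pos q) C.size≡ C.leaf-count
      module D = DegreeSequence (adjMatrix-adjacency H) (pos s) (pos q) (0≤pos q) C.size≡ (ℤ.+≤+ 15≤size)
        (trans (same-moment₁ {H = H} {KCK s q} cospectral) M.moment₁)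
        (trans (same-moment₂ {H = H} {KCK s q} cospectral) M.moment₂)
        (ℤP.≤-trans M.moment₃ (ℤP.≤-reflexive (sym (same-moment₃ {H = H} {KCK s q} cospectral))))

      ρ : Permutation (suc C.size) (suc C.size)
      -- Moves a vertex of maximal degree to position `0`, where `IsCone` expects the apex.
      ρ = transpose zero D.h

      apart : ∀ i → ρ ⟨$⟩ʳ suc i ≢ D.h
      apart i e = suc≢zero (trans (sym (inverseˡ ρ {suc i})) (trans (cong (ρ ⟨$⟩ˡ_) e) (inverseˡ ρ {zero})))
        where
        suc≢zero : ∀ {m} {i : Fin m} → Fin.suc i ≢ zero
        suc≢zero ()

      H₀ : SimpleGraph (suc C.size)
      H₀ = relabel ρ H

      apex : ∀ i → adjMatrix H₀ zero (suc i) ≡ 1ℤ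
      apex i = D.hub-adjacent (ρ ⟨$⟩ʳ suc i) (apart i)

      cone : IsCone H₀
      cone = record { apex = apex ; small = λ i → small i (D.other-degrees (ρ ⟨$⟩ʳ suc i) (apart i)) }
        where
        inner-degree : ∀ i → deg (inner H₀) i ≡ degrees H (ρ ⟨$⟩ʳ suc i) - 1ℤ
        inner-degree i = trans (expose (deg (inner H₀) i)) (cong (_- 1ℤ)
          (trans (cong (_+ deg (inner H₀) i) (sym (trans (Adjacency.symm (adjMatrix-adjacency H₀) (suc i) zero) (apex i)))) (degrees-relabel ρ H (suc i))))
          where
          expose : ∀ x → x ≡ (1ℤ + x) - 1ℤ
          expose = solve-∀
        small : ∀ i → degrees H (ρ ⟨$⟩ʳ suc i) ≡ pos 2 ⊎ degrees H (ρ ⟨$⟩ʳ suc i) ≡ pos 3 → deg (inner H₀) i ≡ pos 1 ⊎ deg (inner H₀) i ≡ pos 2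
        small i (inj₁ e) = inj₁ (trans (inner-degree i) (cong (_- 1ℤ) e))
        small i (inj₂ e) = inj₂ (trans (inner-degree i) (cong (_- 1ℤ) e))

    isomorphic : Isomorphic H (KCK s q)
    isomorphic = isomorphic-relabel ρ {H} {KCK s q} (ConeCase.isomorphic s q 3≤s H₀ cone (λ x → trans (charQ-relabel ρ H x) (cospectral x)))

open Isomorphisms

open import Data.Nat using (_+_; _*_; _≤_)

theorem1p1 : (q s : ℕ) → 3 ≤ s → 16 ≤ 1 + s + 2 * q →
    (H : SimpleGraph (1 + s + 2 * q)) →
    QCospectral H (KCK s q) → Isomorphic H (KCK s q)
theorem1p1 q s 3≤s 16≤n H cospectral = GeneralCase.isomorphic s q 3≤s (ℕP.≤-pred 16≤n) H cospectral
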